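{- Let $\Gamma$ be a graph, let $\Gamma'\leq\Gamma$ be a subgraph of $\Gamma$ with at least one edge, and let $v$ be a positive integer such that there exists a $(K_v,\Gamma)$-design. Then the sets $\mathcal{L}_1\Gamma(v)$ and $\mathcal{L}_2\Gamma(v)$ (defined with respect to $\Gamma'$) are both non-empty.
   Context: All graphs are finite and simple; $\Gamma\leq K$ means $\Gamma$ is a subgraph of $K$ (or is isomorphic to one, when $\Gamma$ is an abstract graph). For a graph $K$ and $\Gamma\leq K$, a $(K,\Gamma)$-design is a set $\mathcal{B}$ of subgraphs of $K$, called blocks, each isomorphic to $\Gamma$, whose edge-sets partition $E(K)$. $K_n$ is the complete graph on a set of $n$ vertices (any $n$-element vertex set may be used); a $\Gamma$-design of order $n$ is a $(K_n,\Gamma)$-design. Given $\Gamma'\leq\Gamma$, a $(K,\Gamma)$-design $\mathcal{B}$ and a $(K',\Gamma')$-design $\mathcal{B}'$, a down-link from $\mathcal{B}$ to $\mathcal{B}'$ is a function $f:\mathcal{B}\to\mathcal{B}'$ such that $f(B)$ is a subgraph of $B$ for every $B\in\mathcal{B}$ (the vertex sets of $K$ and $K'$ need not coincide, and either may be the larger). For fixed $\Gamma'\leq\Gamma$ and $v$ such that a $(K_v,\Gamma)$-design exists: $\mathcal{L}_1\Gamma(v)$ is the set of all integers $n$ such that some $\Gamma$-design of order $v$ can be down-linked to a $\Gamma'$-design of order $n$; $\mathcal{L}_2\Gamma(v)$ is the set of all integers $n$ such that every $\Gamma$-design of order $v$ can be down-linked to a $\Gamma'$-design of order $n$. -}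

module Defs where

open import Level using (0ℓ) renaming (suc to lsuc)
open import Data.Nat using (ℕ; _≟_)
open import Data.Fin using (Fin)
open import Data.List using (List; length)
open import Data.List.Membership.Propositional using (_∈_)
open import Data.List.Membership.DecPropositional _≟_ using (_∈?_)
open import Data.List.Relation.Unary.Unique.Propositional using (Unique)
open import Data.Product using (Σ-syntax; ∃-syntax; ∃₂; _×_; _,_; proj₁)
open import Function.Bundles using (_⇔_)
open import Relation.Binary.Core using (Rel)
open import Relation.Binary.Definitions using (Decidable; Symmetric)
open import Relation.Binary.PropositionalEquality using (_≡_; _≢_; refl; sym)
open import Relation.Nullary using (¬_)
open import Relation.Nullary.Decidable using (_×-dec_; ¬?)
open import Relation.Unary using (Pred)

-- Vertices of all graphs are drawn from the common universe ℕ, so that graphs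
-- with different, possibly overlapping, vertex sets can be compared.
record Graph : Set₁ where
  field
    vertices : List ℕ
    unique   : Unique vertices
    Adj      : Rel ℕ 0ℓ
    adj?     : Decidable Adj
    adj-sym  : Symmetric Adj
    loopless : ∀ {x} → ¬ Adj x x
    adj⇒∈    : ∀ {x y} → Adj x y → x ∈ vertices

open Graph public

HasEdge : Graph → Set
HasEdge G = ∃₂ (Adj G)

infix 4 _⊑_ _≈ᴳ_ _≅_ _≼_

-- Subgraph in the literal sense (no relabelling).
record _⊑_ (H G : Graph) : Set where
  field
    ⊑-vertices : ∀ {x} → x ∈ vertices H → x ∈ vertices G
    ⊑-adj      : ∀ {x y} → Adj H x y → Adj G x y

open _⊑_ public

-- Equality of graphs as pairs (vertex set, edge set); the order in which the
-- vertices are listed is irrelevant.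
_≈ᴳ_ : Graph → Graph → Set
G ≈ᴳ H = (G ⊑ H) × (H ⊑ G)

-- The values of `to` and `from` outside the vertex sets are irrelevant.
record _≅_ (G H : Graph) : Set where
  field
    to      : ℕ → ℕ
    from    : ℕ → ℕ
    to-∈    : ∀ {x} → x ∈ vertices G → to x ∈ vertices H
    from-∈  : ∀ {y} → y ∈ vertices H → from y ∈ vertices G
    from∘to : ∀ {x} → x ∈ vertices G → from (to x) ≡ x
    to∘from : ∀ {y} → y ∈ vertices H → to (from y) ≡ y
    adj-⇔   : ∀ {x y} → x ∈ vertices G → y ∈ vertices G →
              Adj G x y ⇔ Adj H (to x) (to y)

-- Γ ≼ K: Γ is a subgraph of K up to isomorphism.
_≼_ : Graph → Graph → Set₁
Γ ≼ K = ∃[ H ] (H ⊑ K) × (H ≅ Γ)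

complete : (X : List ℕ) → Unique X → Graph
complete X uX = record
  { vertices = X
  ; unique   = uX
  ; Adj      = λ x y → x ∈ X × y ∈ X × x ≢ y
  ; adj?     = λ x y → (x ∈? X) ×-dec (y ∈? X) ×-dec ¬? (x ≟ y)
  ; adj-sym  = λ (x∈ , y∈ , x≢y) → y∈ , x∈ , λ y≡x → x≢y (sym y≡x)
  ; loopless = λ (_ , _ , x≢x) → x≢x refl
  ; adj⇒∈    = proj₁
  }

-- A (K,Γ)-design.  The finite set of blocks is an injectively indexed family
-- of graphs; `covered` and `disjoint` (with `block-⊑`) say that the edge sets of
-- the blocks partition the edge set of K.
record Design (K Γ : Graph) : Set₁ where
  field
    Γ≼K      : Γ ≼ K
    size     : ℕ
    block    : Fin size → Graph
    distinct : ∀ {i j} → block i ≈ᴳ block j → i ≡ j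
    block-⊑  : ∀ i → block i ⊑ K
    block-≅  : ∀ i → block i ≅ Γ
    covered  : ∀ {x y} → Adj K x y → ∃[ i ] Adj (block i) x y
    disjoint : ∀ {i j x y} → Adj (block i) x y → Adj (block j) x y → i ≡ j

open Design public

DownLink : ∀ {K Γ K′ Γ′} → Design K Γ → Design K′ Γ′ → Set
DownLink 𝓑 𝓑′ =
  Σ[ f ∈ (Fin (size 𝓑) → Fin (size 𝓑′)) ] (∀ i → block 𝓑′ (f i) ⊑ block 𝓑 i)

-- A Γ-design of order n, on an arbitrary n-element vertex set.
record DesignOfOrder (Γ : Graph) (n : ℕ) : Set₁ where
  field
    points        : List ℕ
    points-unique : Unique points
    points-length : length points ≡ n
    design        : Design (complete points points-unique) Γ

open DesignOfOrder public

𝓛₁ : (Γ Γ′ : Graph) → ℕ → Pred ℕ (lsuc 0ℓ)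
𝓛₁ Γ Γ′ v n = Σ[ 𝓑 ∈ DesignOfOrder Γ v ] Σ[ 𝓑′ ∈ DesignOfOrder Γ′ n ]
  DownLink (design 𝓑) (design 𝓑′)

𝓛₂ : (Γ Γ′ : Graph) → ℕ → Pred ℕ (lsuc 0ℓ)
𝓛₂ Γ Γ′ v n = (𝓑 : DesignOfOrder Γ v) → Σ[ 𝓑′ ∈ DesignOfOrder Γ′ n ]
  DownLink (design 𝓑) (design 𝓑′)

{-# OPTIONS --safe #-}
-- Each block of the given Γ-design contains a copy of Γ′, and these s copies are edge-disjoint; a down-link
-- exists as soon as they all are blocks of one Γ′-design.  Let e be the number of edges of Γ′, N = s e, and let p
-- be a prime with 2 N ∣ p − 1.  In the field F of p elements let H be the group of (p − 1) / N-th roots of unity: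
-- it has N cosets in F∖{0}, and −1 ∈ H.  If the points are placed injectively in F so that the N edges of the copies
-- have their differences in distinct cosets of H, then the images of the copies under x ↦ a x + b, with b ∈ F
-- and a running through H modulo ± 1, form a Γ′-design of order p.
--
-- Such a placement exists when p is large, because the cosets of H are equidistributed in the following sense:
-- for z ≠ z′ the ratio (z − y) / (z′ − y) takes each value at most once, which gives the second moment of
-- y ↦ #{z ∈ S | z − y in a given coset}, so for S of positive density this number is at least |S| / 2 N for all but
-- boundedly many y; the points are then placed greedily.  Since s ≤ v², p can be chosen independently
-- of the design.
--
-- A prime p ≡ 1 mod m is a prime modulo which a suitable integer a has order m.  It is found by splitting aᵏ − 1
-- into the parts belonging to primes with prescribed orders and estimating their sizes.
module Submission where

-- A down-link compares graphs literally, so the field elements chosen for the vertices must carry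
-- the original vertex names; all other elements receive fresh names. A coset is prescribed for
-- every pair of vertices, not only for the edges of the copies: as cosets avoid 0, the placement is
-- injective for free. Having -1 in H makes the coset of a difference independent of the order of
-- the two ends, and it is the reason for taking a modulo ± 1: a and - a give the same unordered
-- differences.
--
-- No estimate of character sums is needed. Each placed vertex shrinks the other admissible sets by
-- a factor 2 N at worst, so for k points their density stays above a constant depending on N and k
-- only, while the number of bad elements stays bounded as p grows.
--
-- In the search for the prime, a is taken divisible by every prime factor of its intended order.
-- Then no prime divides both aⁿ - 1 and (aⁿʳ - 1) / (aⁿ - 1), which is the exceptional case in the
-- usual treatment of cyclotomic values, and the sizes of the parts follow by plain division.

-- Finite sums of indicators and double counting.

module Counting where

  open import Data.Bool using (if_then_else_)
  open import Data.Nat using (ℕ; zero; suc; _+_; _*_; _≤_; _<_; z≤n; s≤s; _≤?_)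
  open import Data.Nat.Properties hiding (suc-injective)
  open import Data.Fin using (Fin; zero; suc)
  open import Data.Fin.Properties using (suc-injective) renaming (_≟_ to _≟ᶠ_)
  open import Data.List using (length; filter; tabulate)
  open import Data.Product using (∃-syntax; _×_; _,_)
  open import Function using (_∘_)
  open import Relation.Nullary using (Dec; yes; no; ¬_; does; contradiction)
  open import Relation.Nullary.Decidable using (_×-dec_)
  open import Relation.Binary.PropositionalEquality
  open import Algebra.Properties.Semiring.Sum +-*-semiring public
    using (sum; sum-cong-≗; ∑-comm; ∑-distrib-+; *-distribˡ-sum; *-distribʳ-sum)

  private
    variable
      m n : ℕ
      P Q : Set

  -- Iverson bracket: cardinalities become sums of brackets, and double counting becomes an exchange
  -- of sums.
  ⟦_⟧ : Dec P → ℕ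
  ⟦ p ⟧ = if does p then 1 else 0

  ⟦⟧-true : (p : Dec P) → P → ⟦ p ⟧ ≡ 1
  ⟦⟧-true (yes _) x = refl
  ⟦⟧-true (no ¬x) x = contradiction x ¬x

  ⟦⟧-false : (p : Dec P) → ¬ P → ⟦ p ⟧ ≡ 0
  ⟦⟧-false (yes x) ¬x = contradiction x ¬x
  ⟦⟧-false (no _)  ¬x = refl

  ⟦⟧-mono : (p : Dec P) (q : Dec Q) → (P → Q) → ⟦ p ⟧ ≤ ⟦ q ⟧
  ⟦⟧-mono (no _)  q f = z≤n
  ⟦⟧-mono (yes x) q f = ≤-reflexive (sym (⟦⟧-true q (f x)))

  ⟦⟧-cong : (p : Dec P) (q : Dec Q) → (P → Q) → (Q → P) → ⟦ p ⟧ ≡ ⟦ q ⟧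
  ⟦⟧-cong p q f g = ≤-antisym (⟦⟧-mono p q f) (⟦⟧-mono q p g)

  ⟦⟧-× : (p : Dec P) (q : Dec Q) → ⟦ p ×-dec q ⟧ ≡ ⟦ p ⟧ * ⟦ q ⟧
  ⟦⟧-× (no _)  q = refl
  ⟦⟧-× (yes _) q = sym (+-identityʳ _)

  0<⟦⟧⇒ : (p : Dec P) → 0 < ⟦ p ⟧ → P
  0<⟦⟧⇒ (yes x) _ = x

  ⟦⟧≤1 : (p : Dec P) → ⟦ p ⟧ ≤ 1
  ⟦⟧≤1 (yes _) = s≤s z≤n
  ⟦⟧≤1 (no _)  = z≤n

  sum-mono : {f g : Fin n → ℕ} → (∀ i → f i ≤ g i) → sum f ≤ sum g
  sum-mono {zero}  f≤g = z≤n
  sum-mono {suc n} f≤g = +-mono-≤ (f≤g zero) (sum-mono (f≤g ∘ suc))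

  -- The averaging principle behind every choice of a vertex: with f counting failures and g the
  -- indicator of a set, it yields a member of the set without failures.
  sum-<⇒∃< : (f g : Fin n → ℕ) → sum f < sum g → ∃[ i ] f i < g i
  sum-<⇒∃< {suc n} f g lt with suc (f zero) ≤? g zero
  ... | yes p = zero , p
  ... | no ¬p with sum-<⇒∃< (f ∘ suc) (g ∘ suc)
                  (+-cancelˡ-< (g zero) _ _ (≤-<-trans (+-monoˡ-≤ _ (≮⇒≥ ¬p)) lt))
  ... | i , q = suc i , q

  term≤sum : (f : Fin n → ℕ) → ∀ i → f i ≤ sum f
  term≤sum f zero    = m≤m+n _ _
  term≤sum f (suc i) = ≤-trans (term≤sum (f ∘ suc) i) (m≤n+m _ _)

  sum-const : ∀ n c → sum {n} (λ _ → c) ≡ n * c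
  sum-const zero    c = refl
  sum-const (suc n) c = cong (c +_) (sum-const n c)

  sum-select : (f : Fin n → ℕ) (k : Fin n) → sum (λ i → ⟦ k ≟ᶠ i ⟧ * f i) ≡ f k
  sum-select {suc n} f zero = begin
    f zero + 0 + sum (λ i → 0 * f (suc i)) ≡⟨ cong₂ _+_ (+-identityʳ (f zero)) (trans (sum-const n 0) (*-zeroʳ n)) ⟩
    f zero + 0                             ≡⟨ +-identityʳ _ ⟩
    f zero                                 ∎
    where open ≡-Reasoning
  sum-select {suc n} f (suc k) = trans
    (sum-cong-≗ {n} λ i → cong (_* f (suc i)) (⟦⟧-cong (suc k ≟ᶠ suc i) (k ≟ᶠ i) suc-injective (cong suc)))
    (sum-select (f ∘ suc) k)

  sum-select₁ : (k : Fin n) → sum (λ i → ⟦ k ≟ᶠ i ⟧) ≡ 1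
  sum-select₁ {n} k = trans (sum-cong-≗ {n} λ i → sym (*-identityʳ ⟦ k ≟ᶠ i ⟧)) (sum-select (λ _ → 1) k)

  count : {P : Fin n → Set} → (∀ i → Dec (P i)) → ℕ
  count P? = sum (λ i → ⟦ P? i ⟧)

  count-none : {P : Fin n → Set} (P? : ∀ i → Dec (P i)) → (∀ i → ¬ P i) → count P? ≡ 0
  count-none {n} P? none = trans (sum-cong-≗ λ i → ⟦⟧-false (P? i) (none i)) (trans (sum-const n 0) (*-zeroʳ n))

  count-unique : {P : Fin n → Set} (P? : ∀ i → Dec (P i)) → (∀ {i j} → P i → P j → i ≡ j) → count P? ≤ 1
  count-unique {zero}  P? uniq = z≤n
  count-unique {suc n} P? uniq with P? zero
  ... | yes p = s≤s (≤-reflexive (count-none (P? ∘ suc) λ i q → contradiction (uniq p q) λ ()))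
  ... | no ¬p = count-unique (P? ∘ suc) (λ p q → suc-injective (uniq p q))

  -- Counts the pairs (i , f i) with `P i` by rows and by columns: a column j holds at most one of
  -- them, and none unless `Q j`.
  count-injection : {P : Fin m → Set} {Q : Fin n → Set}
    (P? : ∀ i → Dec (P i)) (Q? : ∀ j → Dec (Q j)) (f : Fin m → Fin n) →
    (∀ {i} → P i → Q (f i)) → (∀ {i j} → P i → P j → f i ≡ f j → i ≡ j) →
    count P? ≤ count Q?
  count-injection {m} {n} {P} {Q} P? Q? f hit inj = begin
    sum (λ i → ⟦ P? i ⟧)
      ≡⟨ sum-cong-≗ {m} (λ i → sym (trans (sym (*-distribˡ-sum {n} ⟦ P? i ⟧ (λ j → ⟦ f i ≟ᶠ j ⟧)))
           (trans (cong (⟦ P? i ⟧ *_) (sum-select₁ (f i))) (*-identityʳ _)))) ⟩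
    sum (λ i → sum (λ j → ⟦ P? i ⟧ * ⟦ f i ≟ᶠ j ⟧))
      ≡⟨ ∑-comm {m} {n} (λ i j → ⟦ P? i ⟧ * ⟦ f i ≟ᶠ j ⟧) ⟩
    sum (λ j → sum (λ i → ⟦ P? i ⟧ * ⟦ f i ≟ᶠ j ⟧))
      ≤⟨ sum-mono (λ j → fibre j) ⟩
    sum (λ j → ⟦ Q? j ⟧) ∎
    where
    open ≤-Reasoning
    R? : ∀ j i → Dec (P i × f i ≡ j)
    R? j i = P? i ×-dec (f i ≟ᶠ j)
    fibre : ∀ j → sum (λ i → ⟦ P? i ⟧ * ⟦ f i ≟ᶠ j ⟧) ≤ ⟦ Q? j ⟧
    fibre j with Q? j
    ... | yes _ = ≤-trans (≤-reflexive (sum-cong-≗ {m} λ i → sym (⟦⟧-× (P? i) (f i ≟ᶠ j))))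
                    (count-unique (R? j) λ (p , e) (p′ , e′) → inj p p′ (trans e (sym e′)))
    ... | no ¬q = ≤-reflexive (trans (sum-cong-≗ {m} λ i → sym (⟦⟧-× (P? i) (f i ≟ᶠ j)))
                    (count-none (R? j) λ { i (p , refl) → ¬q (hit p) }))

  count≡length-filter : {A : Set} {P : A → Set} (P? : ∀ x → Dec (P x)) (f : Fin n → A) →
    count (P? ∘ f) ≡ length (filter P? (tabulate f))
  count≡length-filter {zero}  P? f = refl
  count≡length-filter {suc n} P? f with P? (f zero)
  ... | yes _ = cong suc (count≡length-filter P? (f ∘ suc))
  ... | no _  = count≡length-filter P? (f ∘ suc)

-- Finite fields of odd characteristic: Fermat's theorem and the number of roots of a polynomial.

module FiniteFields where

  open import Algebra.Bundles using (CommutativeRing)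
  open import Algebra.Structures using (IsCommutativeRing)
  open import Data.Nat as ℕ using (ℕ; zero; suc; NonZero)
  import Data.Nat.Properties as ℕ
  open import Data.Fin using (Fin; zero; suc; toℕ; punchIn)
  open import Data.Fin.Properties using (punchInᵢ≢i) renaming (_≟_ to _≟ᶠ_)
  open import Data.Fin.Permutation using (permutation)
  open import Data.List using (List; []; _∷_; length)
  open import Data.List.Relation.Unary.All as All using (All; []; _∷_)
  open import Data.List.Relation.Unary.AllPairs using ([]; _∷_)
  open import Data.List.Relation.Unary.Unique.Propositional using (Unique)
  open import Data.Product using (∃-syntax; _×_; _,_)
  open import Function using (_∘_)
  open import Relation.Nullary using (yes; no; contradiction)
  open import Relation.Binary.PropositionalEquality

  -- The order of `toℕ` has no algebraic meaning; it serves to select one element of each pair a, -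
  -- a. The axiom `1<-1` excludes characteristic 2 and the zero ring, and makes 1 the selected
  -- element of its pair.
  record FiniteField (q : ℕ) : Set where
    infix  8 -_
    infixl 7 _*_
    infixl 6 _+_
    infix 9 _⁻¹
    field
      _+_ _*_ : Fin q → Fin q → Fin q
      -_ _⁻¹  : Fin q → Fin q
      0# 1#   : Fin q
      isCommutativeRing : IsCommutativeRing _≡_ _+_ _*_ -_ 0# 1#
      ⁻¹-inverseʳ       : ∀ {x} → x ≢ 0# → x * x ⁻¹ ≡ 1#
      1<-1              : toℕ 1# ℕ.< toℕ (- 1#)

    commutativeRing : CommutativeRing _ _
    commutativeRing = record { isCommutativeRing = isCommutativeRing }

    open CommutativeRing commutativeRing public
      hiding (_+_; _*_; -_; 0#; 1#; isCommutativeRing; refl; sym; trans; setoid; Carrier; _≈_; _≉_; zero)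
    open import Algebra.Properties.Semiring.Exp semiring public using (_^_; ^-assocʳ)
    open import Algebra.Properties.CommutativeSemiring.Exp commutativeSemiring public using (^-distrib-*)
    open import Algebra.Properties.Ring ring public
      using (x[y-z]≈xy-xz; -‿distribˡ-*; -‿distribʳ-*; -‿involutive; -0#≈0#; -‿+-comm)
      renaming (x∙y⁻¹≈ε⇒x≈y to x-y≡0⇒x≡y; x≈y⇒x∙y⁻¹≈ε to x≡y⇒x-y≡0)

  module Field {q} (F : FiniteField q) where
    open FiniteField F
    open import Algebra.Properties.CommutativeMonoid.Sum *-commutativeMonoid
      using () renaming (sum to ∏; sum-cong-≗ to ∏-cong; sum-permute to ∏-permute; ∑-distrib-+ to ∏-distrib-*; sum-remove to ∏-remove; sum-replicate to ∏-const)
    open ≡-Reasoning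

    1≢0 : 1# ≢ 0#
    1≢0 1≡0 = ℕ.<⇒≢ 1<-1 (cong toℕ (trans 1≡0 (trans (sym -0#≈0#) (cong -_ (sym 1≡0)))))

    ⁻¹-cancelˡ : ∀ {x} y → x ≢ 0# → x ⁻¹ * (x * y) ≡ y
    ⁻¹-cancelˡ {x} y x≢0 = begin
      x ⁻¹ * (x * y) ≡⟨ *-assoc _ _ _ ⟨
      x ⁻¹ * x * y   ≡⟨ cong (_* y) (trans (*-comm _ _) (⁻¹-inverseʳ x≢0)) ⟩
      1# * y         ≡⟨ *-identityˡ y ⟩
      y              ∎

    ⁻¹-cancelʳ : ∀ {x} y → x ≢ 0# → x * (x ⁻¹ * y) ≡ y
    ⁻¹-cancelʳ {x} y x≢0 = trans (sym (*-assoc _ _ _)) (trans (cong (_* y) (⁻¹-inverseʳ x≢0)) (*-identityˡ y))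

    *-cancelˡ : ∀ {x y z} → x ≢ 0# → x * y ≡ x * z → y ≡ z
    *-cancelˡ {x} {y} {z} x≢0 eq = trans (sym (⁻¹-cancelˡ y x≢0)) (trans (cong (x ⁻¹ *_) eq) (⁻¹-cancelˡ z x≢0))

    *-nonzero : ∀ {x y} → x ≢ 0# → y ≢ 0# → x * y ≢ 0#
    *-nonzero x≢0 y≢0 xy≡0 = y≢0 (*-cancelˡ x≢0 (trans xy≡0 (sym (zeroʳ _))))

    ^-nonzero : ∀ {x} n → x ≢ 0# → x ^ n ≢ 0#
    ^-nonzero zero    x≢0 = 1≢0
    ^-nonzero (suc n) x≢0 = *-nonzero x≢0 (^-nonzero n x≢0)

    x-y+y≡x : ∀ x y → x - y + y ≡ x
    x-y+y≡x x y = trans (+-assoc x (- y) y) (trans (cong (x +_) (-‿inverseˡ y)) (+-identityʳ x))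

    x+y-y≡x : ∀ x y → x + y - y ≡ x
    x+y-y≡x x y = trans (+-assoc x y (- y)) (trans (cong (x +_) (-‿inverseʳ y)) (+-identityʳ x))

    neg-sub : ∀ x y → - (x - y) ≡ y - x
    neg-sub x y = trans (sym (-‿+-comm x (- y))) (trans (cong (- x +_) (-‿involutive y)) (+-comm (- x) y))

    [x+z]-[y+z]≡x-y : ∀ x y z → (x + z) - (y + z) ≡ x - y
    [x+z]-[y+z]≡x-y x y z = begin
      x + z + - (y + z)     ≡⟨ cong (x + z +_) (-‿+-comm y z) ⟨
      x + z + (- y + - z)   ≡⟨ cong (x + z +_) (+-comm (- y) (- z)) ⟩
      x + z + (- z + - y)   ≡⟨ +-assoc _ _ _ ⟨
      x + z + - z + - y     ≡⟨ cong (_- y) (x+y-y≡x x z) ⟩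
      x - y                 ∎

    [x-z]-[y-z]≡x-y : ∀ x y z → (x - z) - (y - z) ≡ x - y
    [x-z]-[y-z]≡x-y x y z = [x+z]-[y+z]≡x-y x y (- z)

    [x-y]-[x-z]≡z-y : ∀ x y z → (x - y) - (x - z) ≡ z - y
    [x-y]-[x-z]≡z-y x y z = begin
      x - y - (x - z)        ≡⟨ cong (x - y +_) (neg-sub x z) ⟩
      x - y + (z - x)        ≡⟨ +-comm _ _ ⟩
      z - x + (x - y)        ≡⟨ +-assoc _ _ _ ⟨
      z - x + x - y          ≡⟨ cong (_- y) (x-y+y≡x z x) ⟩
      z - y                  ∎

    x≢y⇒x-y≢0 : ∀ {x y} → x ≢ y → x - y ≢ 0#
    x≢y⇒x-y≢0 x≢y e = x≢y (x-y≡0⇒x≡y _ _ e)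

    ∏-nonzero : ∀ {n} (f : Fin n → Fin q) → (∀ i → f i ≢ 0#) → ∏ f ≢ 0#
    ∏-nonzero {zero}  f nz = 1≢0
    ∏-nonzero {suc n} f nz = *-nonzero (nz zero) (∏-nonzero (f ∘ suc) (nz ∘ suc))

    -- Multiplication by x permutes the field, so the product of the nonzero elements is
    -- multiplied by x ^ (q − 1) and yet unchanged.
    fermat : ∀ {n} → suc n ≡ q → ∀ {x} → x ≢ 0# → x ^ n ≡ 1#
    fermat {n} refl {x} x≢0 = begin
      x ^ n     ≡⟨ ∏-g ⟨
      ∏ g       ≡⟨ *-cancelˡ (∏-nonzero nz nz≢0) (trans (*-comm _ _) (trans (sym ∏-swap) (sym (*-identityʳ _)))) ⟩
      1#        ∎
      where
      -- `nz` replaces 0 by 1, so that its product over the whole field is that of the nonzero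
      -- elements; `g i` is the factor by which `nz` changes from i to x i.
      nz g : Fin q → Fin q
      nz i with i ≟ᶠ 0#
      ... | yes _ = 1#
      ... | no _  = i
      g i with i ≟ᶠ 0#
      ... | yes _ = 1#
      ... | no _  = x
      nz≢0 : ∀ i → nz i ≢ 0#
      nz≢0 i with i ≟ᶠ 0#
      ... | yes _   = 1≢0
      ... | no i≢0 = i≢0
      nz-* : ∀ i → nz (x * i) ≡ g i * nz i
      nz-* i with i ≟ᶠ 0# | (x * i) ≟ᶠ 0#
      ... | yes _    | yes _   = sym (*-identityˡ _)
      ... | yes refl | no xi≢0 = contradiction (zeroʳ x) xi≢0
      ... | no i≢0   | yes xi≡0 = contradiction xi≡0 (*-nonzero x≢0 i≢0)
      ... | no _     | no _    = refl
      π = permutation (x *_) (x ⁻¹ *_) (λ y → ⁻¹-cancelʳ y x≢0) (λ y → ⁻¹-cancelˡ y x≢0)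
      ∏-swap : ∏ nz ≡ ∏ g * ∏ nz
      ∏-swap = begin
        ∏ nz                     ≡⟨ ∏-permute nz π ⟩
        ∏ (λ i → nz (x * i))     ≡⟨ ∏-cong nz-* ⟩
        ∏ (λ i → g i * nz i)     ≡⟨ ∏-distrib-* g nz ⟩
        ∏ g * ∏ nz               ∎
      g-0 : g 0# ≡ 1#
      g-0 with 0# ≟ᶠ 0#
      ... | yes _ = refl
      ... | no 0≢0 = contradiction refl 0≢0
      g-≢ : ∀ i → g (punchIn 0# i) ≡ x
      g-≢ i with punchIn 0# i ≟ᶠ 0#
      ... | yes e = contradiction e (punchInᵢ≢i 0# i)
      ... | no _  = refl
      ∏-g : ∏ g ≡ x ^ n
      ∏-g = begin
        ∏ g                              ≡⟨ ∏-remove {i = 0#} g ⟩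
        g 0# * ∏ (λ i → g (punchIn 0# i)) ≡⟨ cong₂ _*_ g-0 (∏-cong g-≢) ⟩
        1# * ∏ (λ (_ : Fin n) → x)       ≡⟨ *-identityˡ _ ⟩
        ∏ (λ (_ : Fin n) → x)            ≡⟨ ∏-const n ⟩
        x ^ n                            ∎

    -- Polynomial functions of degree less than n, in Horner form. Speaking of functions up to
    -- pointwise equality suffices for counting roots and avoids a calculus of coefficients.
    IsPoly : ℕ → (Fin q → Fin q) → Set
    IsPoly zero    f = ∀ x → f x ≡ 0#
    IsPoly (suc n) f = ∃[ c ] ∃[ g ] IsPoly n g × (∀ x → f x ≡ c + x * g x)

    IsPoly-suc : ∀ n {f} → IsPoly n f → IsPoly (suc n) f
    IsPoly-suc zero    {f} f≡0 = 0# , f , f≡0 , λ x → begin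
      f x            ≡⟨ f≡0 x ⟩
      0#             ≡⟨ trans (+-identityˡ _) (zeroʳ x) ⟨
      0# + x * 0#    ≡⟨ cong (λ y → 0# + x * y) (f≡0 x) ⟨
      0# + x * f x   ∎
    IsPoly-suc (suc n) (c , g , pg , eq) = c , g , IsPoly-suc n pg , eq

    IsPoly-+* : ∀ n r {f g} → IsPoly n f → IsPoly n g → IsPoly n (λ x → f x + r * g x)
    IsPoly-+* zero r {f} {g} f≡0 g≡0 x = begin
      f x + r * g x ≡⟨ cong₂ (λ y z → y + r * z) (f≡0 x) (g≡0 x) ⟩
      0# + r * 0#   ≡⟨ trans (+-identityˡ _) (zeroʳ r) ⟩
      0#            ∎
    IsPoly-+* (suc n) r {f} {g} (c , f′ , pf , ef) (d , g′ , pg , eg) =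
      c + r * d , (λ x → f′ x + r * g′ x) , IsPoly-+* n r pf pg , λ x → begin
      f x + r * g x                               ≡⟨ cong₂ (λ y z → y + r * z) (ef x) (eg x) ⟩
      c + x * f′ x + r * (d + x * g′ x)           ≡⟨ cong (c + x * f′ x +_) (distribˡ r d _) ⟩
      c + x * f′ x + (r * d + r * (x * g′ x))     ≡⟨ interchange c _ _ _ ⟩
      c + r * d + (x * f′ x + r * (x * g′ x))     ≡⟨ cong (λ y → c + r * d + (x * f′ x + y)) (x∙yz≈y∙xz r x _) ⟩
      c + r * d + (x * f′ x + x * (r * g′ x))     ≡⟨ cong (c + r * d +_) (distribˡ x _ _) ⟨
      c + r * d + x * (f′ x + r * g′ x)           ∎
      where
      open import Algebra.Properties.CommutativeSemigroup +-commutativeSemigroup using (interchange)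
      open import Algebra.Properties.CommutativeSemigroup *-commutativeSemigroup using (x∙yz≈y∙xz)

    -- Factor theorem, by induction along the Horner form f = c + x g: f x - f r = (x - r) g x + r
    -- (g x - g r), and the last difference is divisible by x - r.
    IsPoly-root : ∀ n {f} → IsPoly (suc n) f → ∀ r →
      ∃[ h ] IsPoly n h × (∀ x → f x - f r ≡ (x - r) * h x)
    IsPoly-root zero {f} (c , g , g≡0 , ef) r = (λ _ → 0#) , (λ _ → refl) , λ x →
      trans (x≡y⇒x-y≡0 (trans (const x) (sym (const r)))) (sym (zeroʳ _))
      where
      const : ∀ x → f x ≡ c
      const x = trans (ef x) (trans (cong (λ y → c + x * y) (g≡0 x)) (trans (cong (c +_) (zeroʳ x)) (+-identityʳ c)))
    IsPoly-root (suc n) {f} (c , g , pg , ef) r with IsPoly-root n pg r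
    ... | h , ph , eh = (λ x → g x + r * h x) , IsPoly-+* (suc n) r pg (IsPoly-suc n ph) , λ x → begin
      f x - f r                                      ≡⟨ cong₂ _-_ (trans (ef x) (+-comm c _)) (trans (ef r) (+-comm c _)) ⟩
      (x * g x + c) - (r * g r + c)                  ≡⟨ [x+z]-[y+z]≡x-y _ _ c ⟩
      x * g x - r * g r                              ≡⟨ cong (_- r * g r) (x-y+y≡x (x * g x) (r * g x)) ⟨
      x * g x - r * g x + r * g x - r * g r          ≡⟨ +-assoc _ _ _ ⟩
      x * g x - r * g x + (r * g x - r * g r)        ≡⟨ cong₂ _+_ (sym ([y-z]x≈yx-zx (g x) x r)) (sym (x[y-z]≈xy-xz r _ _)) ⟩
      (x - r) * g x + r * (g x - g r)                ≡⟨ cong (λ y → (x - r) * g x + r * y) (eh x) ⟩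
      (x - r) * g x + r * ((x - r) * h x)            ≡⟨ cong ((x - r) * g x +_) (x∙yz≈y∙xz r (x - r) (h x)) ⟩
      (x - r) * g x + (x - r) * (r * h x)            ≡⟨ distribˡ (x - r) _ _ ⟨
      (x - r) * (g x + r * h x)                      ∎
      where
      open import Algebra.Properties.CommutativeSemigroup *-commutativeSemigroup using (x∙yz≈y∙xz)
      open import Algebra.Properties.Ring ring using ([y-z]x≈yx-zx)

    many-roots⇒zero : ∀ n {f} → IsPoly n f → (rs : List (Fin q)) → Unique rs →
      All (λ r → f r ≡ 0#) rs → n ℕ.≤ length rs → ∀ x → f x ≡ 0#
    many-roots⇒zero zero    f≡0 rs uniq roots n≤ x = f≡0 x
    many-roots⇒zero (suc n) {f} pf (r ∷ rs) (r∉rs ∷ uniq) (fr≡0 ∷ roots) (ℕ.s≤s n≤) x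
      with IsPoly-root n pf r
    ... | h , ph , eh = begin
      f x              ≡⟨ root-free x ⟨
      f x - f r        ≡⟨ eh x ⟩
      (x - r) * h x    ≡⟨ cong ((x - r) *_) (many-roots⇒zero n ph rs uniq (roots-h r∉rs roots) n≤ x) ⟩
      (x - r) * 0#     ≡⟨ zeroʳ _ ⟩
      0#               ∎
      where
      root-free : ∀ x → f x - f r ≡ f x
      root-free x = trans (cong (λ y → f x - y) fr≡0) (trans (cong (f x +_) -0#≈0#) (+-identityʳ _))
      root-h : ∀ {s} → r ≢ s → f s ≡ 0# → h s ≡ 0#
      root-h {s} r≢s fs≡0 = *-cancelˡ (x≢y⇒x-y≢0 (r≢s ∘ sym))
        (trans (sym (eh s)) (trans (root-free s) (trans fs≡0 (sym (zeroʳ _)))))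
      roots-h : ∀ {ss} → All (r ≢_) ss → All (λ s → f s ≡ 0#) ss → All (λ s → h s ≡ 0#) ss
      roots-h []       []       = []
      roots-h (p ∷ ps) (e ∷ es) = root-h p e ∷ roots-h ps es

    IsPoly-^ : ∀ n → IsPoly (suc n) (λ x → x ^ n)
    IsPoly-^ zero    = 1# , (λ _ → 0#) , (λ _ → refl) , λ x → sym (trans (cong (1# +_) (zeroʳ x)) (+-identityʳ 1#))
    IsPoly-^ (suc n) = 0# , (_^ n) , IsPoly-^ n , λ x → sym (+-identityˡ _)

    -- With more than n roots, xⁿ - y would vanish everywhere, in particular at 0, where its value
    -- is - y.
    power-roots≤ : ∀ n .{{_ : NonZero n}} {y} → y ≢ 0# → (rs : List (Fin q)) → Unique rs →
      All (λ r → r ^ n ≡ y) rs → length rs ℕ.≤ n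
    power-roots≤ (suc n) {y} y≢0 rs uniq roots = ℕ.≮⇒≥ λ n<len →
      contradiction (many-roots⇒zero (suc (suc n)) poly rs uniq (All.map (λ {r} e → trans (cong (- y +_) e) (-‿inverseˡ y)) roots) n<len 0#)
        λ e → y≢0 (trans (sym (-‿involutive y)) (trans (cong -_ (trans (sym (trans (cong (- y +_) (zeroˡ _)) (+-identityʳ _))) e)) -0#≈0#))
      where
      poly : IsPoly (suc (suc n)) (λ x → - y + x ^ suc n)
      poly = - y , (_^ n) , IsPoly-^ n , λ x → refl

-- The field of integers modulo an odd prime.

module PrimeFields where

  open import Algebra.Structures using (IsCommutativeRing)
  open import Data.Nat as ℕ using (ℕ; zero; suc; NonZero; _%_; _∸_; s≤s; z≤n)
  import Data.Nat.Properties as ℕ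
  open import Data.Nat.DivMod using (_mod_; m%n<n; m<n⇒m%n≡m; n%n≡0; %-distribˡ-+; %-distribˡ-*; [m+kn]%n≡m%n)
  open import Data.Nat.Coprimality using (prime⇒coprime; coprime-Bézout)
  open import Data.Nat.GCD using (module Bézout)
  open import Data.Nat.Primality using (Prime)
  open import Data.Fin using (Fin; zero; suc; toℕ)
  open import Data.Fin.Properties using (toℕ-fromℕ<; toℕ-injective; toℕ<n)
  open import Data.Product using (∃-syntax; _,_; proj₁; proj₂)
  open import Relation.Binary.PropositionalEquality hiding ([_])
  open FiniteFields

  module ModularArithmetic (n : ℕ) where
    p = suc n

    [_] : ℕ → Fin p
    [ m ] = m mod p

    toℕ-[] : ∀ m → toℕ [ m ] ≡ m % p
    toℕ-[] m = toℕ-fromℕ< (m%n<n m p)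

    []-cong : ∀ k m → k % p ≡ m % p → [ k ] ≡ [ m ]
    []-cong k m e = toℕ-injective (trans (toℕ-[] k) (trans e (sym (toℕ-[] m))))

    []-toℕ : ∀ x → [ toℕ x ] ≡ x
    []-toℕ x = toℕ-injective (trans (toℕ-[] (toℕ x)) (m<n⇒m%n≡m (toℕ<n x)))

    infixl 7 _*_
    infixl 6 _+_
    infix 8 -_

    _+_ _*_ : Fin p → Fin p → Fin p
    x + y = [ toℕ x ℕ.+ toℕ y ]
    x * y = [ toℕ x ℕ.* toℕ y ]

    -_ : Fin p → Fin p
    - x = [ p ∸ toℕ x ]

    -- `[_]` is a homomorphism from ℕ and, by `[]-toℕ`, onto; the ring laws below are those of ℕ
    -- carried over.
    []-+ : ∀ k m → [ k ] + [ m ] ≡ [ k ℕ.+ m ]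
    []-+ k m = []-cong (toℕ [ k ] ℕ.+ toℕ [ m ]) (k ℕ.+ m) (trans (cong₂ (λ a b → (a ℕ.+ b) % p) (toℕ-[] k) (toℕ-[] m)) (sym (%-distribˡ-+ k m p)))

    []-* : ∀ k m → [ k ] * [ m ] ≡ [ k ℕ.* m ]
    []-* k m = []-cong (toℕ [ k ] ℕ.* toℕ [ m ]) (k ℕ.* m) (trans (cong₂ (λ a b → (a ℕ.* b) % p) (toℕ-[] k) (toℕ-[] m)) (sym (%-distribˡ-* k m p)))

    open ≡-Reasoning

    +-assoc : ∀ x y z → (x + y) + z ≡ x + (y + z)
    +-assoc x y z = begin
      [ a ℕ.+ b ] + z           ≡⟨ cong ([ a ℕ.+ b ] +_) ([]-toℕ z) ⟨
      [ a ℕ.+ b ] + [ c ]       ≡⟨ []-+ (a ℕ.+ b) c ⟩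
      [ a ℕ.+ b ℕ.+ c ]         ≡⟨ cong [_] (ℕ.+-assoc a b c) ⟩
      [ a ℕ.+ (b ℕ.+ c) ]       ≡⟨ []-+ a (b ℕ.+ c) ⟨
      [ a ] + [ b ℕ.+ c ]       ≡⟨ cong (_+ [ b ℕ.+ c ]) ([]-toℕ x) ⟩
      x + [ b ℕ.+ c ]           ∎
      where a = toℕ x; b = toℕ y; c = toℕ z

    *-assoc : ∀ x y z → (x * y) * z ≡ x * (y * z)
    *-assoc x y z = begin
      [ a ℕ.* b ] * z           ≡⟨ cong ([ a ℕ.* b ] *_) ([]-toℕ z) ⟨
      [ a ℕ.* b ] * [ c ]       ≡⟨ []-* (a ℕ.* b) c ⟩
      [ a ℕ.* b ℕ.* c ]         ≡⟨ cong [_] (ℕ.*-assoc a b c) ⟩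
      [ a ℕ.* (b ℕ.* c) ]       ≡⟨ []-* a (b ℕ.* c) ⟨
      [ a ] * [ b ℕ.* c ]       ≡⟨ cong (_* [ b ℕ.* c ]) ([]-toℕ x) ⟩
      x * [ b ℕ.* c ]           ∎
      where a = toℕ x; b = toℕ y; c = toℕ z

    +-comm : ∀ x y → x + y ≡ y + x
    +-comm x y = cong [_] (ℕ.+-comm (toℕ x) (toℕ y))

    *-comm : ∀ x y → x * y ≡ y * x
    *-comm x y = cong [_] (ℕ.*-comm (toℕ x) (toℕ y))

    +-identityˡ : ∀ x → [ 0 ] + x ≡ x
    +-identityˡ x = trans (cong ([ 0 ] +_) (sym ([]-toℕ x))) (trans ([]-+ 0 (toℕ x)) ([]-toℕ x))

    *-identityˡ : ∀ x → [ 1 ] * x ≡ x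
    *-identityˡ x = begin
      [ 1 ] * x          ≡⟨ cong ([ 1 ] *_) ([]-toℕ x) ⟨
      [ 1 ] * [ toℕ x ]  ≡⟨ []-* 1 (toℕ x) ⟩
      [ 1 ℕ.* toℕ x ]    ≡⟨ cong [_] (ℕ.*-identityˡ (toℕ x)) ⟩
      [ toℕ x ]          ≡⟨ []-toℕ x ⟩
      x                  ∎

    *-distribʳ-+ : ∀ x y z → (y + z) * x ≡ y * x + z * x
    *-distribʳ-+ x y z = begin
      [ b ℕ.+ c ] * x           ≡⟨ cong ([ b ℕ.+ c ] *_) ([]-toℕ x) ⟨
      [ b ℕ.+ c ] * [ a ]       ≡⟨ []-* (b ℕ.+ c) a ⟩
      [ (b ℕ.+ c) ℕ.* a ]       ≡⟨ cong [_] (ℕ.*-distribʳ-+ a b c) ⟩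
      [ b ℕ.* a ℕ.+ c ℕ.* a ]   ≡⟨ []-+ (b ℕ.* a) (c ℕ.* a) ⟨
      y * x + z * x             ∎
      where a = toℕ x; b = toℕ y; c = toℕ z

    +-inverseˡ : ∀ x → - x + x ≡ [ 0 ]
    +-inverseˡ x = begin
      - x + x                      ≡⟨ cong (- x +_) ([]-toℕ x) ⟨
      [ p ∸ toℕ x ] + [ toℕ x ]    ≡⟨ []-+ (p ∸ toℕ x) (toℕ x) ⟩
      [ p ∸ toℕ x ℕ.+ toℕ x ]      ≡⟨ cong [_] (ℕ.m∸n+n≡m (ℕ.<⇒≤ (toℕ<n x))) ⟩
      [ p ]                        ≡⟨ []-cong p 0 (n%n≡0 p) ⟩
      [ 0 ]                        ∎

    isCommutativeRing : IsCommutativeRing _≡_ _+_ _*_ -_ [ 0 ] [ 1 ]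
    isCommutativeRing = record
      { isRing = record
        { +-isAbelianGroup = record
          { isGroup = record
            { isMonoid = record
              { isSemigroup = record
                { isMagma = record { isEquivalence = isEquivalence ; ∙-cong = cong₂ _+_ }
                ; assoc = +-assoc }
              ; identity = +-identityˡ , λ x → trans (+-comm x _) (+-identityˡ x) }
            ; inverse = +-inverseˡ , λ x → trans (+-comm x _) (+-inverseˡ x)
            ; ⁻¹-cong = cong -_ }
          ; comm = +-comm }
        ; *-cong = cong₂ _*_
        ; *-assoc = *-assoc
        ; *-identity = *-identityˡ , λ x → trans (*-comm x _) (*-identityˡ x)
        ; distrib = (λ x y z → trans (*-comm x (y + z)) (trans (*-distribʳ-+ x y z) (cong₂ _+_ (*-comm y x) (*-comm z x)))) , *-distribʳ-+ }
      ; *-comm = *-comm }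

    module _ (p-prime : Prime p) (2<p : 2 ℕ.< p) where

      inverse : ∀ x → x ≢ [ 0 ] → ∃[ y ] x * y ≡ [ 1 ]
      inverse x x≢0 = help (coprime-Bézout (prime⇒coprime p-prime a<p))
        where
        a = toℕ x
        instance
          a≢0 : NonZero a
          a≢0 = ℕ.≢-nonZero λ a≡0 → x≢0 (trans (sym ([]-toℕ x)) (cong [_] a≡0))
        a<p = toℕ<n x
        module _ (t : ℕ) where
          x*[t] : x * [ t ] ≡ [ a ℕ.* t ]
          x*[t] = trans (cong (_* [ t ]) (sym ([]-toℕ x))) ([]-* a t)
        help : Bézout.Identity 1 p a → ∃[ y ] x * y ≡ [ 1 ]
        help (Bézout.-+ s t e) = [ t ] , (begin
          x * [ t ]             ≡⟨ x*[t] t ⟩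
          [ a ℕ.* t ]           ≡⟨ cong [_] (trans (ℕ.*-comm a t) (sym e)) ⟩
          [ 1 ℕ.+ s ℕ.* p ]     ≡⟨ []-cong (1 ℕ.+ s ℕ.* p) 1 ([m+kn]%n≡m%n 1 s p) ⟩
          [ 1 ]                 ∎)
        -- t * a = s * p - 1, so the inverse is - t, realised as t * n with n = p - 1.
        help (Bézout.+- s t e) = [ t ℕ.* n ] , (begin
          x * [ t ℕ.* n ]                   ≡⟨ x*[t] (t ℕ.* n) ⟩
          [ a ℕ.* (t ℕ.* n) ]               ≡⟨ []-cong (a ℕ.* (t ℕ.* n) ℕ.+ s ℕ.* p) (a ℕ.* (t ℕ.* n)) ([m+kn]%n≡m%n (a ℕ.* (t ℕ.* n)) s p) ⟨
          [ a ℕ.* (t ℕ.* n) ℕ.+ s ℕ.* p ]   ≡⟨ cong [_] (trans (cong (a ℕ.* (t ℕ.* n) ℕ.+_) (sym e)) regroup) ⟩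
          [ 1 ℕ.+ t ℕ.* a ℕ.* p ]           ≡⟨ []-cong (1 ℕ.+ t ℕ.* a ℕ.* p) 1 ([m+kn]%n≡m%n 1 (t ℕ.* a) p) ⟩
          [ 1 ]                             ∎)
          where
          regroup : a ℕ.* (t ℕ.* n) ℕ.+ (1 ℕ.+ t ℕ.* a) ≡ 1 ℕ.+ t ℕ.* a ℕ.* p
          regroup = lemma a t n
            where
            open import Data.Nat.Tactic.RingSolver using (solve-∀)
            lemma : ∀ a t n → a ℕ.* (t ℕ.* n) ℕ.+ (1 ℕ.+ t ℕ.* a) ≡ 1 ℕ.+ t ℕ.* a ℕ.* (1 ℕ.+ n)
            lemma = solve-∀

      open import Relation.Nullary using (yes; no; contradiction)
      open import Data.Fin.Properties using (_≟_)

      _⁻¹ : Fin p → Fin p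
      x ⁻¹ with x ≟ [ 0 ]
      ... | yes _   = [ 0 ]
      ... | no x≢0 = proj₁ (inverse x x≢0)

      ⁻¹-inverseʳ : ∀ {x} → x ≢ [ 0 ] → x * x ⁻¹ ≡ [ 1 ]
      ⁻¹-inverseʳ {x} x≢0 with x ≟ [ 0 ]
      ... | yes x≡0 = contradiction x≡0 x≢0
      ... | no x≢0′ = proj₂ (inverse x x≢0′)

      toℕ-1 : toℕ [ 1 ] ≡ 1
      toℕ-1 = trans (toℕ-[] 1) (m<n⇒m%n≡m (ℕ.<-trans (s≤s (s≤s z≤n)) 2<p))

      toℕ[1]<toℕ[-1] : toℕ [ 1 ] ℕ.< toℕ (- [ 1 ])
      toℕ[1]<toℕ[-1] = subst₂ ℕ._<_ (sym toℕ-1)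
        (sym (trans (toℕ-[] (p ∸ toℕ [ 1 ])) (trans (cong (λ k → (p ∸ k) % p) toℕ-1) (m<n⇒m%n≡m (ℕ.n<1+n n)))))
        (ℕ.s<s⁻¹ 2<p)

      primeField : FiniteField p
      primeField = record
        { isCommutativeRing = isCommutativeRing
        ; _⁻¹ = _⁻¹
        ; ⁻¹-inverseʳ = ⁻¹-inverseʳ
        ; 1<-1 = toℕ[1]<toℕ[-1]
        }

      open FiniteField primeField using (_^_)

      []-^ : ∀ a k → [ a ] ^ k ≡ [ a ℕ.^ k ]
      []-^ a zero    = refl
      []-^ a (suc k) = trans (cong ([ a ] *_) ([]-^ a k)) ([]-* a (a ℕ.^ k))

      little-fermat : ∀ a → a % p ≢ 0 → (a ℕ.^ n) % p ≡ 1
      little-fermat a a%p≢0 = begin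
        (a ℕ.^ n) % p      ≡⟨ toℕ-[] (a ℕ.^ n) ⟨
        toℕ [ a ℕ.^ n ]    ≡⟨ cong toℕ ([]-^ a n) ⟨
        toℕ ([ a ] ^ n)    ≡⟨ cong toℕ (Field.fermat primeField refl [a]≢0) ⟩
        toℕ [ 1 ]          ≡⟨ toℕ-1 ⟩
        1                  ∎
        where
        [a]≢0 : [ a ] ≢ [ 0 ]
        [a]≢0 e = a%p≢0 (trans (sym (toℕ-[] a)) (trans (cong toℕ e) (toℕ-[] 0)))

-- A prime congruent to 1 modulo a given number, by factoring numbers aⁿ - 1.

module PrimesInProgression where

  open import Data.Nat
  open import Data.Nat.Properties
  open import Data.Nat.Divisibility
  open import Data.Nat.DivMod using (m≡m%n+[m/n]*n)
  open import Data.Nat.GCD using (gcd; gcd-GCD; gcd[m,n]∣m; gcd[m,n]∣n; module Bézout)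
  open import Data.Nat.Coprimality using (Coprime; coprime-Bézout)
  open import Data.Nat.Primality
  open import Data.Nat.Primality.Factorisation
  open import Data.Nat.ListAction using (product)
  open import Data.Nat.ListAction.Properties using (product-++; product-↭; ∈⇒∣product)
  open import Data.Nat.Tactic.RingSolver using (solve-∀)
  open import Data.List using (List; []; _∷_; _++_; filter; upTo)
  open import Data.List.Properties using (filter-++; filter-none)
  open import Data.List.Membership.Propositional using (_∈_)
  open import Data.List.Membership.Propositional.Properties using (∈-filter⁺; ∈-filter⁻; ∈-upTo⁺)
  open import Data.List.Relation.Binary.Permutation.Propositional using (_↭_)
  open import Data.List.Relation.Binary.Permutation.Propositional.Properties using (filter-↭)
  open import Data.List.Relation.Unary.All as All using (All; []; _∷_)
  open import Data.List.Relation.Unary.All.Properties using (++⁺; all-filter)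
  open import Data.List.Relation.Unary.AllPairs using ([]; _∷_)
  open import Data.List.Relation.Unary.Any using (here; there)
  open import Data.List.Relation.Unary.Unique.Propositional using (Unique)
  open import Data.List.Relation.Unary.Unique.Propositional.Properties using (filter⁺; upTo⁺)
  open import Data.Product using (∃-syntax; _×_; _,_; proj₁; proj₂)
  open import Data.Sum using (inj₁; inj₂)
  open import Data.Unit using (⊤; tt)
  open import Function using (_⇔_; mk⇔; Equivalence)
  open import Relation.Nullary using (Dec; yes; no; ¬_; contradiction)
  open import Relation.Nullary.Decidable using (¬?; _×-dec_)
  open import Relation.Binary.PropositionalEquality
  open PrimeFields

  factorList : ℕ → List ℕ
  factorList zero      = []
  factorList n@(suc _) = factors (factorise n)

  factorList-product : ∀ n .{{_ : NonZero n}} → product (factorList n) ≡ n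
  factorList-product n@(suc _) = sym (PrimeFactorisation.isFactorisation (factorise n))

  factorList-prime : ∀ n → All Prime (factorList n)
  factorList-prime zero      = []
  factorList-prime n@(suc _) = PrimeFactorisation.factorsPrime (factorise n)

  factorList-↭ : ∀ n .{{_ : NonZero n}} {ps} → n ≡ product ps → All Prime ps → factorList n ↭ ps
  factorList-↭ n@(suc _) eq ps-prime =
    factorisationUnique (factorise n) (record { isFactorisation = eq ; factorsPrime = ps-prime })

  module _ {P : ℕ → Set} (P? : ∀ n → Dec (P n)) where

    product-filter-++ : ∀ xs ys → product (filter P? (xs ++ ys)) ≡ product (filter P? xs) * product (filter P? ys)
    product-filter-++ xs ys = trans (cong product (filter-++ P? xs ys)) (product-++ (filter P? xs) (filter P? ys))

    filter-cong : {Q : ℕ → Set} (Q? : ∀ n → Dec (Q n)) → ∀ {xs} → All (λ x → P x ⇔ Q x) xs → filter P? xs ≡ filter Q? xs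
    filter-cong Q? [] = refl
    filter-cong Q? {x ∷ xs} (e ∷ es) with P? x | Q? x
    ... | yes _ | yes _ = cong (x ∷_) (filter-cong Q? es)
    ... | no _  | no _  = filter-cong Q? es
    ... | yes p | no ¬q = contradiction (Equivalence.to e p) ¬q
    ... | no ¬p | yes q = contradiction (Equivalence.from e q) ¬p

  ∣m+n∣n⇒∣m : ∀ {d m n} → d ∣ m + n → d ∣ n → d ∣ m
  ∣m+n∣n⇒∣m {d} {m} {n} d∣m+n = ∣m+n∣m⇒∣n (subst (d ∣_) (+-comm m n) d∣m+n)

  prime⇒≢1 : ∀ {p} → Prime p → p ≢ 1
  prime⇒≢1 pr refl = ¬prime[1] pr

  primes-coprime : ∀ {p q} → Prime p → Prime q → p ≢ q → Coprime p q
  primes-coprime p-prime q-prime p≢q (d∣p , d∣q) with prime⇒irreducible p-prime d∣p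
  ... | inj₁ d≡1 = d≡1
  ... | inj₂ refl with prime⇒irreducible q-prime d∣q
  ...   | inj₁ d≡1 = d≡1
  ...   | inj₂ d≡q = contradiction d≡q p≢q

  -- The constant up to which `Φ` agrees with a power of a. It is squared for every further prime
  -- because there `Φ` becomes a quotient of two quantities known up to the old constant. It does
  -- not depend on a, so a can be chosen beyond it.
  slack : List ℕ → ℕ
  slack []       = 2
  slack (r ∷ rs) = slack rs * slack rs

  module PowersMinusOne (a : ℕ) (2≤a : 2 ≤ a) where

    instance
      a≢0 : NonZero a
      a≢0 = >-nonZero (≤-trans (s≤s z≤n) 2≤a)

    M : ℕ → ℕ
    M n = a ^ n ∸ 1

    suc-M : ∀ n → suc (M n) ≡ a ^ n
    suc-M n = m+[n∸m]≡n (m^n>0 a n)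

    M-+ : ∀ i j → M (i + j) ≡ a ^ i * M j + M i
    M-+ i j = suc-injective (begin
      suc (M (i + j))             ≡⟨ suc-M (i + j) ⟩
      a ^ (i + j)                 ≡⟨ ^-distribˡ-+-* a i j ⟩
      a ^ i * a ^ j               ≡⟨ cong (a ^ i *_) (suc-M j) ⟨
      a ^ i * suc (M j)           ≡⟨ *-suc (a ^ i) (M j) ⟩
      a ^ i + a ^ i * M j         ≡⟨ +-comm (a ^ i) _ ⟩
      a ^ i * M j + a ^ i         ≡⟨ cong (a ^ i * M j +_) (suc-M i) ⟨
      a ^ i * M j + suc (M i)     ≡⟨ +-suc _ _ ⟩
      suc (a ^ i * M j + M i)     ∎)
      where open ≡-Reasoning

    -- Ψ n r = (aⁿʳ − 1) / (aⁿ − 1)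
    Ψ : ℕ → ℕ → ℕ
    Ψ n zero    = 0
    Ψ n (suc r) = 1 + a ^ n * Ψ n r

    M-* : ∀ n r → M (n * r) ≡ M n * Ψ n r
    M-* n zero    = trans (cong M (*-zeroʳ n)) (sym (*-zeroʳ (M n)))
    M-* n (suc r) = begin
      M (n * suc r)                    ≡⟨ cong M (*-suc n r) ⟩
      M (n + n * r)                    ≡⟨ M-+ n (n * r) ⟩
      a ^ n * M (n * r) + M n          ≡⟨ cong (λ z → a ^ n * z + M n) (M-* n r) ⟩
      a ^ n * (M n * Ψ n r) + M n      ≡⟨ lemma (a ^ n) (M n) (Ψ n r) ⟩
      M n * (1 + a ^ n * Ψ n r)        ∎
      where
      open ≡-Reasoning
      lemma : ∀ x m y → x * (m * y) + m ≡ m * (1 + x * y)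
      lemma = solve-∀

    -- `Ψ n r` is the sum of the first r powers of aⁿ, and aⁿ ≡ 1 modulo `M n`.
    Ψ-mod : ∀ n r → ∃[ t ] Ψ n r ≡ r + t * M n
    Ψ-mod n zero = 0 , refl
    Ψ-mod n (suc r) with Ψ-mod n r
    ... | t , eq = t + r + t * M n , (begin
      1 + a ^ n * Ψ n r                       ≡⟨ cong₂ (λ x y → 1 + x * y) (sym (suc-M n)) eq ⟩
      1 + suc (M n) * (r + t * M n)           ≡⟨ lemma (M n) r t ⟩
      suc r + (t + r + t * M n) * M n         ∎)
      where
      open ≡-Reasoning
      lemma : ∀ m r t → 1 + (1 + m) * (r + t * m) ≡ 1 + r + (t + r + t * m) * m
      lemma = solve-∀

    module _ {ℓ : ℕ} where

      ∣M-* : ∀ i t → ℓ ∣ M i → ℓ ∣ M (i * t)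
      ∣M-* i t ℓ∣ = subst (ℓ ∣_) (sym (M-* i t)) (∣m⇒∣m*n (Ψ i t) ℓ∣)

      ∣M∧∣Ψ⇒∣ : ∀ n r → ℓ ∣ M n → ℓ ∣ Ψ n r → ℓ ∣ r
      ∣M∧∣Ψ⇒∣ n r ℓ∣M ℓ∣Ψ with Ψ-mod n r
      ... | t , eq = ∣m+n∣n⇒∣m (subst (ℓ ∣_) eq ℓ∣Ψ) (∣n⇒∣m*n t ℓ∣M)

      module _ (ℓ-prime : Prime ℓ) where

        ∣M⇒∤^ : ∀ n → ℓ ∣ M n → ¬ ℓ ∣ a ^ n
        ∣M⇒∤^ n ℓ∣M ℓ∣a^n = prime⇒≢1 ℓ-prime (∣1⇒≡1
          (∣m+n∣m⇒∣n (subst (ℓ ∣_) (trans (sym (suc-M n)) (+-comm 1 (M n))) ℓ∣a^n) ℓ∣M))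

        ∣M⇒∤a : ∀ n .{{_ : NonZero n}} → ℓ ∣ M n → ¬ ℓ ∣ a
        ∣M⇒∤a (suc n) ℓ∣M ℓ∣a = ∣M⇒∤^ (suc n) ℓ∣M (∣m⇒∣m*n (a ^ n) ℓ∣a)

        -- The exponents n with ℓ ∣ aⁿ - 1 are the multiples of the order of a. Closure under
        -- differences, here from `M (i + j)` ≡ aⁱ `M j` modulo `M i`, and under multiples gives
        -- closure under gcd without introducing the order itself.
        ∣M-∸ : ∀ i j → ℓ ∣ M (i + j) → ℓ ∣ M i → ℓ ∣ M j
        ∣M-∸ i j ℓ∣ij ℓ∣i with euclidsLemma (a ^ i) (M j) ℓ-prime
                                 (∣m+n∣n⇒∣m (subst (ℓ ∣_) (M-+ i j) ℓ∣ij) ℓ∣i)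
        ... | inj₁ ℓ∣a^i = contradiction ℓ∣a^i (∣M⇒∤^ i ℓ∣i)
        ... | inj₂ ℓ∣j   = ℓ∣j

        ∣M-bézout : ∀ {d i j} → Bézout.Identity d i j → ∀ t → ℓ ∣ M (t * i) → ℓ ∣ M (t * j) → ℓ ∣ M (t * d)
        ∣M-bézout {d} {i} {j} (Bézout.+- x y eq) t ℓ∣i ℓ∣j =
          ∣M-∸ (t * j * y) (t * d) (subst (λ n → ℓ ∣ M n) scaled (∣M-* (t * i) x ℓ∣i)) (∣M-* (t * j) y ℓ∣j)
          where
          open ≡-Reasoning
          scaled : t * i * x ≡ t * j * y + t * d
          scaled = begin
            t * i * x             ≡⟨ trans (*-assoc t i x) (cong (t *_) (*-comm i x)) ⟩
            t * (x * i)           ≡⟨ cong (t *_) eq ⟨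
            t * (d + y * j)       ≡⟨ lemma t d y j ⟩
            t * j * y + t * d     ∎
            where
            lemma : ∀ t d y j → t * (d + y * j) ≡ t * j * y + t * d
            lemma = solve-∀
        ∣M-bézout (Bézout.-+ x y eq) t ℓ∣i ℓ∣j = ∣M-bézout (Bézout.+- y x eq) t ℓ∣j ℓ∣i

        ∣M-gcd : ∀ {i j} → ℓ ∣ M i → ℓ ∣ M j → ℓ ∣ M (gcd i j)
        ∣M-gcd {i} {j} ℓ∣i ℓ∣j = subst (λ n → ℓ ∣ M n) (*-identityˡ (gcd i j))
          (∣M-bézout (Bézout.identity (gcd-GCD i j)) 1
            (subst (λ n → ℓ ∣ M n) (sym (*-identityˡ i)) ℓ∣i)
            (subst (λ n → ℓ ∣ M n) (sym (*-identityˡ j)) ℓ∣j))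

        ∣M-coprime : ∀ {i j} t → Coprime i j → ℓ ∣ M (t * i) → ℓ ∣ M (t * j) → ℓ ∣ M t
        ∣M-coprime t c ℓ∣i ℓ∣j = subst (λ n → ℓ ∣ M n) (*-identityʳ t) (∣M-bézout (coprime-Bézout c) t ℓ∣i ℓ∣j)

    M>0 : ∀ n .{{_ : NonZero n}} → 1 ≤ M n
    M>0 n@(suc n′) = s≤s⁻¹ (begin
      2            ≤⟨ 2≤a ⟩
      a            ≡⟨ *-identityʳ a ⟨
      a * 1        ≤⟨ *-monoʳ-≤ a (m^n>0 a n′) ⟩
      a ^ n        ≡⟨ suc-M n ⟨
      suc (M n)    ∎)
      where open ≤-Reasoning

    M-nonZero : ∀ n .{{_ : NonZero n}} → NonZero (M n)
    M-nonZero n = >-nonZero (M>0 n)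

    -- For ℓ ∣ M (k * product rs): no r ∈ rs can be cancelled from the exponent.
    Exact : List ℕ → ℕ → ℕ → Set
    Exact []       k ℓ = ⊤
    Exact (r ∷ rs) k ℓ = ¬ ℓ ∣ M (k * product rs) × Exact rs (k * r) ℓ

    exact? : ∀ rs k ℓ → Dec (Exact rs k ℓ)
    exact? []       k ℓ = yes tt
    exact? (r ∷ rs) k ℓ = ¬? (ℓ ∣? M (k * product rs)) ×-dec exact? rs (k * r) ℓ

    Exact-∤ : ∀ {ℓ r} rs k m → Exact rs k ℓ → r ∈ rs → NonZero r → m * r ≡ k * product rs → ¬ ℓ ∣ M m
    Exact-∤ {ℓ} {r} (r ∷ rs) k m (∤M , _) (here refl) r≢0 eq = subst (λ n → ¬ ℓ ∣ M n) (sym m≡) ∤M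
      where
      m≡ : m ≡ k * product rs
      m≡ = *-cancelʳ-≡ m _ r {{r≢0}} (trans eq (trans (cong (k *_) (*-comm r (product rs))) (sym (*-assoc k _ r))))
    Exact-∤ (r ∷ rs) k m (_ , ex) (there r∈) r≢0 eq =
      Exact-∤ rs (k * r) m ex r∈ r≢0 (trans eq (sym (*-assoc k r (product rs))))

    -- A factor j of the exponent prime to r does not affect whether r can be cancelled: ℓ ∣
    -- `M (t * j)` and ℓ ∣ `M (t * r)` together give ℓ ∣ `M t`.
    Exact-* : ∀ {ℓ} → Prime ℓ → ∀ rs k j → All (Coprime j) rs → ℓ ∣ M (k * product rs) →
              Exact rs (k * j) ℓ ⇔ Exact rs k ℓ
    Exact-* ℓ-prime [] k j [] ℓ∣ = mk⇔ (λ _ → tt) (λ _ → tt)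
    Exact-* {ℓ} ℓ-prime (r ∷ rs) k j (c ∷ cs) ℓ∣ = mk⇔
      (λ (∤M , ex) → (λ ℓ∣M → ∤M (subst (λ n → ℓ ∣ M n) swapʲ (∣M-* (k * product rs) j ℓ∣M))) , Equivalence.to IH (subst (λ n → Exact rs n ℓ) swapʳ ex))
      (λ (∤M , ex) → (λ ℓ∣M → ∤M (∣M-coprime ℓ-prime (k * product rs) c
                        (subst (λ n → ℓ ∣ M n) (sym swapʲ) ℓ∣M)
                        (subst (λ n → ℓ ∣ M n) (trans (cong (k *_) (*-comm r _)) (sym (*-assoc k _ r))) ℓ∣)))
                   , subst (λ n → Exact rs n ℓ) (sym swapʳ) (Equivalence.from IH ex))
      where
      swapʲ : k * product rs * j ≡ k * j * product rs
      swapʲ = *-swapʳ k (product rs) j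
        where
        *-swapʳ : ∀ x y z → x * y * z ≡ x * z * y
        *-swapʳ = solve-∀
      swapʳ : k * j * r ≡ k * r * j
      swapʳ = *-swapʳ k j r
        where
        *-swapʳ : ∀ x y z → x * y * z ≡ x * z * y
        *-swapʳ = solve-∀
      IH = Exact-* ℓ-prime rs (k * r) j cs (subst (λ n → ℓ ∣ M n) (sym (*-assoc k r (product rs))) ℓ∣)

    -- The part of M (k * product rs) supported on the primes modulo which the order of a is divisible
    -- to the full power by every r ∈ rs; it takes the place of the value of a cyclotomic polynomial.
    Φ : List ℕ → ℕ → ℕ
    Φ rs k = product (filter (exact? rs k) (factorList (M (k * product rs))))

    Primes∣a : List ℕ → Set
    Primes∣a = All (λ r → Prime r × r ∣ a)

    product≢0 : ∀ {rs} → Primes∣a rs → NonZero (product rs)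
    product≢0 good = productOfPrimes≢0 (All.map proj₁ good)

    -- Every prime factor of M n Ψ n r divides exactly one of M n and Ψ n r, since r ∣ a is prime to M n.
    Φ-step : ∀ {r rs} k .{{k≢0 : NonZero k}} → Primes∣a (r ∷ rs) → Unique (r ∷ rs) →
             Φ rs (k * r) ≡ Φ rs k * Φ (r ∷ rs) k
    Φ-step {r} {rs} k {{k≢0}} ((r-prime , r∣a) ∷ good) (r∉rs ∷ uniq) = begin
      Φ rs (k * r)                                ≡⟨ split (exact? rs (k * r)) (k * r * product rs) (n≡ k r (product rs)) ⟩
      product (filter (exact? rs (k * r)) as) * product (filter (exact? rs (k * r)) bs)
        -- On the primes of `M n` the factor r of the exponent changes nothing, being prime to `rs`;
        -- on those of `Ψ n r` exactness at r is automatic.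
        ≡⟨ cong₂ _*_ (cong product (filter-cong _ (exact? rs k) (All.tabulate on-as)))
                     (sym (cong product (filter-cong _ (exact? rs (k * r)) (All.tabulate on-bs)))) ⟩
      Φ rs k * product (filter (exact? (r ∷ rs) k) bs)
        ≡⟨ cong (Φ rs k *_) (trans (split (exact? (r ∷ rs) k) (k * (r * product rs)) (n≡′ k r (product rs)))
             (trans (cong (_* product (filter (exact? (r ∷ rs) k) bs)) (cong product (filter-none (exact? (r ∷ rs) k) (All.tabulate none-as))))
               (*-identityˡ _))) ⟨
      Φ rs k * Φ (r ∷ rs) k                       ∎
      where
      open ≡-Reasoning
      n = k * product rs
      as = factorList (M n)
      bs = factorList (Ψ n r)
      n≡ : ∀ k r p → k * r * p ≡ k * p * r
      n≡ = solve-∀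
      n≡′ : ∀ k r p → k * (r * p) ≡ k * p * r
      n≡′ = solve-∀
      instance
        n≢0 : NonZero n
        n≢0 = m*n≢0 k (product rs) {{k≢0}} {{product≢0 good}}
        r≢0 : NonZero r
        r≢0 = prime⇒nonZero r-prime
        nr≢0 : NonZero (n * r)
        nr≢0 = m*n≢0 n r
        Mn≢0 : NonZero (M n)
        Mn≢0 = M-nonZero n
        Mnr≢0 : NonZero (M (n * r))
        Mnr≢0 = M-nonZero (n * r)
        Ψ≢0 : NonZero (Ψ n r)
        Ψ≢0 = m*n≢0⇒n≢0 (M n) {{subst NonZero (M-* n r) Mnr≢0}}
      product-as-bs : M (n * r) ≡ product (as ++ bs)
      product-as-bs = trans (M-* n r) (sym (trans (product-++ as bs) (cong₂ _*_ (factorList-product (M n)) (factorList-product (Ψ n r)))))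
      split : ∀ {P : ℕ → Set} (P? : ∀ ℓ → Dec (P ℓ)) m → m ≡ n * r →
        product (filter P? (factorList (M m))) ≡ product (filter P? as) * product (filter P? bs)
      split P? m refl = trans
        (product-↭ (filter-↭ P? (factorList-↭ (M (n * r)) product-as-bs (++⁺ (factorList-prime (M n)) (factorList-prime (Ψ n r))))))
        (product-filter-++ P? as bs)
      ∈as⇒ : ∀ {ℓ} → ℓ ∈ as → Prime ℓ × ℓ ∣ M n
      ∈as⇒ ℓ∈ = All.lookup (factorList-prime (M n)) ℓ∈ , subst (_ ∣_) (factorList-product (M n)) (∈⇒∣product ℓ∈)
      ∈bs⇒ : ∀ {ℓ} → ℓ ∈ bs → Prime ℓ × ℓ ∣ Ψ n r
      ∈bs⇒ ℓ∈ = All.lookup (factorList-prime (Ψ n r)) ℓ∈ , subst (_ ∣_) (factorList-product (Ψ n r)) (∈⇒∣product ℓ∈)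
      coprimes : All (Coprime r) rs
      coprimes = All.tabulate {P = Coprime r} λ s∈ {_} → primes-coprime r-prime (proj₁ (All.lookup good s∈)) (All.lookup r∉rs s∈)
      on-as : ∀ {ℓ} → ℓ ∈ as → Exact rs (k * r) ℓ ⇔ Exact rs k ℓ
      on-as ℓ∈ = Exact-* (proj₁ (∈as⇒ ℓ∈)) rs k r coprimes (proj₂ (∈as⇒ ℓ∈))
      none-as : ∀ {ℓ} → ℓ ∈ as → ¬ Exact (r ∷ rs) k ℓ
      none-as ℓ∈ (∤M , _) = ∤M (proj₂ (∈as⇒ ℓ∈))
      on-bs : ∀ {ℓ} → ℓ ∈ bs → Exact (r ∷ rs) k ℓ ⇔ Exact rs (k * r) ℓ
      on-bs ℓ∈ = mk⇔ proj₂ λ ex → (λ ℓ∣M →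
        ∣M⇒∤a (proj₁ (∈bs⇒ ℓ∈)) n ℓ∣M (∣-trans (∣M∧∣Ψ⇒∣ n r ℓ∣M (proj₂ (∈bs⇒ ℓ∈))) r∣a)) , ex

    -- Euler's totient of the product when the primes are distinct. As in the cyclotomic case,
    -- `k * degree rs` is the expected exponent of a in `Φ rs k`: k for aᵏ - 1, and k r d - k d = k
    -- (r - 1) d when a prime r is added.
    degree : List ℕ → ℕ
    degree []       = 1
    degree (r ∷ rs) = (r ∸ 1) * degree rs

    -- Both bounds go through the induction together: `Φ-step` presents the new value as a quotient
    -- of two old ones, and a lower bound of a quotient needs an upper bound of its denominator.
    Φ-bounds : ∀ {rs} k .{{k≢0 : NonZero k}} → Primes∣a rs → Unique rs →
      a ^ (k * degree rs) ≤ slack rs * Φ rs k × Φ rs k ≤ slack rs * a ^ (k * degree rs)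
    Φ-bounds {[]} k [] [] = lower , upper
      where
      open ≤-Reasoning
      k1 = k * 1
      Φ≡ : Φ [] k ≡ M k1
      Φ≡ = trans (cong product (all-⊤ (factorList (M k1)))) (factorList-product (M k1) {{M-nonZero k1 {{m*n≢0 k 1}}}})
        where
        all-⊤ : ∀ xs → filter (exact? [] k) xs ≡ xs
        all-⊤ []       = refl
        all-⊤ (x ∷ xs) = cong (x ∷_) (all-⊤ xs)
      lower = begin
        a ^ k1             ≡⟨ suc-M k1 ⟨
        1 + M k1           ≤⟨ +-monoˡ-≤ (M k1) (M>0 k1 {{m*n≢0 k 1}}) ⟩
        M k1 + M k1        ≡⟨ cong (M k1 +_) (+-identityʳ (M k1)) ⟨
        2 * M k1           ≡⟨ cong (2 *_) Φ≡ ⟨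
        2 * Φ [] k         ∎
      upper = begin
        Φ [] k             ≡⟨ Φ≡ ⟩
        M k1               ≤⟨ m∸n≤m (a ^ k1) 1 ⟩
        a ^ k1             ≤⟨ m≤n*m (a ^ k1) 2 ⟩
        2 * a ^ k1         ∎
    Φ-bounds {r ∷ rs} k {{k≢0}} good@((r-prime , _) ∷ good′) uniq@(_ ∷ uniq′)
      with Φ-bounds {rs} k good′ uniq′ | Φ-bounds {rs} (k * r) {{m*n≢0 k r {{k≢0}} {{prime⇒nonZero r-prime}}}} good′ uniq′
    ... | A≤CX , X≤CA | BA≤CXY , XY≤CBA = lower , upper
      where
      open ≤-Reasoning
      d = degree rs
      C = slack rs
      X = Φ rs k
      Y = Φ (r ∷ rs) k
      A = a ^ (k * d)
      B = a ^ (k * ((r ∸ 1) * d))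
      instance
        A≢0 : NonZero A
        A≢0 = m^n≢0 a (k * d)
      BA : a ^ (k * r * d) ≡ B * A
      BA = begin-equality
        a ^ (k * r * d)                        ≡⟨ cong (λ z → a ^ (k * z * d)) (m+[n∸m]≡n {1} {r} (>-nonZero⁻¹ r {{prime⇒nonZero r-prime}})) ⟨
        a ^ (k * (1 + (r ∸ 1)) * d)            ≡⟨ cong (a ^_) (lemma k (r ∸ 1) d) ⟩
        a ^ (k * ((r ∸ 1) * d) + k * d)        ≡⟨ ^-distribˡ-+-* a (k * ((r ∸ 1) * d)) (k * d) ⟩
        B * A                                  ∎
        where
        lemma : ∀ k s d → k * (1 + s) * d ≡ k * (s * d) + k * d
        lemma = solve-∀
      lower : B ≤ C * C * Y
      lower = *-cancelʳ-≤ B (C * C * Y) A (begin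
        B * A              ≡⟨ BA ⟨
        a ^ (k * r * d)    ≤⟨ BA≤CXY ⟩
        C * Φ rs (k * r)   ≡⟨ cong (C *_) (Φ-step k good uniq) ⟩
        C * (X * Y)        ≤⟨ *-monoʳ-≤ C (*-monoˡ-≤ Y X≤CA) ⟩
        C * (C * A * Y)    ≡⟨ lemma C A Y ⟩
        C * C * Y * A      ∎)
        where
        lemma : ∀ C A Y → C * (C * A * Y) ≡ C * C * Y * A
        lemma = solve-∀
      upper : Y ≤ C * C * B
      upper = *-cancelʳ-≤ Y (C * C * B) A (begin
        Y * A              ≡⟨ *-comm Y A ⟩
        A * Y              ≤⟨ *-monoˡ-≤ Y A≤CX ⟩
        C * X * Y          ≡⟨ *-assoc C X Y ⟩
        C * (X * Y)        ≡⟨ cong (C *_) (Φ-step k good uniq) ⟨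
        C * Φ rs (k * r)   ≤⟨ *-monoʳ-≤ C XY≤CBA ⟩
        C * (C * a ^ (k * r * d)) ≡⟨ cong (λ z → C * (C * z)) BA ⟩
        C * (C * (B * A))  ≡⟨ lemma C A B ⟩
        C * C * B * A      ∎)
        where
        lemma : ∀ C A B → C * (C * (B * A)) ≡ C * C * B * A
        lemma = solve-∀

    degree≢0 : ∀ {rs} → Primes∣a rs → NonZero (degree rs)
    degree≢0 [] = _
    degree≢0 {r ∷ rs} ((r-prime , _) ∷ good) = m*n≢0 (r ∸ 1) (degree rs)
      {{>-nonZero (m<n⇒0<n∸m (nonTrivial⇒n>1 r {{prime⇒nonTrivial r-prime}}))}} {{degree≢0 good}}

    -- The lower bound gives a ≤ `slack rs` times `Φ rs k`, so `Φ rs k` is not 1, and a product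
    -- other than 1 has a factor.
    exact-prime : ∀ {rs} k .{{k≢0 : NonZero k}} → Primes∣a rs → Unique rs → slack rs < a →
      ∃[ ℓ ] Prime ℓ × ℓ ∣ M (k * product rs) × Exact rs k ℓ
    exact-prime {rs} k {{k≢0}} good uniq slack<a = pick _ refl
      where
      open ≤-Reasoning
      n = k * product rs
      instance
        n≢0 : NonZero n
        n≢0 = m*n≢0 k (product rs) {{k≢0}} {{product≢0 good}}
        Mn≢0 : NonZero (M n)
        Mn≢0 = M-nonZero n
      Φ≢1 : Φ rs k ≢ 1
      Φ≢1 Φ≡1 = <-irrefl refl (begin-strict
        slack rs             <⟨ slack<a ⟩
        a                    ≡⟨ *-identityʳ a ⟨
        a ^ 1                ≤⟨ ^-monoʳ-≤ a (>-nonZero⁻¹ (k * degree rs) {{m*n≢0 k (degree rs) {{k≢0}} {{degree≢0 good}}}}) ⟩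
        a ^ (k * degree rs)  ≤⟨ proj₁ (Φ-bounds k good uniq) ⟩
        slack rs * Φ rs k    ≡⟨ cong (slack rs *_) Φ≡1 ⟩
        slack rs * 1         ≡⟨ *-identityʳ (slack rs) ⟩
        slack rs             ∎)
      pick : ∀ ℓs → ℓs ≡ filter (exact? rs k) (factorList (M n)) → ∃[ ℓ ] Prime ℓ × ℓ ∣ M n × Exact rs k ℓ
      pick []       eq = contradiction (cong product (sym eq)) Φ≢1
      pick (ℓ ∷ ℓs) eq with ∈-filter⁻ (exact? rs k) {xs = factorList (M n)} (subst (ℓ ∈_) eq (here refl))
      ... | ℓ∈ , ex = ℓ , All.lookup (factorList-prime (M n)) ℓ∈ , subst (ℓ ∣_) (factorList-product (M n)) (∈⇒∣product ℓ∈) , ex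

  little-fermat-∣ : ∀ {ℓ} → Prime ℓ → 2 < ℓ → ∀ a → ¬ ℓ ∣ a → ℓ ∣ a ^ (ℓ ∸ 1) ∸ 1
  little-fermat-∣ {ℓ@(suc n)} ℓ-prime 2<ℓ a ℓ∤a = divides ((a ^ n) / ℓ) (begin
    a ^ n ∸ 1                            ≡⟨ cong (_∸ 1) (m≡m%n+[m/n]*n (a ^ n) ℓ) ⟩
    a ^ n % ℓ + a ^ n / ℓ * ℓ ∸ 1        ≡⟨ cong (λ z → z + a ^ n / ℓ * ℓ ∸ 1) (ModularArithmetic.little-fermat n ℓ-prime 2<ℓ a λ e → ℓ∤a (m%n≡0⇒n∣m a ℓ e)) ⟩
    a ^ n / ℓ * ℓ                        ∎)
    where open ≡-Reasoning

  prime-divisor : ∀ n → 1 < n → ∃[ p ] Prime p × p ∣ n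
  prime-divisor n@(suc _) 1<n = pick (factorList n) (factorList-prime n) (factorList-product n)
    where
    pick : ∀ ps → All Prime ps → product ps ≡ n → ∃[ p ] Prime p × p ∣ n
    pick []       _             eq = contradiction (sym eq) (<⇒≢ 1<n ∘ sym)
      where open import Function using (_∘_)
    pick (p ∷ ps) (p-prime ∷ _) eq = p , p-prime , subst (p ∣_) eq (m∣m*n (product ps))

  -- If ℓ ∣ aᵐ − 1 and ℓ divides no aᵐᐟʳ − 1, then a has order m modulo ℓ, hence m ∣ ℓ − 1 by Fermat.
  prime≡1-mod : ∀ m .{{_ : NonZero m}} → ∃[ p ] Prime p × 2 < p × m ∣ p ∸ 1
  prime≡1-mod m₀ = conclude (exact-prime m₀ good uniq slack<a)
    where
    open ≤-Reasoning
    rs = filter prime? (upTo (suc m₀))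
    primes : All Prime rs
    primes = all-filter prime? (upTo (suc m₀))
    uniq : Unique rs
    uniq = filter⁺ prime? (upTo⁺ (suc m₀))
    -- Exactness at `m₀` concerns this exponent. Its prime factors are all in `rs`, which holds
    -- every prime up to `m₀`, so exactness makes the order of a equal to m, a multiple of `m₀`.
    m = m₀ * product rs
    -- Three demands on a: it exceeds `slack rs`, it is divisible by every r in `rs`, and it is
    -- even, which excludes ℓ = 2.
    a = suc (slack rs) * (2 * product rs)
    instance
      Π≢0 : NonZero (product rs)
      Π≢0 = productOfPrimes≢0 primes
      2Π≢0 : NonZero (2 * product rs)
      2Π≢0 = m*n≢0 2 (product rs)
      m≢0 : NonZero m
      m≢0 = m*n≢0 m₀ (product rs)
    2≤a : 2 ≤ a
    2≤a = begin
      2                 ≤⟨ m≤m*n 2 (product rs) ⟩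
      2 * product rs    ≤⟨ m≤n*m (2 * product rs) (suc (slack rs)) ⟩
      a                 ∎
    open PowersMinusOne a 2≤a
    good : Primes∣a rs
    good = All.tabulate λ {r} r∈ → All.lookup primes r∈ , ∣n⇒∣m*n (suc (slack rs)) (∣n⇒∣m*n 2 (∈⇒∣product r∈))
    slack<a : slack rs < a
    slack<a = m≤m*n (suc (slack rs)) (2 * product rs)
    prime∣m⇒∈ : ∀ {r} → Prime r → r ∣ m → r ∈ rs
    prime∣m⇒∈ {r} r-prime r∣m with euclidsLemma m₀ (product rs) r-prime r∣m
    ... | inj₁ r∣m₀ = ∈-filter⁺ prime? (∈-upTo⁺ (s≤s (∣⇒≤ r∣m₀))) r-prime
    ... | inj₂ r∣Π  = factorisationHasAllPrimeFactors r-prime r∣Π primes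
    conclude : ∃[ ℓ ] Prime ℓ × ℓ ∣ M m × Exact rs m₀ ℓ → ∃[ p ] Prime p × 2 < p × m₀ ∣ p ∸ 1
    conclude (ℓ , ℓ-prime , ℓ∣M , ex) =
      ℓ , ℓ-prime , 2<ℓ , ∣-trans (m∣m*n (product rs)) (subst (_∣ ℓ ∸ 1) g≡m (gcd[m,n]∣n m (ℓ ∸ 1)))
      where
      ℓ∤a : ¬ ℓ ∣ a
      ℓ∤a = ∣M⇒∤a ℓ-prime m ℓ∣M
      2<ℓ : 2 < ℓ
      2<ℓ = ≤∧≢⇒< (nonTrivial⇒n>1 ℓ {{prime⇒nonTrivial ℓ-prime}})
        λ { refl → ℓ∤a (∣n⇒∣m*n (suc (slack rs)) (m∣m*n (product rs))) }
      g = gcd m (ℓ ∸ 1)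
      ℓ∣Mg : ℓ ∣ M g
      ℓ∣Mg = ∣M-gcd ℓ-prime {m} {ℓ ∸ 1} ℓ∣M (little-fermat-∣ ℓ-prime 2<ℓ a ℓ∤a)
      g≡m : g ≡ m
      g≡m with gcd[m,n]∣m m (ℓ ∸ 1)
      ... | divides 0 eq = contradiction eq (≢-nonZero⁻¹ m)
      ... | divides 1 eq = sym (trans eq (*-identityˡ g))
      -- If g is a proper divisor of m, then g divides m / r for a prime r dividing m / g, whence ℓ
      -- ∣ `M (m / r)`, against exactness.
      ... | divides t@(suc (suc _)) eq with prime-divisor t (s≤s (s≤s z≤n))
      ...   | r , r-prime , divides s t≡sr = contradiction (∣M-* g s ℓ∣Mg)
              (Exact-∤ rs m₀ (g * s) ex (prime∣m⇒∈ r-prime r∣m) (prime⇒nonZero r-prime) gsr≡m)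
        where
        gsr≡m : g * s * r ≡ m
        gsr≡m = begin-equality
          g * s * r     ≡⟨ *-assoc g s r ⟩
          g * (s * r)   ≡⟨ cong (g *_) t≡sr ⟨
          g * t         ≡⟨ *-comm g t ⟩
          t * g         ≡⟨ eq ⟨
          m             ∎
        r∣m : r ∣ m
        r∣m = divides (g * s) (sym gsr≡m)

-- Cosets of the roots of unity as colours, and the second moment of the colour degrees.

module CosetColouring where

  open import Data.Nat as ℕ using (ℕ; zero; suc; NonZero; _≤_; _<_; z≤n; s≤s; _<?_)
  import Data.Nat.Properties as ℕ
  open import Data.Nat.Tactic.RingSolver using (solve-∀)
  open import Data.Fin as Fin using (Fin; zero; suc)
  open import Data.Fin.Properties using () renaming (_≟_ to _≟ᶠ_; suc-injective to sucᶠ-injective)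
  open import Data.List using (List; length; filter; allFin; lookup)
  open import Data.List.Membership.Propositional using (_∈_)
  open import Data.List.Membership.Propositional.Properties using (∈-filter⁺; ∈-filter⁻; ∈-allFin; ∈-lookup)
  open import Data.List.Relation.Unary.All as All using (All)
  open import Data.List.Relation.Unary.All.Properties using (all-filter)
  open import Data.List.Relation.Unary.AllPairs using (_∷_)
  open import Data.List.Relation.Unary.Any using (index)
  open import Data.List.Relation.Unary.Any.Properties using (lookup-index)
  open import Data.List.Relation.Unary.Unique.Propositional using (Unique)
  open import Data.List.Relation.Unary.Unique.Propositional.Properties using (filter⁺; allFin⁺)
  open import Data.Product using (_×_; _,_; proj₂)
  open import Data.Sum using (inj₁; inj₂)
  open import Function using (_∘_; id)
  open import Relation.Nullary using (Dec; yes; no; contradiction)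
  open import Relation.Nullary.Decidable using (_×-dec_; ¬?)
  open import Relation.Binary.PropositionalEquality
  open Counting
  open FiniteFields

  lookup-unique : {A : Set} {xs : List A} → Unique xs → ∀ {i j} → lookup xs i ≡ lookup xs j → i ≡ j
  lookup-unique (x∉xs ∷ uniq) {zero}  {zero}  e = refl
  lookup-unique (x∉xs ∷ uniq) {zero}  {suc j} e = contradiction e (All.lookup x∉xs (∈-lookup j))
  lookup-unique (x∉xs ∷ uniq) {suc i} {zero}  e = contradiction (sym e) (All.lookup x∉xs (∈-lookup i))
  lookup-unique (x∉xs ∷ uniq) {suc i} {suc j} e = cong suc (lookup-unique uniq e)

  -- The colour of x ≢ 0# is its coset modulo H = {x | x ^ h ≡ 1#}, read off from x ^ h; 0# has a colour of its own.
  module Colouring {q} (F : FiniteField q) (N h : ℕ) .{{N≢0 : NonZero N}} .{{h≢0 : NonZero h}}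
                   (q≡ : suc (N ℕ.* h) ≡ q) where
    open FiniteField F
    open Field F

    power-count≤ : ∀ n .{{_ : NonZero n}} {y} → y ≢ 0# → count (λ x → x ^ n ≟ᶠ y) ≤ n
    power-count≤ n {y} y≢0 = subst (_≤ n) (sym (count≡length-filter (λ x → x ^ n ≟ᶠ y) id))
      (power-roots≤ n y≢0 _ (filter⁺ _ (allFin⁺ q)) (all-filter _ (allFin q)))

    roots : List (Fin q)
    roots = filter (λ y → y ^ N ≟ᶠ 1#) (allFin q)

    roots-unique : Unique roots
    roots-unique = filter⁺ _ (allFin⁺ q)

    0^ : ∀ n .{{_ : NonZero n}} → 0# ^ n ≡ 0#
    0^ (suc n) = zeroˡ _

    1^ : ∀ n → 1# ^ n ≡ 1#
    1^ zero    = refl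
    1^ (suc n) = trans (*-identityˡ _) (1^ n)

    ∈roots⇒≢0 : ∀ {y} → y ∈ roots → y ≢ 0#
    ∈roots⇒≢0 y∈ refl = 1≢0 (trans (sym (proj₂ (∈-filter⁻ _ {xs = allFin q} y∈))) (0^ N))

    power∈roots : ∀ {x} → x ≢ 0# → x ^ h ∈ roots
    power∈roots {x} x≢0 = ∈-filter⁺ _ (∈-allFin _)
      (trans (^-assocʳ x h N) (trans (cong (x ^_) (ℕ.*-comm h N)) (fermat q≡ x≢0)))

    -- At most N by counting roots. At least N because x ↦ xʰ sends the N h nonzero elements into
    -- `roots` with fibres of at most h elements; no primitive root is involved.
    length-roots : length roots ≡ N
    length-roots = ℕ.≤-antisym (power-roots≤ N 1≢0 roots roots-unique (all-filter _ (allFin q)))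
      (ℕ.*-cancelʳ-≤ N L h (ℕ.s≤s⁻¹ (begin
        suc (N ℕ.* h)                   ≡⟨ trans q≡ (sym (trans (sum-const q 1) (ℕ.*-identityʳ q))) ⟩
        sum {q} (λ x → 1)               ≤⟨ sum-mono covered ⟩
        sum {q} (λ x → ⟦ 0# ≟ᶠ x ⟧ ℕ.+ sum {L} (λ i → ⟦ x ^ h ≟ᶠ lookup roots i ⟧))
          ≡⟨ ∑-distrib-+ {q} (λ x → ⟦ 0# ≟ᶠ x ⟧) _ ⟩
        sum {q} (λ x → ⟦ 0# ≟ᶠ x ⟧) ℕ.+ sum {q} (λ x → sum {L} (λ i → ⟦ x ^ h ≟ᶠ lookup roots i ⟧))
          ≡⟨ cong₂ ℕ._+_ (sum-select₁ 0#) (∑-comm {q} {L} (λ x i → ⟦ x ^ h ≟ᶠ lookup roots i ⟧)) ⟩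
        1 ℕ.+ sum {L} (λ i → count (λ x → x ^ h ≟ᶠ lookup roots i))
          ≤⟨ s≤s (sum-mono (λ i → power-count≤ h (∈roots⇒≢0 (∈-lookup i)))) ⟩
        1 ℕ.+ sum {L} (λ i → h)         ≡⟨ cong suc (sum-const L h) ⟩
        suc (L ℕ.* h)                   ∎)))
      where
      open ℕ.≤-Reasoning
      L = length roots
      covered : ∀ x → 1 ≤ ⟦ 0# ≟ᶠ x ⟧ ℕ.+ sum {L} (λ i → ⟦ x ^ h ≟ᶠ lookup roots i ⟧)
      covered x with 0# ≟ᶠ x
      ... | yes _  = s≤s z≤n
      ... | no 0≢x = ℕ.≤-trans (ℕ.≤-reflexive (sym (⟦⟧-true (x ^ h ≟ᶠ lookup roots (index x∈)) (lookup-index x∈)))) (term≤sum _ (index x∈))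
        where x∈ = power∈roots (0≢x ∘ sym)

    colour : Fin q → Fin (suc N)
    colour x with x ≟ᶠ 0#
    ... | yes _   = zero
    ... | no x≢0 = suc (Fin.cast length-roots (index (power∈roots x≢0)))

    -- The value of xʰ common to all x of one colour; it is 0 for the colour of 0.
    palette : Fin (suc N) → Fin q
    palette zero    = 0#
    palette (suc i) = lookup roots (Fin.cast (sym length-roots) i)

    palette-colour : ∀ x → palette (colour x) ≡ x ^ h
    palette-colour x with x ≟ᶠ 0#
    ... | yes refl = sym (0^ h)
    ... | no x≢0  = trans (cong (lookup roots) (cast-cast length-roots (index (power∈roots x≢0)))) (sym (lookup-index (power∈roots x≢0)))
      where
      open import Data.Fin.Properties using (cast-is-id)
      cast-cast : ∀ {m n} (e : m ≡ n) i → Fin.cast (sym e) (Fin.cast e i) ≡ i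
      cast-cast refl i = trans (cast-is-id refl _) (cast-is-id refl i)

    colour≡zero⇒≡0 : ∀ {x} → colour x ≡ zero → x ≡ 0#
    colour≡zero⇒≡0 {x} e with x ≟ᶠ 0#
    ... | yes x≡0 = x≡0
    colour≡zero⇒≡0 () | no _

    colour-0 : colour 0# ≡ zero
    colour-0 with 0# ≟ᶠ 0#
    ... | yes _  = refl
    ... | no 0≢0 = contradiction refl 0≢0

    palette-injective : ∀ {c d} → palette c ≡ palette d → c ≡ d
    palette-injective {zero}  {zero}  e = refl
    palette-injective {zero}  {suc d} e = contradiction (sym e) (∈roots⇒≢0 (∈-lookup (Fin.cast (sym length-roots) d)))
    palette-injective {suc c} {zero}  e = contradiction e (∈roots⇒≢0 (∈-lookup (Fin.cast (sym length-roots) c)))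
    palette-injective {suc c} {suc d} e = cong suc (cast-injective (sym length-roots) (lookup-unique roots-unique e))
      where
      cast-injective : ∀ {m n} (e : m ≡ n) {i j : Fin m} → Fin.cast e i ≡ Fin.cast e j → i ≡ j
      cast-injective refl {i} {j} e = trans (sym (cast-is-id refl i)) (trans e (cast-is-id refl j))
        where open import Data.Fin.Properties using (cast-is-id)

    same-power⇒colour : ∀ {x y} → x ^ h ≡ y ^ h → colour x ≡ colour y
    same-power⇒colour e = palette-injective (trans (palette-colour _) (trans e (sym (palette-colour _))))

    colour-* : ∀ {a} x → a ^ h ≡ 1# → colour (a * x) ≡ colour x
    colour-* {a} x e = same-power⇒colour (trans (^-distrib-* a x h) (trans (cong (_* x ^ h) e) (*-identityˡ _)))

    colour-ratio : ∀ {x y} → y ≢ 0# → colour x ≡ colour y → (x * y ⁻¹) ^ h ≡ 1#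
    colour-ratio {x} {y} y≢0 e = begin
      (x * y ⁻¹) ^ h        ≡⟨ ^-distrib-* x (y ⁻¹) h ⟩
      x ^ h * y ⁻¹ ^ h      ≡⟨ cong (_* y ⁻¹ ^ h) (trans (sym (palette-colour x)) (trans (cong palette e) (palette-colour y))) ⟩
      y ^ h * y ⁻¹ ^ h      ≡⟨ ^-distrib-* y (y ⁻¹) h ⟨
      (y * y ⁻¹) ^ h        ≡⟨ cong (_^ h) (⁻¹-inverseʳ y≢0) ⟩
      1# ^ h                ≡⟨ 1^ h ⟩
      1#                    ∎
      where open ≡-Reasoning

    module _ {S : Fin q → Set} (S? : ∀ x → Dec (S x)) where

      degree : Fin q → Fin N → ℕ
      degree y c = count (λ z → S? z ×-dec (colour (z - y) ≟ᶠ suc c))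

      Bad : Fin q → Fin N → Set
      Bad y c = 2 ℕ.* (N ℕ.* degree y c) < count S?

      bad? : ∀ y c → Dec (Bad y c)
      bad? y c = 2 ℕ.* (N ℕ.* degree y c) <? count S?

      private
        s = count S?

        σ : Fin q → ℕ
        σ z = ⟦ S? z ⟧

        χ : Fin q → Fin N → Fin q → ℕ
        χ y c z = ⟦ colour (z - y) ≟ᶠ suc c ⟧

        degree-sum : ∀ y c → degree y c ≡ sum (λ z → σ z ℕ.* χ y c z)
        degree-sum y c = sum-cong-≗ {q} λ z → ⟦⟧-× (S? z) (colour (z - y) ≟ᶠ suc c)

        -- Every pair (y , z) with z in S is counted under exactly one colour, except the pairs y =
        -- z, whose difference 0 lies in no coset; they account for the summand s.
        Σdegree : sum (λ y → sum (degree y)) ℕ.+ s ≡ q ℕ.* s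
        Σdegree = begin
          sum (λ y → sum (degree y)) ℕ.+ sum σ     ≡⟨ ∑-distrib-+ {q} (λ y → sum (degree y)) σ ⟨
          sum (λ y → sum (degree y) ℕ.+ σ y)       ≡⟨ sum-cong-≗ {q} row ⟩
          sum {q} (λ _ → s)                        ≡⟨ sum-const q s ⟩
          q ℕ.* s                                  ∎
          where
          open ≡-Reasoning
          one : ∀ y z → ⟦ y ≟ᶠ z ⟧ ℕ.+ sum (λ c → χ y c z) ≡ 1
          one y z = trans (cong (ℕ._+ sum (λ c → χ y c z))
            (⟦⟧-cong (y ≟ᶠ z) (colour (z - y) ≟ᶠ zero)
              (λ { refl → trans (cong colour (-‿inverseʳ y)) colour-0 })
              (λ e → sym (x-y≡0⇒x≡y z y (colour≡zero⇒≡0 e)))))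
            (sum-select₁ (colour (z - y)))
          row : ∀ y → sum (degree y) ℕ.+ σ y ≡ s
          row y = begin
            sum (degree y) ℕ.+ σ y
              ≡⟨ cong₂ ℕ._+_ (trans (sum-cong-≗ {N} (degree-sum y)) (∑-comm {N} {q} (λ c z → σ z ℕ.* χ y c z))) (sym (sum-select σ y)) ⟩
            sum (λ z → sum (λ c → σ z ℕ.* χ y c z)) ℕ.+ sum (λ z → ⟦ y ≟ᶠ z ⟧ ℕ.* σ z)
              ≡⟨ ∑-distrib-+ {q} (λ z → sum (λ c → σ z ℕ.* χ y c z)) (λ z → ⟦ y ≟ᶠ z ⟧ ℕ.* σ z) ⟨
            sum (λ z → sum (λ c → σ z ℕ.* χ y c z) ℕ.+ ⟦ y ≟ᶠ z ⟧ ℕ.* σ z)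
              ≡⟨ sum-cong-≗ {q} (λ z → begin
                   sum (λ c → σ z ℕ.* χ y c z) ℕ.+ ⟦ y ≟ᶠ z ⟧ ℕ.* σ z
                     ≡⟨ cong (ℕ._+ ⟦ y ≟ᶠ z ⟧ ℕ.* σ z) (*-distribˡ-sum {N} (σ z) (λ c → χ y c z)) ⟨
                   σ z ℕ.* sum (λ c → χ y c z) ℕ.+ ⟦ y ≟ᶠ z ⟧ ℕ.* σ z
                     ≡⟨ lemma (σ z) (sum (λ c → χ y c z)) ⟦ y ≟ᶠ z ⟧ ⟩
                   σ z ℕ.* (⟦ y ≟ᶠ z ⟧ ℕ.+ sum (λ c → χ y c z))
                     ≡⟨ trans (cong (σ z ℕ.*_) (one y z)) (ℕ.*-identityʳ (σ z)) ⟩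
                   σ z ∎) ⟩
            s ∎
            where
            lemma : ∀ a b c → a ℕ.* b ℕ.+ c ℕ.* a ≡ a ℕ.* (c ℕ.+ b)
            lemma = solve-∀

        pairs : Fin q → Fin q → ℕ
        pairs z z′ = sum (λ y → sum (λ c → χ y c z ℕ.* χ y c z′))

        agree? : ∀ z z′ y → Dec (colour (z - y) ≡ colour (z′ - y) × colour (z′ - y) ≢ zero)
        agree? z z′ y = (colour (z - y) ≟ᶠ colour (z′ - y)) ×-dec ¬? (colour (z′ - y) ≟ᶠ zero)

        χχ≤ : ∀ z z′ y → sum (λ c → χ y c z ℕ.* χ y c z′) ≤ ⟦ agree? z z′ y ⟧
        χχ≤ z z′ y = go (agree? z z′ y)
         where
         both? : ∀ c → Dec (colour (z - y) ≡ suc c × colour (z′ - y) ≡ suc c)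
         both? c = (colour (z - y) ≟ᶠ suc c) ×-dec (colour (z′ - y) ≟ᶠ suc c)
         as-count : sum (λ c → χ y c z ℕ.* χ y c z′) ≡ count both?
         as-count = sum-cong-≗ {N} λ c → sym (⟦⟧-× (colour (z - y) ≟ᶠ suc c) (colour (z′ - y) ≟ᶠ suc c))
         go : (ag? : Dec (colour (z - y) ≡ colour (z′ - y) × colour (z′ - y) ≢ zero)) → sum (λ c → χ y c z ℕ.* χ y c z′) ≤ ⟦ ag? ⟧
         go (yes _)  = ℕ.≤-trans (ℕ.≤-reflexive as-count)
           (count-unique both? λ (e , _) (e′ , _) → sucᶠ-injective (trans (sym e) e′))
         go (no ¬ag) = ℕ.≤-reflexive (trans as-count (count-none both? λ c (e , e′) →
           ¬ag (trans e (sym e′) , λ e″ → contradiction (trans (sym e′) e″) λ ())))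

        -- For z ≢ z′ the map y ↦ (z - y) / (z′ - y) is injective, and it sends agreement of colours into H.
        pairs≤ : ∀ z z′ → pairs z z′ ≤ q ℕ.* ⟦ z ≟ᶠ z′ ⟧ ℕ.+ h
        pairs≤ z z′ with z ≟ᶠ z′
        ... | yes _   = begin
          pairs z z′                              ≤⟨ sum-mono (χχ≤ z z′) ⟩
          sum (λ y → ⟦ agree? z z′ y ⟧)           ≤⟨ sum-mono (λ y → ⟦⟧≤1 (agree? z z′ y)) ⟩
          sum {q} (λ y → 1)                       ≡⟨ sum-const q 1 ⟩
          q ℕ.* 1                                 ≤⟨ ℕ.m≤m+n _ h ⟩
          q ℕ.* 1 ℕ.+ h                           ∎
          where open ℕ.≤-Reasoning
        ... | no z≢z′ = begin
          pairs z z′                              ≤⟨ sum-mono (χχ≤ z z′) ⟩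
          count (agree? z z′)                     ≤⟨ count-injection (agree? z z′) (λ x → x ^ h ≟ᶠ 1#) ratio
                                                       (λ (e , nz) → colour-ratio (nz⇒≢0 nz) e)
                                                       (λ (_ , nz) (_ , nz′) → ratio-injective (nz⇒≢0 nz) (nz⇒≢0 nz′)) ⟩
          count (λ x → x ^ h ≟ᶠ 1#)               ≤⟨ power-count≤ h 1≢0 ⟩
          h                                       ≤⟨ ℕ.m≤n+m h _ ⟩
          q ℕ.* 0 ℕ.+ h                           ∎
          where
          open ℕ.≤-Reasoning
          ratio : Fin q → Fin q
          ratio y = (z - y) * (z′ - y) ⁻¹
          nz⇒≢0 : ∀ {x} → colour x ≢ zero → x ≢ 0#
          nz⇒≢0 nz refl = nz colour-0
          ratio-* : ∀ {y} → z′ - y ≢ 0# → ratio y * (z′ - y) ≡ z - y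
          ratio-* {y} ≢0 = trans (*-assoc _ _ _) (trans (cong ((z - y) *_) (trans (*-comm _ _) (⁻¹-inverseʳ ≢0))) (*-identityʳ _))
          ratio-injective : ∀ {y w} → z′ - y ≢ 0# → z′ - w ≢ 0# → ratio y ≡ ratio w → y ≡ w
          ratio-injective {y} {w} y-ok w-ok e with w ≟ᶠ y
          ... | yes w≡y = sym w≡y
          ... | no w≢y  = contradiction z≡z′ z≢z′
            where
            r = ratio y
            -- With the same ratio r at y and w, subtract r (z′ - w) = z - w from r (z′ - y) = z -
            -- y. If w ≢ y this forces r = 1, and then z = z′.
            difference : w - y ≡ r * (w - y)
            difference = trans (sym ([x-y]-[x-z]≡z-y z y w))
              (trans (sym (cong₂ _-_ (ratio-* y-ok) (trans (cong (_* (z′ - w)) e) (ratio-* w-ok))))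
              (trans (sym (x[y-z]≈xy-xz r (z′ - y) (z′ - w)))
                (cong (r *_) ([x-y]-[x-z]≡z-y z′ y w))))
            r≡1 : r ≡ 1#
            r≡1 = *-cancelˡ (x≢y⇒x-y≢0 w≢y) (trans (*-comm _ _) (trans (sym difference) (sym (*-identityʳ _))))
            z≡z′ : z ≡ z′
            z≡z′ = x-y≡0⇒x≡y z z′ (trans (sym ([x-z]-[y-z]≡x-y z z′ y))
              (x≡y⇒x-y≡0 (trans (sym (ratio-* y-ok)) (trans (cong (_* (z′ - y)) r≡1) (*-identityˡ _)))))

        -- Opening the squares gives a sum over pairs (z , z′): a pair z = z′ contributes at most q,
        -- any other at most h. The term h s² is about what a perfectly even distribution would
        -- give, N q (s / N)².
        Σdegree² : sum (λ y → sum (λ c → degree y c ℕ.* degree y c)) ≤ q ℕ.* s ℕ.+ h ℕ.* (s ℕ.* s)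
        Σdegree² = begin
          sum (λ y → sum (λ c → degree y c ℕ.* degree y c))
            ≡⟨ sum-cong-≗ {q} (λ y → sum-cong-≗ {N} (λ c → square y c)) ⟩
          sum (λ y → sum (λ c → sum (λ z → sum (λ z′ → τ z z′ ℕ.* (χ y c z ℕ.* χ y c z′)))))
            ≡⟨ sum-cong-≗ {q} (λ y → ∑-comm {N} {q} (λ c z → sum (λ z′ → τ z z′ ℕ.* (χ y c z ℕ.* χ y c z′)))) ⟩
          sum (λ y → sum (λ z → sum (λ c → sum (λ z′ → τ z z′ ℕ.* (χ y c z ℕ.* χ y c z′)))))
            ≡⟨ ∑-comm {q} {q} (λ y z → sum (λ c → sum (λ z′ → τ z z′ ℕ.* (χ y c z ℕ.* χ y c z′)))) ⟩
          sum (λ z → sum (λ y → sum (λ c → sum (λ z′ → τ z z′ ℕ.* (χ y c z ℕ.* χ y c z′)))))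
            ≡⟨ sum-cong-≗ {q} (λ z → sum-cong-≗ {q} (λ y → ∑-comm {N} {q} (λ c z′ → τ z z′ ℕ.* (χ y c z ℕ.* χ y c z′)))) ⟩
          sum (λ z → sum (λ y → sum (λ z′ → sum (λ c → τ z z′ ℕ.* (χ y c z ℕ.* χ y c z′)))))
            ≡⟨ sum-cong-≗ {q} (λ z → ∑-comm {q} {q} (λ y z′ → sum (λ c → τ z z′ ℕ.* (χ y c z ℕ.* χ y c z′)))) ⟩
          sum (λ z → sum (λ z′ → sum (λ y → sum (λ c → τ z z′ ℕ.* (χ y c z ℕ.* χ y c z′)))))
            ≡⟨ sum-cong-≗ {q} (λ z → sum-cong-≗ {q} (λ z′ → factor z z′)) ⟩
          sum (λ z → sum (λ z′ → τ z z′ ℕ.* pairs z z′))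
            ≤⟨ sum-mono (λ z → sum-mono (λ z′ → ℕ.*-monoʳ-≤ (τ z z′) (pairs≤ z z′))) ⟩
          sum (λ z → sum (λ z′ → τ z z′ ℕ.* (q ℕ.* ⟦ z ≟ᶠ z′ ⟧ ℕ.+ h)))
            ≤⟨ sum-mono row ⟩
          sum (λ z → q ℕ.* σ z ℕ.+ h ℕ.* s ℕ.* σ z)
            ≡⟨ sum-cong-≗ {q} (λ z → sym (ℕ.*-distribʳ-+ (σ z) q (h ℕ.* s))) ⟩
          sum (λ z → (q ℕ.+ h ℕ.* s) ℕ.* σ z)
            ≡⟨ *-distribˡ-sum {q} (q ℕ.+ h ℕ.* s) σ ⟨
          (q ℕ.+ h ℕ.* s) ℕ.* s
            ≡⟨ expand q h s ⟩
          q ℕ.* s ℕ.+ h ℕ.* (s ℕ.* s) ∎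
          where
          open ℕ.≤-Reasoning
          τ : Fin q → Fin q → ℕ
          τ z z′ = σ z ℕ.* σ z′
          expand : ∀ q h s → (q ℕ.+ h ℕ.* s) ℕ.* s ≡ q ℕ.* s ℕ.+ h ℕ.* (s ℕ.* s)
          expand = solve-∀
          square : ∀ y c → degree y c ℕ.* degree y c ≡ sum (λ z → sum (λ z′ → τ z z′ ℕ.* (χ y c z ℕ.* χ y c z′)))
          square y c = begin-equality
            degree y c ℕ.* degree y c             ≡⟨ cong₂ ℕ._*_ (degree-sum y c) (degree-sum y c) ⟩
            sum a ℕ.* sum a                       ≡⟨ *-distribʳ-sum {q} (sum a) a ⟩
            sum (λ z → a z ℕ.* sum a)             ≡⟨ sum-cong-≗ {q} (λ z → *-distribˡ-sum {q} (a z) a) ⟩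
            sum (λ z → sum (λ z′ → a z ℕ.* a z′)) ≡⟨ sum-cong-≗ {q} (λ z → sum-cong-≗ {q} (λ z′ → swap (σ z) (χ y c z) (σ z′) (χ y c z′))) ⟩
            sum (λ z → sum (λ z′ → τ z z′ ℕ.* (χ y c z ℕ.* χ y c z′))) ∎
            where
            a : Fin q → ℕ
            a z = σ z ℕ.* χ y c z
            swap : ∀ a b c d → a ℕ.* b ℕ.* (c ℕ.* d) ≡ a ℕ.* c ℕ.* (b ℕ.* d)
            swap = solve-∀
          factor : ∀ z z′ → sum (λ y → sum (λ c → τ z z′ ℕ.* (χ y c z ℕ.* χ y c z′))) ≡ τ z z′ ℕ.* pairs z z′
          factor z z′ = trans (sum-cong-≗ {q} (λ y → sym (*-distribˡ-sum {N} (τ z z′) (λ c → χ y c z ℕ.* χ y c z′))))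
            (sym (*-distribˡ-sum {q} (τ z z′) (λ y → sum (λ c → χ y c z ℕ.* χ y c z′))))
          row : ∀ z → sum (λ z′ → τ z z′ ℕ.* (q ℕ.* ⟦ z ≟ᶠ z′ ⟧ ℕ.+ h)) ≤ q ℕ.* σ z ℕ.+ h ℕ.* s ℕ.* σ z
          row z = begin
            sum (λ z′ → τ z z′ ℕ.* (q ℕ.* ⟦ z ≟ᶠ z′ ⟧ ℕ.+ h))
              ≡⟨ sum-cong-≗ {q} (λ z′ → rearrange (σ z) (σ z′) q ⟦ z ≟ᶠ z′ ⟧ h) ⟩
            sum (λ z′ → q ℕ.* σ z ℕ.* (⟦ z ≟ᶠ z′ ⟧ ℕ.* σ z′) ℕ.+ h ℕ.* σ z ℕ.* σ z′)
              ≡⟨ ∑-distrib-+ {q} (λ z′ → q ℕ.* σ z ℕ.* (⟦ z ≟ᶠ z′ ⟧ ℕ.* σ z′)) (λ z′ → h ℕ.* σ z ℕ.* σ z′) ⟩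
            sum (λ z′ → q ℕ.* σ z ℕ.* (⟦ z ≟ᶠ z′ ⟧ ℕ.* σ z′)) ℕ.+ sum (λ z′ → h ℕ.* σ z ℕ.* σ z′)
              ≡⟨ cong₂ ℕ._+_ (sym (*-distribˡ-sum {q} (q ℕ.* σ z) (λ z′ → ⟦ z ≟ᶠ z′ ⟧ ℕ.* σ z′))) (sym (*-distribˡ-sum {q} (h ℕ.* σ z) σ)) ⟩
            q ℕ.* σ z ℕ.* sum (λ z′ → ⟦ z ≟ᶠ z′ ⟧ ℕ.* σ z′) ℕ.+ h ℕ.* σ z ℕ.* s
              ≡⟨ cong (λ t → q ℕ.* σ z ℕ.* t ℕ.+ h ℕ.* σ z ℕ.* s) (sum-select σ z) ⟩
            q ℕ.* σ z ℕ.* σ z ℕ.+ h ℕ.* σ z ℕ.* s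
              ≤⟨ ℕ.+-monoˡ-≤ _ (ℕ.*-monoʳ-≤ (q ℕ.* σ z) (⟦⟧≤1 (S? z))) ⟩
            q ℕ.* σ z ℕ.* 1 ℕ.+ h ℕ.* σ z ℕ.* s
              ≡⟨ tidy q (σ z) h s ⟩
            q ℕ.* σ z ℕ.+ h ℕ.* s ℕ.* σ z ∎
            where
            rearrange : ∀ a b q d h → a ℕ.* b ℕ.* (q ℕ.* d ℕ.+ h) ≡ q ℕ.* a ℕ.* (d ℕ.* b) ℕ.+ h ℕ.* a ℕ.* b
            rearrange = solve-∀
            tidy : ∀ q a h s → q ℕ.* a ℕ.* 1 ℕ.+ h ℕ.* a ℕ.* s ≡ q ℕ.* a ℕ.+ h ℕ.* s ℕ.* a
            tidy = solve-∀

        -- 4 (x - s)² is nonnegative, and exceeds s² when 2 x < s.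
        deviation : ∀ x s (2x<?s : Dec (2 ℕ.* x < s)) → 8 ℕ.* (s ℕ.* x) ℕ.+ s ℕ.* s ℕ.* ⟦ 2x<?s ⟧ ≤ 4 ℕ.* (x ℕ.* x) ℕ.+ 4 ℕ.* (s ℕ.* s)
        deviation x s (yes 2x<s) = subst (λ s → 8 ℕ.* (s ℕ.* x) ℕ.+ s ℕ.* s ℕ.* 1 ≤ 4 ℕ.* (x ℕ.* x) ℕ.+ 4 ℕ.* (s ℕ.* s))
                           (ℕ.m+[n∸m]≡n (ℕ.<⇒≤ 2x<s)) (ineq (s ℕ.∸ 2 ℕ.* x))
          where
          ineq : ∀ t → let s = 2 ℕ.* x ℕ.+ t in 8 ℕ.* (s ℕ.* x) ℕ.+ s ℕ.* s ℕ.* 1 ≤ 4 ℕ.* (x ℕ.* x) ℕ.+ 4 ℕ.* (s ℕ.* s)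
          ineq t = ℕ.≤-trans (ℕ.m≤m+n _ (4 ℕ.* (x ℕ.* t) ℕ.+ 3 ℕ.* (t ℕ.* t))) (ℕ.≤-reflexive (identity x t))
            where
            identity : ∀ x t → let s = 2 ℕ.* x ℕ.+ t in
              8 ℕ.* (s ℕ.* x) ℕ.+ s ℕ.* s ℕ.* 1 ℕ.+ (4 ℕ.* (x ℕ.* t) ℕ.+ 3 ℕ.* (t ℕ.* t)) ≡ 4 ℕ.* (x ℕ.* x) ℕ.+ 4 ℕ.* (s ℕ.* s)
            identity = solve-∀
        deviation x s (no _) with ℕ.≤-total x s
        ... | inj₁ x≤s = subst (λ s → 8 ℕ.* (s ℕ.* x) ℕ.+ s ℕ.* s ℕ.* 0 ≤ 4 ℕ.* (x ℕ.* x) ℕ.+ 4 ℕ.* (s ℕ.* s))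
                             (ℕ.m+[n∸m]≡n x≤s) (ineq (s ℕ.∸ x))
          where
          ineq : ∀ t → let s = x ℕ.+ t in 8 ℕ.* (s ℕ.* x) ℕ.+ s ℕ.* s ℕ.* 0 ≤ 4 ℕ.* (x ℕ.* x) ℕ.+ 4 ℕ.* (s ℕ.* s)
          ineq t = ℕ.≤-trans (ℕ.m≤m+n _ (4 ℕ.* (t ℕ.* t))) (ℕ.≤-reflexive (identity x t))
            where
            identity : ∀ x t → let s = x ℕ.+ t in
              8 ℕ.* (s ℕ.* x) ℕ.+ s ℕ.* s ℕ.* 0 ℕ.+ 4 ℕ.* (t ℕ.* t) ≡ 4 ℕ.* (x ℕ.* x) ℕ.+ 4 ℕ.* (s ℕ.* s)
            identity = solve-∀
        ... | inj₂ s≤x = subst (λ x → 8 ℕ.* (s ℕ.* x) ℕ.+ s ℕ.* s ℕ.* 0 ≤ 4 ℕ.* (x ℕ.* x) ℕ.+ 4 ℕ.* (s ℕ.* s))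
                             (ℕ.m+[n∸m]≡n s≤x) (ineq (x ℕ.∸ s))
          where
          ineq : ∀ t → let x = s ℕ.+ t in 8 ℕ.* (s ℕ.* x) ℕ.+ s ℕ.* s ℕ.* 0 ≤ 4 ℕ.* (x ℕ.* x) ℕ.+ 4 ℕ.* (s ℕ.* s)
          ineq t = ℕ.≤-trans (ℕ.m≤m+n _ (4 ℕ.* (t ℕ.* t))) (ℕ.≤-reflexive (identity s t))
            where
            identity : ∀ s t → let x = s ℕ.+ t in
              8 ℕ.* (s ℕ.* x) ℕ.+ s ℕ.* s ℕ.* 0 ℕ.+ 4 ℕ.* (t ℕ.* t) ≡ 4 ℕ.* (x ℕ.* x) ℕ.+ 4 ℕ.* (s ℕ.* s)
            identity = solve-∀

      -- Chebyshev: on average over y, the degrees into S are the expected s / N, with small variance.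
      few-bad : ∀ D .{{_ : NonZero (count S?)}} → q ≤ D ℕ.* count S? →
        sum (λ y → sum (λ c → ⟦ bad? y c ⟧)) ≤ 4 ℕ.* (N ℕ.* N) ℕ.* D ℕ.+ 4 ℕ.* N
      few-bad D q≤Ds = ℕ.*-cancelˡ-≤ (s ℕ.* s) {{ℕ.m*n≢0 s s}} (ℕ.+-cancelʳ-≤ extra _ _ (begin
        s ℕ.* s ℕ.* B ℕ.+ extra
          ≡⟨ collect ⟨
        8 ℕ.* (s ℕ.* (N ℕ.* A₁)) ℕ.+ s ℕ.* s ℕ.* B ℕ.+ 8 ℕ.* (s ℕ.* s) ℕ.* N
          ≤⟨ ℕ.+-monoˡ-≤ _ moments ⟩
        4 ℕ.* (N ℕ.* N) ℕ.* A₂ ℕ.+ 4 ℕ.* (s ℕ.* s) ℕ.* (N ℕ.* q) ℕ.+ 8 ℕ.* (s ℕ.* s) ℕ.* N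
          ≤⟨ ℕ.+-monoˡ-≤ _ (ℕ.+-monoˡ-≤ _ (ℕ.*-monoʳ-≤ (4 ℕ.* (N ℕ.* N)) Σdegree²)) ⟩
        4 ℕ.* (N ℕ.* N) ℕ.* (q ℕ.* s ℕ.+ h ℕ.* (s ℕ.* s)) ℕ.+ 4 ℕ.* (s ℕ.* s) ℕ.* (N ℕ.* q) ℕ.+ 8 ℕ.* (s ℕ.* s) ℕ.* N
          ≤⟨ ℕ.+-monoˡ-≤ _ (ℕ.+-monoˡ-≤ _ (ℕ.*-monoʳ-≤ (4 ℕ.* (N ℕ.* N)) (ℕ.+-monoˡ-≤ _ (ℕ.*-monoˡ-≤ s q≤Ds)))) ⟩
        4 ℕ.* (N ℕ.* N) ℕ.* (D ℕ.* s ℕ.* s ℕ.+ h ℕ.* (s ℕ.* s)) ℕ.+ 4 ℕ.* (s ℕ.* s) ℕ.* (N ℕ.* q) ℕ.+ 8 ℕ.* (s ℕ.* s) ℕ.* N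
          ≡⟨ cong (λ q → 4 ℕ.* (N ℕ.* N) ℕ.* (D ℕ.* s ℕ.* s ℕ.+ h ℕ.* (s ℕ.* s)) ℕ.+ 4 ℕ.* (s ℕ.* s) ℕ.* (N ℕ.* q) ℕ.+ 8 ℕ.* (s ℕ.* s) ℕ.* N) (sym q≡) ⟩
        4 ℕ.* (N ℕ.* N) ℕ.* (D ℕ.* s ℕ.* s ℕ.+ h ℕ.* (s ℕ.* s)) ℕ.+ 4 ℕ.* (s ℕ.* s) ℕ.* (N ℕ.* (1 ℕ.+ N ℕ.* h)) ℕ.+ 8 ℕ.* (s ℕ.* s) ℕ.* N
          ≡⟨ rearrange N h s D ⟩
        s ℕ.* s ℕ.* (4 ℕ.* (N ℕ.* N) ℕ.* D ℕ.+ 4 ℕ.* N) ℕ.+ 8 ℕ.* (s ℕ.* s) ℕ.* (N ℕ.* (1 ℕ.+ N ℕ.* h))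
          ≡⟨ cong (λ q → s ℕ.* s ℕ.* (4 ℕ.* (N ℕ.* N) ℕ.* D ℕ.+ 4 ℕ.* N) ℕ.+ 8 ℕ.* (s ℕ.* s) ℕ.* (N ℕ.* q)) q≡ ⟩
        s ℕ.* s ℕ.* (4 ℕ.* (N ℕ.* N) ℕ.* D ℕ.+ 4 ℕ.* N) ℕ.+ extra ∎))
        where
        open ℕ.≤-Reasoning
        B  = sum (λ y → sum (λ c → ⟦ bad? y c ⟧))
        A₁ = sum (λ y → sum (degree y))
        A₂ = sum (λ y → sum (λ c → degree y c ℕ.* degree y c))
        extra = 8 ℕ.* (s ℕ.* s) ℕ.* (N ℕ.* q)
        rearrange : ∀ N h s D →
          4 ℕ.* (N ℕ.* N) ℕ.* (D ℕ.* s ℕ.* s ℕ.+ h ℕ.* (s ℕ.* s)) ℕ.+ 4 ℕ.* (s ℕ.* s) ℕ.* (N ℕ.* (1 ℕ.+ N ℕ.* h)) ℕ.+ 8 ℕ.* (s ℕ.* s) ℕ.* N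
          ≡ s ℕ.* s ℕ.* (4 ℕ.* (N ℕ.* N) ℕ.* D ℕ.+ 4 ℕ.* N) ℕ.+ 8 ℕ.* (s ℕ.* s) ℕ.* (N ℕ.* (1 ℕ.+ N ℕ.* h))
        rearrange = solve-∀
        collect : 8 ℕ.* (s ℕ.* (N ℕ.* A₁)) ℕ.+ s ℕ.* s ℕ.* B ℕ.+ 8 ℕ.* (s ℕ.* s) ℕ.* N ≡ s ℕ.* s ℕ.* B ℕ.+ extra
        collect = begin-equality
          8 ℕ.* (s ℕ.* (N ℕ.* A₁)) ℕ.+ s ℕ.* s ℕ.* B ℕ.+ 8 ℕ.* (s ℕ.* s) ℕ.* N   ≡⟨ gather s N A₁ B ⟩
          s ℕ.* s ℕ.* B ℕ.+ 8 ℕ.* s ℕ.* (N ℕ.* (A₁ ℕ.+ s))                       ≡⟨ cong (λ t → s ℕ.* s ℕ.* B ℕ.+ 8 ℕ.* s ℕ.* (N ℕ.* t)) Σdegree ⟩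
          s ℕ.* s ℕ.* B ℕ.+ 8 ℕ.* s ℕ.* (N ℕ.* (q ℕ.* s))                        ≡⟨ tidy s N q B ⟩
          s ℕ.* s ℕ.* B ℕ.+ extra                                                ∎
          where
          gather : ∀ s N A B → 8 ℕ.* (s ℕ.* (N ℕ.* A)) ℕ.+ s ℕ.* s ℕ.* B ℕ.+ 8 ℕ.* (s ℕ.* s) ℕ.* N ≡ s ℕ.* s ℕ.* B ℕ.+ 8 ℕ.* s ℕ.* (N ℕ.* (A ℕ.+ s))
          gather = solve-∀
          tidy : ∀ s N q B → s ℕ.* s ℕ.* B ℕ.+ 8 ℕ.* s ℕ.* (N ℕ.* (q ℕ.* s)) ≡ s ℕ.* s ℕ.* B ℕ.+ 8 ℕ.* (s ℕ.* s) ℕ.* (N ℕ.* q)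
          tidy = solve-∀
        sum₂-* : ∀ k (f : Fin q → Fin N → ℕ) → sum (λ y → sum (λ c → k ℕ.* f y c)) ≡ k ℕ.* sum (λ y → sum (f y))
        sum₂-* k f = trans (sum-cong-≗ {q} (λ y → sym (*-distribˡ-sum {N} k (f y)))) (sym (*-distribˡ-sum {q} k (λ y → sum (f y))))
        sum₂-+ : ∀ (f g : Fin q → Fin N → ℕ) → sum (λ y → sum (λ c → f y c ℕ.+ g y c)) ≡ sum (λ y → sum (f y)) ℕ.+ sum (λ y → sum (g y))
        sum₂-+ f g = trans (sum-cong-≗ {q} (λ y → ∑-distrib-+ {N} (f y) (g y))) (∑-distrib-+ {q} (λ y → sum (f y)) (λ y → sum (g y)))
        moments : 8 ℕ.* (s ℕ.* (N ℕ.* A₁)) ℕ.+ s ℕ.* s ℕ.* B ≤ 4 ℕ.* (N ℕ.* N) ℕ.* A₂ ℕ.+ 4 ℕ.* (s ℕ.* s) ℕ.* (N ℕ.* q)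
        moments = begin
          8 ℕ.* (s ℕ.* (N ℕ.* A₁)) ℕ.+ s ℕ.* s ℕ.* B
            ≡⟨ cong₂ ℕ._+_ (trans (assoc₁ s N A₁) (sym (sum₂-* (8 ℕ.* s ℕ.* N) degree))) (sym (sum₂-* (s ℕ.* s) (λ y c → ⟦ bad? y c ⟧))) ⟩
          sum (λ y → sum (λ c → 8 ℕ.* s ℕ.* N ℕ.* degree y c)) ℕ.+ sum (λ y → sum (λ c → s ℕ.* s ℕ.* ⟦ bad? y c ⟧))
            ≡⟨ sum₂-+ (λ y c → 8 ℕ.* s ℕ.* N ℕ.* degree y c) (λ y c → s ℕ.* s ℕ.* ⟦ bad? y c ⟧) ⟨
          sum (λ y → sum (λ c → 8 ℕ.* s ℕ.* N ℕ.* degree y c ℕ.+ s ℕ.* s ℕ.* ⟦ bad? y c ⟧))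
            ≤⟨ sum-mono (λ y → sum-mono (λ c → pointwise y c)) ⟩
          sum (λ y → sum (λ c → 4 ℕ.* (N ℕ.* N) ℕ.* (degree y c ℕ.* degree y c) ℕ.+ 4 ℕ.* (s ℕ.* s)))
            ≡⟨ sum₂-+ (λ y c → 4 ℕ.* (N ℕ.* N) ℕ.* (degree y c ℕ.* degree y c)) (λ y c → 4 ℕ.* (s ℕ.* s)) ⟩
          sum (λ y → sum (λ c → 4 ℕ.* (N ℕ.* N) ℕ.* (degree y c ℕ.* degree y c))) ℕ.+ sum {q} (λ y → sum {N} (λ c → 4 ℕ.* (s ℕ.* s)))
            ≡⟨ cong₂ ℕ._+_ (sum₂-* (4 ℕ.* (N ℕ.* N)) (λ y c → degree y c ℕ.* degree y c))
                 (trans (sum-cong-≗ {q} (λ y → sum-const N (4 ℕ.* (s ℕ.* s)))) (trans (sum-const q (N ℕ.* (4 ℕ.* (s ℕ.* s)))) (assoc₂ q N s))) ⟩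
          4 ℕ.* (N ℕ.* N) ℕ.* A₂ ℕ.+ 4 ℕ.* (s ℕ.* s) ℕ.* (N ℕ.* q) ∎
          where
          assoc₁ : ∀ s N A → 8 ℕ.* (s ℕ.* (N ℕ.* A)) ≡ 8 ℕ.* s ℕ.* N ℕ.* A
          assoc₁ = solve-∀
          assoc₂ : ∀ q N s → q ℕ.* (N ℕ.* (4 ℕ.* (s ℕ.* s))) ≡ 4 ℕ.* (s ℕ.* s) ℕ.* (N ℕ.* q)
          assoc₂ = solve-∀
          pointwise : ∀ y c → 8 ℕ.* s ℕ.* N ℕ.* degree y c ℕ.+ s ℕ.* s ℕ.* ⟦ bad? y c ⟧ ≤ 4 ℕ.* (N ℕ.* N) ℕ.* (degree y c ℕ.* degree y c) ℕ.+ 4 ℕ.* (s ℕ.* s)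
          pointwise y c = begin
            8 ℕ.* s ℕ.* N ℕ.* d ℕ.+ s ℕ.* s ℕ.* ⟦ bad? y c ⟧        ≡⟨ cong (ℕ._+ s ℕ.* s ℕ.* ⟦ bad? y c ⟧) (sym (assoc₁ s N d)) ⟩
            8 ℕ.* (s ℕ.* (N ℕ.* d)) ℕ.+ s ℕ.* s ℕ.* ⟦ bad? y c ⟧    ≤⟨ deviation (N ℕ.* d) s (bad? y c) ⟩
            4 ℕ.* (N ℕ.* d ℕ.* (N ℕ.* d)) ℕ.+ 4 ℕ.* (s ℕ.* s)       ≡⟨ cong (ℕ._+ 4 ℕ.* (s ℕ.* s)) (assoc₃ N d) ⟩
            4 ℕ.* (N ℕ.* N) ℕ.* (d ℕ.* d) ℕ.+ 4 ℕ.* (s ℕ.* s)       ∎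
            where
            d = degree y c
            assoc₃ : ∀ N d → 4 ℕ.* (N ℕ.* d ℕ.* (N ℕ.* d)) ≡ 4 ℕ.* (N ℕ.* N) ℕ.* (d ℕ.* d)
            assoc₃ = solve-∀

-- Greedy placement of points with prescribed colours of differences.

module Greedy where

  open import Data.Nat as ℕ using (ℕ; zero; suc; NonZero; _≤_; _<_; z≤n; s≤s)
  import Data.Nat.Properties as ℕ
  open import Data.Nat.Tactic.RingSolver using (solve-∀)
  open import Data.Fin as Fin using (Fin; zero; suc)
  open import Data.Fin.Properties using (<-cmp) renaming (_≟_ to _≟ᶠ_)
  open import Data.Product using (∃-syntax; Σ-syntax; _×_; _,_; proj₁; proj₂)
  open import Data.Unit using (⊤; tt)
  open import Relation.Nullary using (Dec; yes; ¬_; contradiction)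
  open import Relation.Nullary.Decidable using (_×-dec_)
  open import Relation.Binary.Definitions using (Tri; tri<; tri≈; tri>)
  open import Relation.Binary.PropositionalEquality
  open Counting
  open FiniteFields
  open CosetColouring

  private
    below-threshold : ∀ k β E D q {b s} → b ≤ k ℕ.* β → suc k ℕ.* β ℕ.* E < q → q ≤ D ℕ.* s → D ≤ E → b < s
    below-threshold k β E D q {b} {s} b≤kβ large q≤Ds D≤E =
      ℕ.≤-<-trans (ℕ.≤-trans b≤kβ (ℕ.m≤n+m (k ℕ.* β) β)) (ℕ.*-cancelʳ-< E (suc k ℕ.* β) s (begin-strict
        suc k ℕ.* β ℕ.* E      <⟨ large ⟩
        q                      ≤⟨ q≤Ds ⟩
        D ℕ.* s                ≤⟨ ℕ.*-monoˡ-≤ s D≤E ⟩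
        E ℕ.* s                ≡⟨ ℕ.*-comm E s ⟩
        s ℕ.* E                ∎))
      where open ℕ.≤-Reasoning

    threshold-mono : ∀ N {D E} → D ≤ E → 4 ℕ.* (N ℕ.* N) ℕ.* D ℕ.+ 4 ℕ.* N ≤ 4 ℕ.* (N ℕ.* N) ℕ.* E ℕ.+ 4 ℕ.* N
    threshold-mono N D≤E = ℕ.+-monoˡ-≤ (4 ℕ.* N) (ℕ.*-monoʳ-≤ (4 ℕ.* (N ℕ.* N)) D≤E)

    refine-large : ∀ N D {q s t} → q ≤ D ℕ.* s → s ≤ 2 ℕ.* (N ℕ.* t) → q ≤ D ℕ.* (2 ℕ.* N) ℕ.* t
    refine-large N D {q} {s} {t} q≤Ds s≤2Nt =
      ℕ.≤-trans q≤Ds (ℕ.≤-trans (ℕ.*-monoʳ-≤ D s≤2Nt) (ℕ.≤-reflexive (assoc D N t)))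
      where
      assoc : ∀ D N t → D ℕ.* (2 ℕ.* (N ℕ.* t)) ≡ D ℕ.* (2 ℕ.* N) ℕ.* t
      assoc = solve-∀

  -- k β E with E = (2 N)ᵏ and β = 4 N² E + 4 N: an admissible set keeps at least q / E elements,
  -- and each of the fewer than k other sets spoils at most β of them, so q > k β E always leaves a
  -- choice.
  room : ℕ → ℕ → ℕ
  room k N = k ℕ.* (4 ℕ.* (N ℕ.* N) ℕ.* (2 ℕ.* N) ℕ.^ k ℕ.+ 4 ℕ.* N) ℕ.* (2 ℕ.* N) ℕ.^ k

  -- The prime has to serve every design, so it is compared with the bound T instead of the actual
  -- number N of colours.
  room-mono : ∀ k {N T} → N ≤ T → room k N ≤ room k T
  room-mono k {N} {T} N≤T = ℕ.*-mono-≤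
    (ℕ.*-monoʳ-≤ k (ℕ.+-mono-≤ (ℕ.*-mono-≤ (ℕ.*-monoʳ-≤ 4 (ℕ.*-mono-≤ N≤T N≤T)) power) (ℕ.*-monoʳ-≤ 4 N≤T)))
    power
    where
    power : (2 ℕ.* N) ℕ.^ k ≤ (2 ℕ.* T) ℕ.^ k
    power = ℕ.^-monoˡ-≤ k (ℕ.*-monoʳ-≤ 2 N≤T)

  module Realisation {q} (F : FiniteField q) (N h : ℕ) .{{N≢0 : NonZero N}} .{{h≢0 : NonZero h}}
                     (q≡ : suc (N ℕ.* h) ≡ q) where
    open FiniteField F
    open Field F
    open Colouring F N h q≡

    -- The vertices are chosen one at a time; S i is the set of elements still admissible for vertex i.
    greedy : ∀ E k D → D ℕ.* (2 ℕ.* N) ℕ.^ k ≤ E → k ℕ.* (4 ℕ.* (N ℕ.* N) ℕ.* E ℕ.+ 4 ℕ.* N) ℕ.* E < q →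
      {S : Fin k → Fin q → Set} (S? : ∀ i x → Dec (S i x)) → (∀ i → q ≤ D ℕ.* count (S? i)) →
      (col : Fin k → Fin k → Fin N) →
      Σ[ ψ ∈ (Fin k → Fin q) ] (∀ i → S i (ψ i)) × (∀ {i j : Fin k} → i Fin.< j → colour (ψ j - ψ i) ≡ suc (col i j))
    greedy E zero    D D≤E large S? S-large col = (λ ()) , (λ ()) , λ { {()} }
    greedy E (suc k) D D≤E large {S} S? S-large col = ψ , ψ∈S , λ {i} {j} → ψ-colour {i} {j}
      where
      open ℕ.≤-Reasoning
      -- 1 / D is the current density bound of the admissible sets and D grows by 2 N per vertex; E
      -- bounds all later values of D, which allows one threshold β for the whole recursion.
      β = 4 ℕ.* (N ℕ.* N) ℕ.* E ℕ.+ 4 ℕ.* N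
      instance
        2N≢0 : NonZero (2 ℕ.* N)
        2N≢0 = ℕ.m*n≢0 2 N
        power≢0 : NonZero ((2 ℕ.* N) ℕ.^ suc k)
        power≢0 = ℕ.m^n≢0 (2 ℕ.* N) (suc k)
      D≤E′ : D ≤ E
      D≤E′ = ℕ.≤-trans (ℕ.m≤m*n D ((2 ℕ.* N) ℕ.^ suc k)) D≤E
      0<q : 0 < q
      0<q = ℕ.≤-<-trans z≤n large
      S≢0 : ∀ i → NonZero (count (S? i))
      S≢0 i = ℕ.m*n≢0⇒n≢0 D {{ℕ.>-nonZero (ℕ.<-≤-trans 0<q (S-large i))}}
      -- Failures are counted for all colours, not just the prescribed one, since `few-bad` bounds
      -- the total over colours.
      all-bad : Fin q → ℕ
      all-bad y = sum (λ j → sum (λ c → ⟦ bad? (S? (suc j)) y c ⟧))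
      few-bad-for : ∀ j → sum (λ y → sum (λ c → ⟦ bad? (S? (suc j)) y c ⟧)) ≤ β
      few-bad-for j = ℕ.≤-trans (few-bad (S? (suc j)) D {{S≢0 (suc j)}} (S-large (suc j))) (threshold-mono N D≤E′)
      few : sum all-bad < count (S? zero)
      few = below-threshold k β E D q (begin
        sum all-bad
          ≡⟨ ∑-comm {q} {k} (λ y j → sum (λ c → ⟦ bad? (S? (suc j)) y c ⟧)) ⟩
        sum (λ j → sum (λ y → sum (λ c → ⟦ bad? (S? (suc j)) y c ⟧)))
          ≤⟨ sum-mono few-bad-for ⟩
        sum {k} (λ j → β)
          ≡⟨ sum-const k β ⟩
        k ℕ.* β ∎) large (S-large zero) D≤E′
      -- The right side is at most 1, so the strict inequality says at once that y is admissible and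
      -- that it is bad for no later vertex and colour.
      good-vertex : ∃[ y ] all-bad y < ⟦ S? zero y ⟧
      good-vertex = sum-<⇒∃< all-bad (λ y → ⟦ S? zero y ⟧) few
      y = proj₁ good-vertex
      y∈S : S zero y
      y∈S = 0<⟦⟧⇒ (S? zero y) (ℕ.≤-<-trans z≤n (proj₂ good-vertex))
      all-good : ∀ j c → ¬ Bad (S? (suc j)) y c
      all-good j c is-bad = ℕ.<-irrefl refl (begin-strict
        1                                                     ≡⟨ ⟦⟧-true (bad? (S? (suc j)) y c) is-bad ⟨
        ⟦ bad? (S? (suc j)) y c ⟧                             ≤⟨ term≤sum (λ c → ⟦ bad? (S? (suc j)) y c ⟧) c ⟩
        sum (λ c → ⟦ bad? (S? (suc j)) y c ⟧)                 ≤⟨ term≤sum (λ j → sum (λ c → ⟦ bad? (S? (suc j)) y c ⟧)) j ⟩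
        all-bad y                                             <⟨ proj₂ good-vertex ⟩
        ⟦ S? zero y ⟧                                         ≤⟨ ⟦⟧≤1 (S? zero y) ⟩
        1                                                     ∎)
      -- What remains admissible for the later vertices; as y is not bad, at least the fraction 1 /
      -- 2 N survives.
      T? : ∀ j x → Dec (S (suc j) x × colour (x - y) ≡ suc (col zero (suc j)))
      T? j x = S? (suc j) x ×-dec (colour (x - y) ≟ᶠ suc (col zero (suc j)))
      T-large : ∀ j → q ≤ D ℕ.* (2 ℕ.* N) ℕ.* count (T? j)
      T-large j = refine-large N D (S-large (suc j)) (ℕ.≮⇒≥ (all-good j (col zero (suc j))))
      rest = greedy E k (D ℕ.* (2 ℕ.* N))
        (ℕ.≤-trans (ℕ.≤-reflexive (ℕ.*-assoc D (2 ℕ.* N) _)) D≤E)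
        (ℕ.≤-<-trans (ℕ.*-monoˡ-≤ E (ℕ.m≤n+m (k ℕ.* β) β)) large)
        T? T-large (λ i j → col (suc i) (suc j))
      ψ : Fin (suc k) → Fin q
      ψ zero    = y
      ψ (suc i) = proj₁ rest i
      ψ∈S : ∀ i → S i (ψ i)
      ψ∈S zero    = y∈S
      ψ∈S (suc i) = proj₁ (proj₁ (proj₂ rest) i)
      ψ-colour : ∀ {i j : Fin (suc k)} → i Fin.< j → colour (ψ j - ψ i) ≡ suc (col i j)
      ψ-colour {zero}  {suc j} _         = proj₂ (proj₁ (proj₂ rest) j)
      ψ-colour {suc i} {suc j} (s≤s i<j) = proj₂ (proj₂ rest) {i} {j} i<j

    module _ ([-1]^h : (- 1#) ^ h ≡ 1#) where

      -‿^h : ∀ {x} → x ^ h ≡ 1# → (- x) ^ h ≡ 1#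
      -‿^h {x} e = begin
        (- x) ^ h              ≡⟨ cong (_^ h) (-1*x≡-x x) ⟨
        (- 1# * x) ^ h         ≡⟨ ^-distrib-* (- 1#) x h ⟩
        (- 1#) ^ h * x ^ h     ≡⟨ cong₂ _*_ [-1]^h e ⟩
        1# * 1#                ≡⟨ *-identityˡ 1# ⟩
        1#                     ∎
        where
        open ≡-Reasoning
        open import Algebra.Properties.Ring ring using () renaming (-1*x≈-x to -1*x≡-x)

      -- Multiplication by -1, an element of H, preserves cosets; so a colour belongs to an
      -- unordered pair and can be prescribed for an edge.
      colour-sym : ∀ x y → colour (x - y) ≡ colour (y - x)
      colour-sym x y = trans (cong colour (trans (sym (neg-sub y x)) (sym (-1*x≡-x (y - x))))) (colour-* (y - x) [-1]^h)
        where open import Algebra.Properties.Ring ring using () renaming (-1*x≈-x to -1*x≡-x)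

      realise : ∀ k → room k N < q →
        (col : Fin k → Fin k → Fin N) → (∀ i j → col i j ≡ col j i) →
        Σ[ ψ ∈ (Fin k → Fin q) ] ∀ {i j : Fin k} → i ≢ j → colour (ψ i - ψ j) ≡ suc (col i j)
      realise k large col col-sym = pack (greedy ((2 ℕ.* N) ℕ.^ k) k 1 (ℕ.≤-reflexive (ℕ.*-identityˡ _)) large
        {λ _ _ → ⊤} (λ _ _ → yes tt) (λ _ → ℕ.≤-reflexive (sym (trans (ℕ.*-identityˡ _) (trans (sum-const q 1) (ℕ.*-identityʳ q))))) col)
        where
        pack : Σ[ ψ ∈ (Fin k → Fin q) ] (∀ i → ⊤) × (∀ {i j : Fin k} → i Fin.< j → colour (ψ j - ψ i) ≡ suc (col i j)) →
               Σ[ ψ ∈ (Fin k → Fin q) ] ∀ {i j : Fin k} → i ≢ j → colour (ψ i - ψ j) ≡ suc (col i j)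
        pack (ψ , _ , ψ-colour) = ψ , λ {i} {j} i≢j → by-order i≢j (<-cmp i j)
          where
          by-order : ∀ {i j} → i ≢ j → Tri (i Fin.< j) (i ≡ j) (j Fin.< i) → colour (ψ i - ψ j) ≡ suc (col i j)
          by-order {i} {j} i≢j (tri< i<j _ _) = trans (colour-sym (ψ i) (ψ j)) (ψ-colour {i} {j} i<j)
          by-order i≢j (tri≈ _ i≡j _) = contradiction i≡j i≢j
          by-order {i} {j} i≢j (tri> _ _ j<i) = trans (ψ-colour {j} {i} j<i) (cong suc (col-sym j i))

-- Images of graphs under injections and numberings of their edges.

module GraphImages where

  open import Data.Nat using (ℕ; _<_; _<?_; _⊓_; _⊔_; _≟_)
  open import Data.Nat.Properties using (⊓-comm; ⊔-comm; <-cmp; <⇒≤; m≤n⇒m⊓n≡m; m≤n⇒m⊔n≡n; m≥n⇒m⊓n≡n; m≥n⇒m⊔n≡m)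
  open import Data.Fin using (Fin)
  open import Data.List using (List; []; _∷_; map; length; filter; cartesianProduct; lookup)
  open import Data.List.Membership.Propositional using (_∈_)
  open import Data.List.Membership.Propositional.Properties using (∈-map⁺; ∈-map⁻; ∈-filter⁺; ∈-filter⁻; ∈-cartesianProduct⁺; ∈-lookup)
  import Data.List.Membership.DecPropositional as DecMembership
  open import Data.List.Relation.Unary.All using (All; []; _∷_)
  open import Data.List.Relation.Unary.AllPairs using ([]; _∷_)
  open import Data.List.Relation.Unary.Any using (here; there; index)
  open import Data.List.Relation.Unary.Any.Properties using (lookup-index)
  open import Data.List.Relation.Unary.Unique.Propositional using (Unique)
  open import Data.List.Relation.Unary.Unique.Propositional.Properties using (filter⁺; cartesianProduct⁺)
  open import Data.Product using (∃₂; _×_; _,_; proj₁; proj₂)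
  open import Data.Product.Properties using (≡-dec)
  open import Data.Sum using (_⊎_; inj₁; inj₂)
  open import Function using (_∘_; mk⇔; Equivalence)
  open import Relation.Nullary using (Dec; yes; no; contradiction)
  open import Relation.Nullary.Decidable using (_×-dec_)
  open import Relation.Binary.Definitions using (tri<; tri≈; tri>)
  open import Relation.Binary.PropositionalEquality
  open import Defs
  open CosetColouring

  open DecMembership _≟_ using (_∈?_)

  ⊑-trans : ∀ {G H K} → G ⊑ H → H ⊑ K → G ⊑ K
  ⊑-trans p q = record { ⊑-vertices = ⊑-vertices q ∘ ⊑-vertices p ; ⊑-adj = ⊑-adj q ∘ ⊑-adj p }

  ≅-trans : ∀ {G H K} → G ≅ H → H ≅ K → G ≅ K
  ≅-trans p q = record
    { to      = Q.to ∘ P.to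
    ; from    = P.from ∘ Q.from
    ; to-∈    = Q.to-∈ ∘ P.to-∈
    ; from-∈  = P.from-∈ ∘ Q.from-∈
    ; from∘to = λ x∈ → trans (cong P.from (Q.from∘to (P.to-∈ x∈))) (P.from∘to x∈)
    ; to∘from = λ y∈ → trans (cong Q.to (P.to∘from (Q.from-∈ y∈))) (Q.to∘from y∈)
    ; adj-⇔   = λ x∈ y∈ → mk⇔ (Equivalence.to (Q.adj-⇔ (P.to-∈ x∈) (P.to-∈ y∈)) ∘ Equivalence.to (P.adj-⇔ x∈ y∈))
                              (Equivalence.from (P.adj-⇔ x∈ y∈) ∘ Equivalence.from (Q.adj-⇔ (P.to-∈ x∈) (P.to-∈ y∈)))
    }
    where
    module P = _≅_ p
    module Q = _≅_ q

  map-unique : ∀ (f g : ℕ → ℕ) {xs} → (∀ {x} → x ∈ xs → g (f x) ≡ x) → Unique xs → Unique (map f xs)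
  map-unique f g {[]}     inv []            = []
  map-unique f g {x ∷ xs} inv (x∉ ∷ uniq) = fresh x∉ (inv ∘ there) ∷ map-unique f g (inv ∘ there) uniq
    where
    fresh : ∀ {ys} → All (x ≢_) ys → (∀ {y} → y ∈ ys → g (f y) ≡ y) → All (f x ≢_) (map f ys)
    fresh []           inv′ = []
    fresh (x≢y ∷ x≢ys) inv′ = (λ e → x≢y (trans (sym (inv (here refl))) (trans (cong g e) (inv′ (here refl))))) ∷ fresh x≢ys (inv′ ∘ there)

  -- Adjacency is pulled back along the inverse g, which keeps it decidable without a search;
  -- membership is demanded as well because g is arbitrary outside the image.
  module Image (G : Graph) (f g : ℕ → ℕ) (g∘f : ∀ {x} → x ∈ vertices G → g (f x) ≡ x) where

    image : Graph
    image = record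
      { vertices = map f (vertices G)
      ; unique   = map-unique f g g∘f (unique G)
      ; Adj      = λ u w → u ∈ map f (vertices G) × w ∈ map f (vertices G) × Adj G (g u) (g w)
      ; adj?     = λ u w → (u ∈? _) ×-dec (w ∈? _) ×-dec adj? G (g u) (g w)
      ; adj-sym  = λ (u∈ , w∈ , a) → w∈ , u∈ , adj-sym G a
      ; loopless = λ (_ , _ , a) → loopless G a
      ; adj⇒∈    = proj₁
      }

    g-∈ : ∀ {u} → u ∈ vertices image → g u ∈ vertices G
    g-∈ u∈ with ∈-map⁻ f u∈
    ... | x , x∈ , refl = subst (_∈ vertices G) (sym (g∘f x∈)) x∈

    f∘g : ∀ {u} → u ∈ vertices image → f (g u) ≡ u
    f∘g u∈ with ∈-map⁻ f u∈
    ... | x , x∈ , refl = cong f (g∘f x∈)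

    image-≅ : image ≅ G
    image-≅ = record
      { to = g ; from = f ; to-∈ = g-∈ ; from-∈ = ∈-map⁺ f ; from∘to = f∘g ; to∘from = g∘f
      ; adj-⇔ = λ u∈ w∈ → mk⇔ (proj₂ ∘ proj₂) (λ a → u∈ , w∈ , a) }

    image-adj : ∀ {x y} → Adj G x y → Adj image (f x) (f y)
    image-adj a = ∈-map⁺ f x∈ , ∈-map⁺ f y∈ , subst₂ (Adj G) (sym (g∘f x∈)) (sym (g∘f y∈)) a
      where
      x∈ = adj⇒∈ G a
      y∈ = adj⇒∈ G (adj-sym G a)

  -- A bijection between the undirected edges and `Fin e`, expressed on ordered pairs: injective up
  -- to exchanging the ends, with irrelevant values on non-edges.
  record EdgeNumbering (G : Graph) (e : ℕ) : Set where
    field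
      number            : ℕ → ℕ → Fin e
      number-sym        : ∀ x y → number x y ≡ number y x
      number-injective  : ∀ {x y x′ y′} → Adj G x y → Adj G x′ y′ → number x y ≡ number x′ y′ →
                          (x ≡ x′ × y ≡ y′) ⊎ (x ≡ y′ × y ≡ x′)
      number-surjective : ∀ c → ∃₂ λ x y → Adj G x y × number x y ≡ c

  transport-numbering : ∀ {G H e} → G ≅ H → EdgeNumbering H e → EdgeNumbering G e
  transport-numbering {G} {H} iso en = record
    { number = λ x y → number (to x) (to y)
    ; number-sym = λ x y → number-sym (to x) (to y)
    ; number-injective = λ a a′ eq → lift a a′ (number-injective (to-adj a) (to-adj a′) eq)
    ; number-surjective = λ c → pull (number-surjective c)
    }
    where
    open EdgeNumbering en
    open _≅_ iso
    ∈ˡ : ∀ {x y} → Adj G x y → x ∈ vertices G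
    ∈ˡ = adj⇒∈ G
    ∈ʳ : ∀ {x y} → Adj G x y → y ∈ vertices G
    ∈ʳ = adj⇒∈ G ∘ adj-sym G
    to-adj : ∀ {x y} → Adj G x y → Adj H (to x) (to y)
    to-adj a = Equivalence.to (adj-⇔ (∈ˡ a) (∈ʳ a)) a
    to-injective : ∀ {x y} → x ∈ vertices G → y ∈ vertices G → to x ≡ to y → x ≡ y
    to-injective x∈ y∈ e = trans (sym (from∘to x∈)) (trans (cong from e) (from∘to y∈))
    lift : ∀ {x y x′ y′} → Adj G x y → Adj G x′ y′ → (to x ≡ to x′ × to y ≡ to y′) ⊎ (to x ≡ to y′ × to y ≡ to x′) →
           (x ≡ x′ × y ≡ y′) ⊎ (x ≡ y′ × y ≡ x′)
    lift a a′ (inj₁ (p , q)) = inj₁ (to-injective (∈ˡ a) (∈ˡ a′) p , to-injective (∈ʳ a) (∈ʳ a′) q)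
    lift a a′ (inj₂ (p , q)) = inj₂ (to-injective (∈ˡ a) (∈ʳ a′) p , to-injective (∈ʳ a) (∈ˡ a′) q)
    pull : ∀ {c} → ∃₂ (λ x y → Adj H x y × number x y ≡ c) → ∃₂ λ x y → Adj G x y × number (to x) (to y) ≡ c
    pull (x , y , a , eq) = from x , from y ,
      Equivalence.from (adj-⇔ (from-∈ x∈) (from-∈ y∈)) (subst₂ (Adj H) (sym (to∘from x∈)) (sym (to∘from y∈)) a) ,
      trans (cong₂ number (to∘from x∈) (to∘from y∈)) eq
      where
      x∈ = adj⇒∈ H a
      y∈ = adj⇒∈ H (adj-sym H a)

  module Edges (G : Graph) (has-edge : HasEdge G) where

    Ordered : ℕ × ℕ → Set
    Ordered (x , y) = x < y × Adj G x y

    ordered? : ∀ p → Dec (Ordered p)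
    ordered? (x , y) = (x <? y) ×-dec adj? G x y

    edges : List (ℕ × ℕ)
    edges = filter ordered? (cartesianProduct (vertices G) (vertices G))

    edges-unique : Unique edges
    edges-unique = filter⁺ ordered? (cartesianProduct⁺ (unique G) (unique G))

    norm : ℕ → ℕ → ℕ × ℕ
    norm x y = x ⊓ y , x ⊔ y

    norm-< : ∀ {x y} → x < y → norm x y ≡ (x , y)
    norm-< x<y = cong₂ _,_ (m≤n⇒m⊓n≡m (<⇒≤ x<y)) (m≤n⇒m⊔n≡n (<⇒≤ x<y))

    norm-> : ∀ {x y} → y < x → norm x y ≡ (y , x)
    norm-> y<x = cong₂ _,_ (m≥n⇒m⊓n≡n (<⇒≤ y<x)) (m≥n⇒m⊔n≡m (<⇒≤ y<x))

    ordered∈edges : ∀ {x y} → x < y → Adj G x y → (x , y) ∈ edges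
    ordered∈edges x<y a = ∈-filter⁺ ordered? (∈-cartesianProduct⁺ (adj⇒∈ G a) (adj⇒∈ G (adj-sym G a))) (x<y , a)

    norm-cases : ∀ {x y} → Adj G x y → norm x y ≡ (x , y) ⊎ norm x y ≡ (y , x)
    norm-cases {x} {y} a with <-cmp x y
    ... | tri< x<y _ _  = inj₁ (norm-< x<y)
    ... | tri≈ _ refl _ = contradiction a (loopless G)
    ... | tri> _ _ y<x  = inj₂ (norm-> y<x)

    norm∈edges : ∀ {x y} → Adj G x y → norm x y ∈ edges
    norm∈edges {x} {y} a with <-cmp x y
    ... | tri< x<y _ _  = subst (_∈ edges) (sym (norm-< x<y)) (ordered∈edges x<y a)
    ... | tri≈ _ refl _ = contradiction a (loopless G)
    ... | tri> _ _ y<x  = subst (_∈ edges) (sym (norm-> y<x)) (ordered∈edges y<x (adj-sym G a))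

    open DecMembership (≡-dec _≟_ _≟_) using () renaming (_∈?_ to _∈ᴱ?_)

    -- The number given to non-edges; some edge must exist for the numbering to be total.
    default : Fin (length edges)
    default = index (norm∈edges (proj₂ (proj₂ has-edge)))

    position : ℕ × ℕ → Fin (length edges)
    position p with p ∈ᴱ? edges
    ... | yes p∈ = index p∈
    ... | no _   = default

    lookup-position : ∀ {p} → p ∈ edges → lookup edges (position p) ≡ p
    lookup-position {p} p∈ with p ∈ᴱ? edges
    ... | yes p∈′ = sym (lookup-index p∈′)
    ... | no p∉   = contradiction p∈ p∉

    edge-numbering : EdgeNumbering G (length edges)
    edge-numbering = record
      { number = λ x y → position (norm x y)
      ; number-sym = λ x y → cong position (cong₂ _,_ (⊓-comm x y) (⊔-comm x y))
      ; number-injective = λ a a′ eq → compare (norm-cases a) (norm-cases a′)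
          (trans (sym (lookup-position (norm∈edges a))) (trans (cong (lookup edges) eq) (lookup-position (norm∈edges a′))))
      ; number-surjective = surj
      }
      where
      compare : ∀ {x y x′ y′} → norm x y ≡ (x , y) ⊎ norm x y ≡ (y , x) → norm x′ y′ ≡ (x′ , y′) ⊎ norm x′ y′ ≡ (y′ , x′) →
                norm x y ≡ norm x′ y′ → (x ≡ x′ × y ≡ y′) ⊎ (x ≡ y′ × y ≡ x′)
      compare {x} {y} {x′} {y′} n n′ eq = go n n′
        where
        split : ∀ {p q} → norm x y ≡ p → norm x′ y′ ≡ q → proj₁ p ≡ proj₁ q × proj₂ p ≡ proj₂ q
        split e e′ = cong proj₁ p≡q , cong proj₂ p≡q
          where p≡q = trans (sym e) (trans eq e′)
        go : norm x y ≡ (x , y) ⊎ norm x y ≡ (y , x) → norm x′ y′ ≡ (x′ , y′) ⊎ norm x′ y′ ≡ (y′ , x′) → _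
        go (inj₁ e) (inj₁ e′) = inj₁ (split e e′)
        go (inj₁ e) (inj₂ e′) = inj₂ (split e e′)
        go (inj₂ e) (inj₁ e′) = inj₂ (proj₂ (split e e′) , proj₁ (split e e′))
        go (inj₂ e) (inj₂ e′) = inj₁ (proj₂ (split e e′) , proj₁ (split e e′))
      surj : ∀ c → ∃₂ λ x y → Adj G x y × position (norm x y) ≡ c
      surj c with ∈-filter⁻ ordered? {xs = cartesianProduct (vertices G) (vertices G)} (∈-lookup c)
      ... | _ , x<y , a = proj₁ (lookup edges c) , proj₂ (lookup edges c) , a ,
        lookup-unique edges-unique (trans (lookup-position (norm∈edges a)) (norm-< x<y))

-- The design formed by the affine images of the base graphs.

module CyclotomicDesign where

  open import Data.Nat as ℕ using (ℕ; suc; NonZero)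
  import Data.Nat.Properties as ℕ
  open import Data.Fin using (Fin; zero; suc; toℕ; combine; remQuot)
  open import Data.Fin.Properties using (combine-injective; combine-surjective; remQuot-combine; combine-remQuot) renaming (_≟_ to _≟ᶠ_; toℕ-injective to toℕ-injectiveᶠ; suc-injective to suc-injectiveᶠ)
  open import Data.List using (List; length; filter; allFin; lookup; tabulate)
  open import Data.List.Membership.Propositional using (_∈_)
  open import Data.List.Membership.Propositional.Properties using (∈-map⁻; ∈-filter⁺; ∈-filter⁻; ∈-allFin; ∈-lookup; ∈-tabulate⁺; ∈-tabulate⁻)
  open import Data.List.Relation.Unary.Any using (index)
  open import Data.List.Relation.Unary.Any.Properties using (lookup-index)
  open import Data.List.Relation.Unary.Unique.Propositional using (Unique)
  open import Data.List.Relation.Unary.Unique.Propositional.Properties using (filter⁺; allFin⁺; tabulate⁺)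
  open import Data.Product using (∃₂; ∃-syntax; _×_; _,_; proj₁; proj₂)
  open import Data.Sum using (_⊎_; inj₁; inj₂)
  open import Function using (_∘_)
  open import Relation.Nullary using (Dec; contradiction)
  open import Relation.Nullary.Decidable using (_×-dec_)
  open import Relation.Binary.Definitions using (tri<; tri≈; tri>)
  open import Relation.Binary.PropositionalEquality
  open import Defs
  open FiniteFields
  open CosetColouring
  open Greedy
  open GraphImages

  -- The points of the design are labelled by the field elements through `label`; `value` recovers them.
  module Translates {q} (F : FiniteField q) (s e h : ℕ) .{{se≢0 : NonZero (s ℕ.* e)}} .{{h≢0 : NonZero h}}
    (q≡ : suc (s ℕ.* e ℕ.* h) ≡ q)
    ([-1]^h : FiniteField._^_ F (FiniteField.-_ F (FiniteField.1# F)) h ≡ FiniteField.1# F)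
    (label : Fin q → ℕ) (value : ℕ → Fin q) (value-label : ∀ t → value (label t) ≡ t)
    {Γ′ : Graph} (base : Fin s → Graph) (base-≅ : ∀ i → base i ≅ Γ′)
    (label-value : ∀ i {x} → x ∈ vertices (base i) → label (value x) ≡ x)
    (numbering : ∀ i → EdgeNumbering (base i) e)
    where

    open FiniteField F
    open Field F
    open Colouring F (s ℕ.* e) h q≡
    private module Num i = EdgeNumbering (numbering i)

    module _ (base-colour : ∀ i {x y} → Adj (base i) x y → colour (value x - value y) ≡ suc (combine i (Num.number i x y)))
             where

      -- Selects one of a and - a in H. With both, each edge would be covered twice, once from each
      -- orientation of its base edge.
      IsRep : Fin q → Set
      IsRep a = a ^ h ≡ 1# × toℕ a ℕ.< toℕ (- a)

      isRep? : ∀ a → Dec (IsRep a)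
      isRep? a = (a ^ h ≟ᶠ 1#) ×-dec (toℕ a ℕ.<? toℕ (- a))

      reps : List (Fin q)
      reps = filter isRep? (allFin q)

      rep : Fin (length reps) → Fin q
      rep = lookup reps

      rep-isRep : ∀ k → IsRep (rep k)
      rep-isRep k = proj₂ (∈-filter⁻ isRep? {xs = allFin q} (∈-lookup k))

      rep-injective : ∀ {k l} → rep k ≡ rep l → k ≡ l
      rep-injective = lookup-unique (filter⁺ isRep? (allFin⁺ q))

      rep-surjective : ∀ {a} → IsRep a → ∃[ k ] rep k ≡ a
      rep-surjective {a} r = index a∈ , sym (lookup-index a∈)
        where a∈ = ∈-filter⁺ isRep? (∈-allFin a) r

      power≡1⇒≢0 : ∀ {a} → a ^ h ≡ 1# → a ≢ 0#
      power≡1⇒≢0 e refl = 1≢0 (trans (sym e) (0^ h))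

      rep≢0 : ∀ k → rep k ≢ 0#
      rep≢0 k = power≡1⇒≢0 (proj₁ (rep-isRep k))

      1-isRep : IsRep 1#
      1-isRep = 1^ h , 1<-1

      rep-neg : ∀ k l → rep k ≢ - rep l
      rep-neg k l eq = ℕ.<-asym (proj₂ (rep-isRep l)) (subst₂ (λ x y → toℕ x ℕ.< toℕ y) eq
        (trans (cong -_ eq) (-‿involutive (rep l))) (proj₂ (rep-isRep k)))

      -1≢1 : - 1# ≢ 1#
      -1≢1 e = ℕ.<⇒≢ 1<-1 (cong toℕ (sym e))

      neg≢ : ∀ {a} → a ≢ 0# → a ≢ - a
      neg≢ {a} a≢0 e = -1≢1 (*-cancelˡ a≢0 (trans (sym (-‿distribʳ-* a 1#))
        (trans (cong -_ (*-identityʳ a)) (trans (sym e) (sym (*-identityʳ a))))))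

      rep-or-neg : ∀ {a} → a ^ h ≡ 1# → IsRep a ⊎ IsRep (- a)
      rep-or-neg {a} a^h≡1 with ℕ.<-cmp (toℕ a) (toℕ (- a))
      ... | tri< lt _ _ = inj₁ (a^h≡1 , lt)
      ... | tri≈ _ eq _ = contradiction (toℕ-injectiveᶠ eq) (neg≢ (power≡1⇒≢0 a^h≡1))
      ... | tri> _ _ gt = inj₂ (Realisation.-‿^h F (s ℕ.* e) h q≡ [-1]^h a^h≡1 , subst (λ x → toℕ (- a) ℕ.< toℕ x) (sym (-‿involutive a)) gt)

      move back : Fin q → Fin q → ℕ → ℕ
      move a b x = label (a * value x + b)
      back a b u = label (a ⁻¹ * (value u - b))

      back-move : ∀ i {a} b → a ≢ 0# → ∀ {x} → x ∈ vertices (base i) → back a b (move a b x) ≡ x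
      back-move i {a} b a≢0 {x} x∈ = begin
        label (a ⁻¹ * (value (label (a * value x + b)) - b))  ≡⟨ cong (λ t → label (a ⁻¹ * (t - b))) (value-label _) ⟩
        label (a ⁻¹ * (a * value x + b - b))                  ≡⟨ cong (λ t → label (a ⁻¹ * t)) (x+y-y≡x _ b) ⟩
        label (a ⁻¹ * (a * value x))                          ≡⟨ cong label (⁻¹-cancelˡ (value x) a≢0) ⟩
        label (value x)                                       ≡⟨ label-value i x∈ ⟩
        x                                                     ∎
        where open ≡-Reasoning

      Index : Set
      Index = Fin s × Fin (length reps) × Fin q

      module Block (ix : Index) where
        i = proj₁ ix
        a = rep (proj₁ (proj₂ ix))
        b = proj₂ (proj₂ ix)
        open Image (base i) (move a b) (back a b) (back-move i b (rep≢0 (proj₁ (proj₂ ix)))) public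

        edge-form : ∀ {u w} → Adj image u w → ∃₂ λ x y → Adj (base i) x y ×
          u ≡ move a b x × w ≡ move a b y × value u ≡ a * value x + b × value w ≡ a * value y + b
        edge-form {u} {w} (u∈ , w∈ , adj) = back a b u , back a b w , adj , sym (f∘g u∈) , sym (f∘g w∈) ,
          trans (cong value (sym (f∘g u∈))) (value-label _) , trans (cong value (sym (f∘g w∈))) (value-label _)

      blk : Index → Graph
      blk = Block.image

      affine-difference : ∀ a b x y → (a * x + b) - (a * y + b) ≡ a * (x - y)
      affine-difference a b x y = trans ([x+z]-[y+z]≡x-y (a * x) (a * y) b) (sym (x[y-z]≈xy-xz a x y))

      base-difference≢0 : ∀ i {x y} → Adj (base i) x y → value x - value y ≢ 0#
      base-difference≢0 i adj e = contradiction (trans (sym (base-colour i adj)) (trans (cong colour e) colour-0)) λ ()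

      -- The colour of u - w is that of the base edge it comes from, and it names the base graph and
      -- the edge. Equal orientations then give equal multipliers and translations; opposite ones
      -- would give multipliers a and - a, which are never both representatives.
      edge-unique : ∀ {ix jx u w} → Adj (blk ix) u w → Adj (blk jx) u w → ix ≡ jx
      edge-unique {ix@(i , k , b)} {jx@(j , l , c)} {u} {w} p p′
        with Block.edge-form ix p | Block.edge-form jx p′
      ... | x , y , adj , _ , _ , u≡ , w≡ | x′ , y′ , adj′ , _ , _ , u≡′ , w≡′ = conclude
        where
        open ≡-Reasoning
        d  = value x - value y
        d′ = value x′ - value y′
        difference : value u - value w ≡ rep k * d
        difference = trans (cong₂ _-_ u≡ w≡) (affine-difference (rep k) b _ _)
        difference′ : value u - value w ≡ rep l * d′
        difference′ = trans (cong₂ _-_ u≡′ w≡′) (affine-difference (rep l) c _ _)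
        colours : suc (combine i (Num.number i x y)) ≡ suc (combine j (Num.number j x′ y′))
        colours = begin
          suc (combine i (Num.number i x y))     ≡⟨ base-colour i adj ⟨
          colour d                               ≡⟨ colour-* d (proj₁ (rep-isRep k)) ⟨
          colour (rep k * d)                     ≡⟨ cong colour (trans (sym difference) difference′) ⟩
          colour (rep l * d′)                    ≡⟨ colour-* d′ (proj₁ (rep-isRep l)) ⟩
          colour d′                              ≡⟨ base-colour j adj′ ⟩
          suc (combine j (Num.number j x′ y′))   ∎
        same : i ≡ j × Num.number i x y ≡ Num.number j x′ y′
        same = combine-injective i (Num.number i x y) j (Num.number j x′ y′) (suc-injectiveᶠ colours)
        same-block : ∀ {i j} → i ≡ j → {x y x′ y′ : ℕ} → Adj (base i) x y → Adj (base j) x′ y′ →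
          Num.number i x y ≡ Num.number j x′ y′ → (x ≡ x′ × y ≡ y′) ⊎ (x ≡ y′ × y ≡ x′)
        same-block {i} refl a a′ eq = Num.number-injective i a a′ eq
        d≢0 = base-difference≢0 i adj
        finish : (x ≡ x′ × y ≡ y′) ⊎ (x ≡ y′ × y ≡ x′) → k ≡ l × b ≡ c
        finish (inj₁ (refl , refl)) = k≡l , b≡c
          where
          k≡l : k ≡ l
          k≡l = rep-injective (*-cancelˡ d≢0 (trans (*-comm d (rep k)) (trans (sym difference) (trans difference′ (*-comm (rep l) d)))))
          b≡c : b ≡ c
          b≡c = +-cancelˡ (rep k * value x) b c (trans (sym u≡) (trans u≡′ (cong (λ k → rep k * value x + c) (sym k≡l))))
            where open import Algebra.Properties.Group +-group using () renaming (∙-cancelˡ to +-cancelˡ)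
        finish (inj₂ (refl , refl)) = contradiction (*-cancelˡ d≢0 (begin
          d * rep k               ≡⟨ *-comm d (rep k) ⟩
          rep k * d               ≡⟨ trans (sym difference) difference′ ⟩
          rep l * d′              ≡⟨ cong (rep l *_) (neg-sub (value x) (value y)) ⟨
          rep l * - d             ≡⟨ -‿distribʳ-* (rep l) d ⟨
          - (rep l * d)           ≡⟨ cong -_ (*-comm (rep l) d) ⟩
          - (d * rep l)           ≡⟨ -‿distribʳ-* d (rep l) ⟩
          d * - rep l             ∎)) (rep-neg k l)
        conclude : ix ≡ jx
        conclude = cong₂ _,_ (proj₁ same) (cong₂ _,_ (proj₁ rest) (proj₂ rest))
          where rest = finish (same-block (proj₁ same) adj adj′ (proj₂ same))

      cover-by : ∀ i {x y} → Adj (base i) x y → ∀ {a} → IsRep a → ∀ {t r} → t - r ≡ a * (value x - value y) →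
        ∃[ ix ] Adj (blk ix) (label t) (label r)
      cover-by i {x} {y} adj {a} a-rep {t} {r} eq with rep-surjective a-rep
      ... | k , refl = (i , k , b) , subst₂ (Adj (blk (i , k , b))) (cong label t≡) (cong label r≡) (Block.image-adj (i , k , b) adj)
        where
        open ≡-Reasoning
        -- The translation that takes x to t; the equation for the difference then takes y to r.
        b = t - a * value x
        t≡ : a * value x + b ≡ t
        t≡ = trans (+-comm _ _) (x-y+y≡x t (a * value x))
        r≡ : a * value y + b ≡ r
        r≡ = sym (x-y≡0⇒x≡y _ _ (begin
          r - (a * value y + b)                     ≡⟨ neg-sub _ r ⟨
          - ((a * value y + b) - r)                 ≡⟨ cong -_ (trans (cong (λ z → z - r) (sym (x-y≡z⇒ y-eq))) (-‿inverseʳ r)) ⟩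
          - 0#                                      ≡⟨ -0#≈0# ⟩
          0#                                        ∎))
          where
          y-eq : (a * value y + b) - t ≡ r - t
          y-eq = begin
            (a * value y + b) - t                         ≡⟨ cong (λ z → (a * value y + b) - z) t≡ ⟨
            (a * value y + b) - (a * value x + b)         ≡⟨ affine-difference a b _ _ ⟩
            a * (value y - value x)                       ≡⟨ cong (a *_) (neg-sub (value x) (value y)) ⟨
            a * - (value x - value y)                     ≡⟨ -‿distribʳ-* a _ ⟨
            - (a * (value x - value y))                   ≡⟨ cong -_ eq ⟨
            - (t - r)                                     ≡⟨ neg-sub t r ⟩
            r - t                                         ∎
          x-y≡z⇒ : (a * value y + b) - t ≡ r - t → r ≡ a * value y + b
          x-y≡z⇒ eq′ = trans (sym (x-y+y≡x r t)) (trans (cong (_+ t) (sym eq′)) (x-y+y≡x _ t))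

      -- Every coset is the colour of some base edge, so t - r is a base difference times an element
      -- ρ of H. If - ρ is the representative rather than ρ, the base edge is used in reverse.
      covered-by : ∀ {t r} → t ≢ r → ∃[ ix ] Adj (blk ix) (label t) (label r)
      covered-by {t} {r} t≢r with colour (t - r) in eq
      ... | zero  = contradiction (x-y≡0⇒x≡y t r (colour≡zero⇒≡0 eq)) t≢r
      ... | suc c with combine-surjective {s} {e} c
      ...   | i , l , refl with Num.number-surjective i l
      ...     | x , y , adj , refl = choose (rep-or-neg (colour-ratio d≢0 (trans eq (sym (base-colour i adj)))))
        where
        open ≡-Reasoning
        d = value x - value y
        d≢0 = base-difference≢0 i adj
        ρ = (t - r) * d ⁻¹
        ρd : t - r ≡ ρ * d
        ρd = sym (trans (*-assoc _ _ _) (trans (cong ((t - r) *_) (trans (*-comm _ _) (⁻¹-inverseʳ d≢0))) (*-identityʳ _)))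
        choose : IsRep ρ ⊎ IsRep (- ρ) → ∃[ ix ] Adj (blk ix) (label t) (label r)
        choose (inj₁ isRep) = cover-by i adj isRep ρd
        choose (inj₂ isRep) = cover-by i (adj-sym (base i) adj) isRep (begin
          t - r                            ≡⟨ ρd ⟩
          ρ * d                            ≡⟨ -‿involutive _ ⟨
          - - (ρ * d)                      ≡⟨ cong -_ (-‿distribʳ-* ρ d) ⟩
          - (ρ * - d)                      ≡⟨ -‿distribˡ-* ρ (- d) ⟩
          - ρ * - d                        ≡⟨ cong (- ρ *_) (neg-sub (value x) (value y)) ⟩
          - ρ * (value y - value x)        ∎)

      label-injective : ∀ {t r} → label t ≡ label r → t ≡ r
      label-injective {t} {r} e = trans (sym (value-label t)) (trans (cong value e) (value-label r))

      pts : List ℕ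
      pts = tabulate label

      pts-unique : Unique pts
      pts-unique = tabulate⁺ label-injective

      K = complete pts pts-unique

      blk-⊑ : ∀ ix → blk ix ⊑ K
      blk-⊑ ix = record
        { ⊑-vertices = ∈pts
        ; ⊑-adj = λ {u} {w} p → ∈pts (adj⇒∈ (blk ix) p) , ∈pts (adj⇒∈ (blk ix) (adj-sym (blk ix) {u} {w} p)) ,
                                λ { refl → loopless (blk ix) p } }
        where
        ∈pts : ∀ {u} → u ∈ vertices (blk ix) → u ∈ pts
        ∈pts u∈ with ∈-map⁻ _ u∈
        ... | x , _ , refl = ∈-tabulate⁺ _

      code : Index → Fin (s ℕ.* (length reps ℕ.* q))
      code (i , k , b) = combine i (combine k b)

      decode : Fin (s ℕ.* (length reps ℕ.* q)) → Index
      decode n = let (i , m) = remQuot (length reps ℕ.* q) n in i , remQuot q m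

      decode-code : ∀ ix → decode (code ix) ≡ ix
      decode-code (i , k , b) = trans
        (cong (λ (i′ , m) → i′ , remQuot q m) (remQuot-combine {s} {length reps ℕ.* q} i (combine k b)))
        (cong (i ,_) (remQuot-combine {length reps} {q} k b))

      decode-injective : ∀ {m n} → decode m ≡ decode n → m ≡ n
      decode-injective {m} {n} e = trans (sym (code-decode m)) (trans (cong code e) (code-decode n))
        where
        code-decode : ∀ n → code (decode n) ≡ n
        code-decode n = trans
          (cong (combine (proj₁ (remQuot {s} (length reps ℕ.* q) n))) (combine-remQuot {length reps} q (proj₂ (remQuot {s} (length reps ℕ.* q) n))))
          (combine-remQuot {s} (length reps ℕ.* q) n)

      unit : Fin (length reps)
      unit = proj₁ (rep-surjective 1-isRep)

      start : Fin s → Index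
      start i = i , unit , 0#

      -- The map with a = 1 and b = 0 fixes every vertex of the base graph, since `label` and
      -- `value` are inverse there.
      start-⊑ : ∀ i → blk (start i) ⊑ base i
      start-⊑ i = record { ⊑-vertices = ∈base ; ⊑-adj = edge }
        where
        a = rep unit
        move-fixes : ∀ {x} → x ∈ vertices (base i) → move a 0# x ≡ x
        move-fixes {x} x∈ = trans (cong label (trans (+-identityʳ _)
          (trans (cong (_* value x) (proj₂ (rep-surjective 1-isRep))) (*-identityˡ _)))) (label-value i x∈)
        ∈base : ∀ {u} → u ∈ vertices (blk (start i)) → u ∈ vertices (base i)
        ∈base u∈ with ∈-map⁻ _ u∈
        ... | x , x∈ , refl = subst (_∈ vertices (base i)) (sym (move-fixes x∈)) x∈
        edge : ∀ {u w} → Adj (blk (start i)) u w → Adj (base i) u w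
        edge {u} {w} p with Block.edge-form (start i) {u} {w} p
        ... | x , y , adj , u≡ , w≡ , _ = subst₂ (Adj (base i))
          (sym (trans u≡ (move-fixes (adj⇒∈ (base i) adj)))) (sym (trans w≡ (move-fixes (adj⇒∈ (base i) (adj-sym (base i) adj))))) adj

      -- `i₀` supplies the copy of `Γ′` inside K. Edges of the base graphs separate the blocks:
      -- equal blocks share an edge, and `edge-unique` applies.
      translates : Fin s → (∀ i → HasEdge (base i)) → Design K Γ′
      translates i₀ has-edge = record
        { Γ≼K      = blk (start i₀) , blk-⊑ (start i₀) , blk-≅ (start i₀)
        ; size     = s ℕ.* (length reps ℕ.* q)
        ; block    = blk ∘ decode
        ; distinct = λ {m} {n} (m⊑n , _) → distinct′ m n m⊑n
        ; block-⊑  = blk-⊑ ∘ decode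
        ; block-≅  = blk-≅ ∘ decode
        ; covered  = cover
        ; disjoint = λ {m} {n} {u} {w} p p′ → decode-injective (edge-unique {decode m} {decode n} {u} {w} p p′)
        }
        where
        blk-≅ : ∀ ix → blk ix ≅ Γ′
        blk-≅ ix = ≅-trans (Block.image-≅ ix) (base-≅ (proj₁ ix))
        distinct′ : ∀ m n → blk (decode m) ⊑ blk (decode n) → m ≡ n
        distinct′ m n m⊑n = decode-injective (edge-unique {decode m} {decode n} p (⊑-adj m⊑n p))
          where p = Block.image-adj (decode m) (proj₂ (proj₂ (has-edge (proj₁ (decode m)))))
        cover : ∀ {u w} → Adj K u w → ∃[ n ] Adj (blk (decode n)) u w
        cover (u∈ , w∈ , u≢w) with ∈-tabulate⁻ u∈ | ∈-tabulate⁻ w∈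
        ... | t , refl | r , refl with covered-by {t} {r} (u≢w ∘ cong label)
        ...   | ix , p = code ix , subst (λ jx → Adj (blk jx) (label t) (label r)) (sym (decode-code ix)) p

      start-link : ∀ i₀ has-edge i → block (translates i₀ has-edge) (code (start i)) ⊑ base i
      start-link i₀ has-edge i = subst (λ jx → blk jx ⊑ base i) (sym (decode-code (start i))) (start-⊑ i)

-- From a given design to a design of prime order containing its chosen subgraphs.

module Completion where

  open import Data.Nat as ℕ using (ℕ; suc; NonZero; _≤_; _<_; _!; s≤s; z≤n)
  import Data.Nat.Properties as ℕ
  open import Data.Nat.Divisibility using (_∣_; divides; ∣-trans; m∣m*n; ∣⇒≤; m≤n⇒m!∣n!)
  open import Data.Nat.Primality using (Prime)
  open import Data.Nat.Tactic.RingSolver using (solve-∀)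
  open import Data.Fin using (Fin; suc; toℕ; combine)
  open import Data.Fin.Properties using (any?; combine-injective; injective⇒≤; nonZeroIndex; toℕ-injective) renaming (_≟_ to _≟ᶠ_)
  open import Data.List using (List; length; lookup)
  open import Data.List.Properties using (length-tabulate)
  open import Data.List.Extrema.Nat using (max; xs≤max)
  open import Data.List.Membership.Propositional using (_∈_)
  open import Data.List.Membership.Propositional.Properties using (∈-map⁻; ∈-lookup)
  open import Data.List.Relation.Unary.All as All using (All)
  open import Data.List.Relation.Unary.Any using (index)
  open import Data.List.Relation.Unary.Any.Properties using (lookup-index)
  open import Data.List.Relation.Unary.Unique.Propositional using (Unique)
  open import Data.Product using (∃-syntax; Σ-syntax; _×_; _,_; proj₁; proj₂)
  open import Function using (_∘_; Equivalence)
  open import Relation.Nullary using (Dec; yes; no; ¬_; contradiction)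
  open import Relation.Binary.PropositionalEquality
  open import Defs
  open PrimesInProgression
  open FiniteFields
  open PrimeFields
  open CosetColouring
  open Greedy
  open GraphImages
  open CyclotomicDesign

  -- Names for the field elements: ψ i keeps the name of the vertex placed there, as the down-link
  -- requires, and every other element gets a number beyond all of X.
  module Labelling {q} (X : List ℕ) (X-unique : Unique X) (ψ : Fin (length X) → Fin q)
                   (ψ-injective : ∀ {i j} → ψ i ≡ ψ j → i ≡ j) (default : Fin q) where

    fresh : ℕ
    fresh = suc (max 0 X)

    label : Fin q → ℕ
    label t with any? (λ i → ψ i ≟ᶠ t)
    ... | yes (i , _) = lookup X i
    ... | no _        = fresh ℕ.+ toℕ t

    lookup≢fresh : ∀ i k → lookup X i ≢ fresh ℕ.+ k
    lookup≢fresh i k = ℕ.<⇒≢ (ℕ.<-≤-trans (s≤s (All.lookup (xs≤max 0 X) (∈-lookup i))) (ℕ.m≤m+n fresh k))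

    label-injective : ∀ {t r} → label t ≡ label r → t ≡ r
    label-injective {t} {r} e with any? (λ i → ψ i ≟ᶠ t) | any? (λ i → ψ i ≟ᶠ r)
    ... | yes (i , ψi≡t) | yes (j , ψj≡r) = trans (sym ψi≡t) (trans (cong ψ (lookup-unique X-unique e)) ψj≡r)
    ... | yes (i , _)    | no _           = contradiction e (lookup≢fresh i (toℕ r))
    ... | no _           | yes (j , _)    = contradiction (sym e) (lookup≢fresh j (toℕ t))
    ... | no _           | no _           = toℕ-injective (ℕ.+-cancelˡ-≡ fresh _ _ e)

    label-ψ : ∀ i → label (ψ i) ≡ lookup X i
    label-ψ i with any? (λ j → ψ j ≟ᶠ ψ i)
    ... | yes (j , e) = cong (lookup X) (ψ-injective e)
    ... | no none     = contradiction (i , refl) none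

    value : ℕ → Fin q
    value u with any? (λ t → label t ℕ.≟ u)
    ... | yes (t , _) = t
    ... | no _        = default

    value-label : ∀ t → value (label t) ≡ t
    value-label t with any? (λ r → label r ℕ.≟ label t)
    ... | yes (r , e) = label-injective e
    ... | no none     = contradiction (t , refl) none

    value-∈ : ∀ {x} (x∈ : x ∈ X) → value x ≡ ψ (index x∈)
    value-∈ x∈ = trans (cong value (trans (lookup-index x∈) (sym (label-ψ (index x∈))))) (value-label _)

    label-value : ∀ {x} → x ∈ X → label (value x) ≡ x
    label-value x∈ = trans (cong label (value-∈ x∈)) (trans (label-ψ (index x∈)) (sym (lookup-index x∈)))

  HasEdge-≅ : ∀ {G H} → G ≅ H → HasEdge H → HasEdge G
  HasEdge-≅ {G} {H} iso (x , y , a) = from x , from y ,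
    Equivalence.from (adj-⇔ (from-∈ x∈) (from-∈ y∈)) (subst₂ (Adj H) (sym (to∘from x∈)) (sym (to∘from y∈)) a)
    where
    open _≅_ iso
    x∈ = adj⇒∈ H a
    y∈ = adj⇒∈ H (adj-sym H a)

  HasEdge-⊑ : ∀ {G H} → G ⊑ H → HasEdge G → HasEdge H
  HasEdge-⊑ G⊑H (x , y , a) = x , y , ⊑-adj G⊑H a

  module Subdesign {Γ Γ′ : Graph} (Γ′≼Γ : Γ′ ≼ Γ) (has-edge : HasEdge Γ′)
                   {X : List ℕ} {X-unique : Unique X} (𝓑 : Design (complete X X-unique) Γ) where

    open Edges Γ′ has-edge using (edges; edge-numbering) renaming (default to edge₀)

    e = length edges
    s = size 𝓑

    private
      H = proj₁ Γ′≼Γ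
      H⊑Γ = proj₁ (proj₂ Γ′≼Γ)
      H≅Γ′ = proj₂ (proj₂ Γ′≼Γ)

      module Iso i = _≅_ (block-≅ 𝓑 i)
      module Base i = Image H (Iso.from i) (Iso.to i) (Iso.to∘from i ∘ ⊑-vertices H⊑Γ)

    -- The copy of `Γ′` inside a block: the fixed subgraph H of Γ carried over by the isomorphism
    -- between Γ and the block.
    base : Fin s → Graph
    base = Base.image

    base-≅ : ∀ i → base i ≅ Γ′
    base-≅ i = ≅-trans (Base.image-≅ i) H≅Γ′

    base-⊑ : ∀ i → base i ⊑ block 𝓑 i
    base-⊑ i = record { ⊑-vertices = vertex ; ⊑-adj = λ (u∈ , w∈ , a) → Equivalence.from (Iso.adj-⇔ i (vertex u∈) (vertex w∈)) (⊑-adj H⊑Γ a) }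
      where
      vertex : ∀ {u} → u ∈ vertices (base i) → u ∈ vertices (block 𝓑 i)
      vertex u∈ with ∈-map⁻ _ u∈
      ... | x , x∈ , refl = Iso.from-∈ i (⊑-vertices H⊑Γ x∈)

    base-∈ : ∀ i {x} → x ∈ vertices (base i) → x ∈ X
    base-∈ i = ⊑-vertices (block-⊑ 𝓑 i) ∘ ⊑-vertices (base-⊑ i)

    base-disjoint : ∀ {i j x y} → Adj (base i) x y → Adj (base j) x y → i ≡ j
    base-disjoint {i} {j} {x} {y} a a′ = disjoint 𝓑 (⊑-adj (base-⊑ i) {x} {y} a) (⊑-adj (base-⊑ j) {x} {y} a′)

    base-edge : ∀ i → HasEdge (base i)
    base-edge i = HasEdge-≅ (base-≅ i) has-edge

    numbering : ∀ i → EdgeNumbering (base i) e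
    numbering i = transport-numbering (base-≅ i) edge-numbering

    private module Num i = EdgeNumbering (numbering i)

    -- Γ has an edge through `Γ′`, hence so does K, and some block covers it. So the number of
    -- colours is positive.
    block₀ : Fin s
    block₀ = proj₁ (covered 𝓑 (proj₂ (proj₂ K-edge)))
      where
      K-edge : HasEdge (complete X X-unique)
      K-edge = HasEdge-⊑ (proj₁ (proj₂ (Γ≼K 𝓑))) (HasEdge-≅ (proj₂ (proj₂ (Γ≼K 𝓑))) (HasEdge-⊑ H⊑Γ (HasEdge-≅ H≅Γ′ has-edge)))

    -- A block is determined by the ends of any one edge of its copy, the copies being
    -- edge-disjoint. The bound depends on the order of the design alone.
    size≤ : s ≤ length X ℕ.* length X
    size≤ = injective⇒≤ {f = end-points} (λ {i} {j} eq → end-points-injective i j eq)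
      where
      x∈ : ∀ i → proj₁ (base-edge i) ∈ X
      x∈ i = base-∈ i (adj⇒∈ (base i) (proj₂ (proj₂ (base-edge i))))
      y∈ : ∀ i → proj₁ (proj₂ (base-edge i)) ∈ X
      y∈ i = base-∈ i (adj⇒∈ (base i) (adj-sym (base i) (proj₂ (proj₂ (base-edge i)))))
      end-points : Fin s → Fin (length X ℕ.* length X)
      end-points i = combine (index (x∈ i)) (index (y∈ i))
      same-index : ∀ {x y} (p : x ∈ X) (r : y ∈ X) → index p ≡ index r → x ≡ y
      same-index p r eq = trans (lookup-index p) (trans (cong (lookup X) eq) (sym (lookup-index r)))
      end-points-injective : ∀ i j → end-points i ≡ end-points j → i ≡ j
      end-points-injective i j eq with combine-injective (index (x∈ i)) (index (y∈ i)) (index (x∈ j)) (index (y∈ j)) eq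
      ... | p , r = base-disjoint (proj₂ (proj₂ (base-edge i)))
        (subst₂ (Adj (base j)) (sym (same-index (x∈ i) (x∈ j) p)) (sym (same-index (y∈ i) (y∈ j) r)) (proj₂ (proj₂ (base-edge j))))

    -- Distinct edges of the copies receive distinct colours. The remaining pairs share an arbitrary
    -- one: they are coloured only so that their ends are placed at different elements.
    pairColour : ℕ → ℕ → Fin (s ℕ.* e)
    pairColour x y with any? (λ i → adj? (base i) x y)
    ... | yes (i , _) = combine i (Num.number i x y)
    ... | no _        = combine block₀ edge₀

    pairColour-adj : ∀ i {x y} → Adj (base i) x y → pairColour x y ≡ combine i (Num.number i x y)
    pairColour-adj i {x} {y} a with any? (λ i → adj? (base i) x y)
    ... | yes (j , a′) = cong (λ j → combine j (Num.number j x y)) (base-disjoint {j} {i} a′ a)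
    ... | no none      = contradiction (i , a) none

    pairColour-sym : ∀ x y → pairColour x y ≡ pairColour y x
    pairColour-sym x y = by-edge (any? (λ i → adj? (base i) x y))
      where
      pairColour-none : ∀ {x y} → ¬ (∃[ i ] Adj (base i) x y) → pairColour x y ≡ combine block₀ edge₀
      pairColour-none {x} {y} none with any? (λ i → adj? (base i) x y)
      ... | yes some = contradiction some none
      ... | no _     = refl
      by-edge : Dec (∃[ i ] Adj (base i) x y) → pairColour x y ≡ pairColour y x
      by-edge (yes (i , a)) = trans (pairColour-adj i a)
        (trans (cong (combine i) (Num.number-sym i x y)) (sym (pairColour-adj i (adj-sym (base i) {x} {y} a))))
      by-edge (no none) = trans (pairColour-none none)
        (sym (pairColour-none λ (i , a) → none (i , adj-sym (base i) {y} {x} a)))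

    instance
      s≢0 : NonZero s
      s≢0 = nonZeroIndex block₀
      e≢0 : NonZero e
      e≢0 = nonZeroIndex edge₀
      se≢0 : NonZero (s ℕ.* e)
      se≢0 = ℕ.m*n≢0 s e

    module _ {q} (F : FiniteField q) (c : ℕ) (q≡ : suc (s ℕ.* e ℕ.* (2 ℕ.* c)) ≡ q)
             .{{2c≢0 : NonZero (2 ℕ.* c)}} (large : room (length X) (s ℕ.* e) < q) where

      open FiniteField F
      open Field F
      private
        -- H is the set of solutions of xʰ = 1, so an even h puts -1 into H.
        h = 2 ℕ.* c
        open module Col = Colouring F (s ℕ.* e) h q≡ using (colour; colour-0; 1^)

      [-1]^h : (- 1#) ^ h ≡ 1#
      [-1]^h = begin
        (- 1#) ^ h                     ≡⟨ ^-assocʳ (- 1#) 2 c ⟨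
        ((- 1#) ^ 2) ^ c               ≡⟨ cong (_^ c) square ⟩
        1# ^ c                         ≡⟨ 1^ c ⟩
        1#                             ∎
        where
        open ≡-Reasoning
        square : (- 1#) ^ 2 ≡ 1#
        square = begin
          - 1# * (- 1# * 1#)   ≡⟨ cong (- 1# *_) (*-identityʳ (- 1#)) ⟩
          - 1# * - 1#          ≡⟨ -‿distribˡ-* 1# (- 1#) ⟨
          - (1# * - 1#)        ≡⟨ cong -_ (*-identityˡ (- 1#)) ⟩
          - - 1#               ≡⟨ -‿involutive 1# ⟩
          1#                   ∎

      private
        realised : Σ[ ψ ∈ (Fin (length X) → Fin q) ] ∀ {i j : Fin (length X)} → i ≢ j →
                   colour (ψ i - ψ j) ≡ suc (pairColour (lookup X i) (lookup X j))
        realised = Realisation.realise F (s ℕ.* e) h q≡ [-1]^h (length X) large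
          (λ i j → pairColour (lookup X i) (lookup X j)) (λ i j → pairColour-sym (lookup X i) (lookup X j))
        ψ = proj₁ realised
        ψ-injective : ∀ {i j} → ψ i ≡ ψ j → i ≡ j
        ψ-injective {i} {j} eq with i ≟ᶠ j
        ... | yes i≡j = i≡j
        ... | no i≢j  = contradiction (trans (sym (proj₂ realised i≢j)) (trans (cong colour (x≡y⇒x-y≡0 eq)) colour-0)) λ ()
        open module Lab = Labelling X X-unique ψ ψ-injective 0# using (label; value; value-label; value-∈; label-value)
        module Tr = Translates F s e h q≡ [-1]^h label value value-label base base-≅ (λ i x∈ → label-value (base-∈ i x∈)) numbering

        base-colour : ∀ i {x y} → Adj (base i) x y → colour (value x - value y) ≡ suc (combine i (Num.number i x y))
        base-colour i {x} {y} a = begin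
          colour (value x - value y)                                  ≡⟨ cong colour (cong₂ _-_ (value-∈ x∈) (value-∈ y∈)) ⟩
          colour (ψ (index x∈) - ψ (index y∈))                        ≡⟨ proj₂ realised distinct-ends ⟩
          suc (pairColour (lookup X (index x∈)) (lookup X (index y∈))) ≡⟨ cong suc (cong₂ pairColour (lookup-index x∈) (lookup-index y∈)) ⟨
          suc (pairColour x y)                                        ≡⟨ cong suc (pairColour-adj i a) ⟩
          suc (combine i (Num.number i x y))                          ∎
          where
          open ≡-Reasoning
          x∈ = base-∈ i (adj⇒∈ (base i) {x} {y} a)
          y∈ = base-∈ i (adj⇒∈ (base i) {y} {x} (adj-sym (base i) {x} {y} a))
          distinct-ends : index x∈ ≢ index y∈
          distinct-ends eq = loopless (base i) (subst (Adj (base i) x)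
            (trans (lookup-index y∈) (trans (cong (lookup X) (sym eq)) (sym (lookup-index x∈)))) a)

      completion : Σ[ 𝓑′ ∈ DesignOfOrder Γ′ q ] DownLink 𝓑 (design 𝓑′)
      completion = record
        { points = Tr.pts base-colour
        ; points-unique = Tr.pts-unique base-colour
        ; points-length = length-tabulate label
        ; design = Tr.translates base-colour block₀ base-edge
        -- Each block is linked to the unmoved copy of `Γ′` chosen inside it.
        } , (λ i → Tr.code base-colour (Tr.start base-colour i)) ,
            (λ i → ⊑-trans (Tr.start-link base-colour block₀ base-edge i) (base-⊑ i))

  n∣n! : ∀ n .{{_ : NonZero n}} → n ∣ n !
  n∣n! (suc n) = m∣m*n (n !)

  -- The prime is quantified before N: for `𝓛₂` the order has to be fixed before the design, and N
  -- depends on the design.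
  SuitablePrime : ℕ → ℕ → Set
  SuitablePrime k T = ∃[ n ] Prime (suc n) × 2 < suc n × (∀ N .{{_ : NonZero N}} → N ≤ T →
    room k N < suc n × ∃[ c ] N ℕ.* (2 ℕ.* c) ≡ n)

  -- The modulus is a multiple of 2 N for every number N ≤ T of colours that can occur.
  suitable-prime : ∀ k T → SuitablePrime k T
  suitable-prime k T = unpack (prime≡1-mod m)
    where
    -- The factorial is divisible by every 2 N in question; the second factor forces p - 1, a
    -- positive multiple of m, above `room k T`.
    m = (2 ℕ.* T) ! ℕ.* suc (room k T)
    instance
      factorial≢0 : NonZero ((2 ℕ.* T) !)
      factorial≢0 = (2 ℕ.* T) ℕ.!≢0
      m≢0 : NonZero m
      m≢0 = ℕ.m*n≢0 ((2 ℕ.* T) !) (suc (room k T))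
    unpack : ∃[ p ] Prime p × 2 < p × m ∣ p ℕ.∸ 1 → SuitablePrime k T
    unpack (suc n , p-prime , 2<p , m∣n) = n , p-prime , 2<p , λ N {{N≢0}} N≤T → room<p N N≤T , multiple N {{N≢0}} N≤T
      where
      instance
        n≢0 : NonZero n
        n≢0 = ℕ.>-nonZero (ℕ.<-trans (s≤s z≤n) (ℕ.s<s⁻¹ 2<p))
      room<p : ∀ N → N ≤ T → room k N < suc n
      room<p N N≤T = s≤s (ℕ.≤-trans (room-mono k N≤T) (ℕ.≤-trans (ℕ.n≤1+n _)
        (ℕ.≤-trans (ℕ.m≤n*m (suc (room k T)) ((2 ℕ.* T) !)) (∣⇒≤ m∣n))))
      multiple : ∀ N .{{N≢0 : NonZero N}} → N ≤ T → ∃[ c ] N ℕ.* (2 ℕ.* c) ≡ n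
      multiple N {{N≢0}} N≤T with ∣-trans (n∣n! (2 ℕ.* N) {{ℕ.m*n≢0 2 N {{_}} {{N≢0}}}}) (∣-trans (m≤n⇒m!∣n! (ℕ.*-monoʳ-≤ 2 N≤T)) (∣-trans (m∣m*n (suc (room k T))) m∣n))
      ... | divides c eq = c , trans (rearrange N c) (sym eq)
        where
        rearrange : ∀ N c → N ℕ.* (2 ℕ.* c) ≡ c ℕ.* (2 ℕ.* N)
        rearrange = solve-∀

  down-linkable : (Γ Γ′ : Graph) → Γ′ ≼ Γ → HasEdge Γ′ → ∀ v → ∃[ n ] 𝓛₂ Γ Γ′ v n
  -- A design of order v has at most v² blocks, each contributing E edges, so at most v² E colours
  -- are needed.
  down-linkable Γ Γ′ Γ′≼Γ has-edge v = from-prime (suitable-prime v (v ℕ.* v ℕ.* E))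
    where
    E = length (Edges.edges Γ′ has-edge)
    from-prime : SuitablePrime v (v ℕ.* v ℕ.* E) → ∃[ n ] 𝓛₂ Γ Γ′ v n
    from-prime (n , p-prime , 2<p , suits) = suc n , link-from
      where
      link-from : 𝓛₂ Γ Γ′ v (suc n)
      link-from 𝓑 = use (suits N {{N≢0}} (subst (λ w → N ≤ w ℕ.* w ℕ.* E) (points-length 𝓑)
                          (ℕ.*-monoˡ-≤ E (Subdesign.size≤ Γ′≼Γ has-edge (design 𝓑)))))
        where
        N = size (design 𝓑) ℕ.* E
        N≢0 : NonZero N
        N≢0 = Subdesign.se≢0 Γ′≼Γ has-edge (design 𝓑)
        use : room v N < suc n × ∃[ c ] N ℕ.* (2 ℕ.* c) ≡ n → Σ[ 𝓑′ ∈ DesignOfOrder Γ′ (suc n) ] DownLink (design 𝓑) (design 𝓑′)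
        use (large , c , eq) = Subdesign.completion Γ′≼Γ has-edge (design 𝓑)
          (ModularArithmetic.primeField n p-prime 2<p) c (cong suc eq) {{2c≢0}}
          (subst (λ w → room w N < suc n) (sym (points-length 𝓑)) large)
          where
          2c≢0 : NonZero (2 ℕ.* c)
          2c≢0 = ℕ.m*n≢0⇒n≢0 N {{ℕ.>-nonZero (subst (0 <_) (sym eq) (ℕ.<-trans (s≤s z≤n) (ℕ.s<s⁻¹ 2<p)))}}

open import Data.Nat using (ℕ; NonZero)
open import Data.Product using (∃-syntax; _×_; _,_)
open import Relation.Unary using (Satisfiable)
open import Defs
open Completion using (down-linkable)

proposition3p2 : (Γ Γ′ : Graph) → Γ′ ≼ Γ → HasEdge Γ′ →
    (v : ℕ) .{{_ : NonZero v}} → DesignOfOrder Γ v →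
    Satisfiable (𝓛₁ Γ Γ′ v) × Satisfiable (𝓛₂ Γ Γ′ v)
proposition3p2 Γ Γ′ Γ′≼Γ has-edge v 𝓑 = both (down-linkable Γ Γ′ Γ′≼Γ has-edge v)
  where
  both : ∃[ n ] 𝓛₂ Γ Γ′ v n → Satisfiable (𝓛₁ Γ Γ′ v) × Satisfiable (𝓛₂ Γ Γ′ v)
  -- The same n serves both sets, the given design being one of those to which `every` applies.
  both (n , every) = (n , 𝓑 , every 𝓑) , (n , every)
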